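{- For $0<|q|<1$, \begin{align*} \overline{r}_0(1)&=\frac{J_{6}^{12}}{3J_{1,6}^7J_{2}^4J_{3,6}^2}+\frac{4J_{6}^3}{3J_{1,6}J_{2}}+\frac{J_{1,6}^5J_2^2J_{3,6}^2}{3J_{6}^6},\\ \overline{r}_1(1)&=\frac{J_{6}^{12}}{3J_{1,6}^7J_{2}^4J_{3,6}^2}-\frac{J_{1,6}^5J_2^2J_{3,6}^2}{3J_{6}^6},\\ \overline{r}_2(1)&=\frac{J_{6}^{12}}{3J_{1,6}^7J_{2}^4J_{3,6}^2}-\frac{2J_{6}^3}{3J_{1,6}J_{2}}+\frac{J_{1,6}^5J_2^2J_{3,6}^2}{3J_{6}^6},\\ \overline{r}_3(1)&=\frac{J_{6}^{12}}{3J_{1,6}^7J_{2}^4J_{3,6}^2}-\frac{J_{1,6}^5J_2^2J_{3,6}^2}{3J_{6}^6}. \end{align*}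
   Context: An overpartition of a non-negative integer $n$ is a partition of $n$ in which the first occurrence of each distinct part may be overlined; the empty overpartition of $0$ is counted and has rank $0$. The rank of an overpartition is its largest part minus its number of parts. $\overline N(s,6,n)$ is the number of overpartitions of $n$ with rank congruent to $s$ modulo $6$, and $\overline r_s(d)=\sum_{n\ge0}\overline N(s,6,3n+d)q^n$. Notation: $(a;q)_\infty=\prod_{n\ge0}(1-aq^n)$, $j(z;q)=(z;q)_\infty(q/z;q)_\infty(q;q)_\infty$, $J_{a,m}=j(q^a;q^m)$, $J_m=(q^m;q^m)_\infty$. -}

module Defs where

open import Data.Nat as ℕ using (ℕ; zero; suc; _∸_; _≤?_; _≟_)
open import Data.Integer as ℤ using (ℤ; +_; -_)
open import Data.Integer.DivMod using (_%ℕ_)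
open import Data.Bool using (Bool; true; false; if_then_else_)
open import Data.Product using (_×_; _,_; proj₁)
open import Data.List using (List; []; _∷_; map; concatMap; length; filter; replicate; upTo; foldr; _++_)
open import Relation.Nullary.Decidable using (does)

-- An overpartition is represented as a list of parts (part , overlined?)
-- in non-increasing order; within each block of equal parts only the
-- first occurrence may carry the overline flag.
Overpartition : Set
Overpartition = List (ℕ × Bool)

block : (m k : ℕ) → Bool → Overpartition
block zero    k b = []
block (suc m) k b = (k , b) ∷ replicate m (k , false)

-- ovpBounded k n : all overpartitions of n whose parts are all ≤ k
-- (each exactly once).  Multiplicity m of the part (suc k) ranges over
-- 0 … n; for m ≥ 1 the first copy is overlined or not.
ovpBounded : ℕ → ℕ → List Overpartition
ovpBounded zero zero    = [] ∷ []
ovpBounded zero (suc n) = []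
ovpBounded (suc k) n =
  ovpBounded k n ++
  concatMap
    (λ m → if does (ℕ._*_ (suc m) (suc k) ≤? n)
             then concatMap
                    (λ b → map (λ π → block (suc m) (suc k) b ++ π)
                               (ovpBounded k (n ∸ ℕ._*_ (suc m) (suc k))))
                    (false ∷ true ∷ [])
             else [])
    (upTo n)

overpartitions : ℕ → List Overpartition
overpartitions n = ovpBounded n n

largestPart : Overpartition → ℕ
largestPart []            = 0
largestPart ((k , _) ∷ _) = k

rank : Overpartition → ℤ
rank π = (+ largestPart π) ℤ.- (+ length π)

Nbar : (s m n : ℕ) → .{{_ : ℕ.NonZero m}} → ℕ
Nbar s m n = length (filter (λ π → (rank π %ℕ m) ≟ (s ℕ.% m)) (overpartitions n))

PS : Set
PS = ℕ → ℤ   -- n ↦ coefficient of q^n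

sumℤ : List ℤ → ℤ
sumℤ = foldr ℤ._+_ (+ 0)

_⊕_ : PS → PS → PS
(f ⊕ g) n = f n ℤ.+ g n

_⊖_ : PS → PS → PS
(f ⊖ g) n = f n ℤ.- g n

_·_ : ℤ → PS → PS
(c · f) n = c ℤ.* f n

_⊛_ : PS → PS → PS
(f ⊛ g) n = sumℤ (map (λ k → f k ℤ.* g (n ∸ k)) (upTo (suc n)))

infixl 6 _⊕_ _⊖_
infixl 7 _⊛_ _·_

one : PS
one zero    = + 1
one (suc _) = + 0

_^_ : PS → ℕ → PS
f ^ zero  = one
f ^ suc e = f ⊛ (f ^ e)

oneMinusQ : ℕ → PS
oneMinusQ e n = one n ℤ.- (if does (n ≟ e) then + 1 else + 0)

pochFin : (a m N : ℕ) → PS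
pochFin a m zero    = one
pochFin a m (suc N) = pochFin a m N ⊛ oneMinusQ (a ℕ.+ m ℕ.* N)

-- (q^a ; q^m)_∞ for a ≥ 1, m ≥ 1: the coefficient of q^n only depends on
-- the factors with a + m i ≤ n, all of which have i < n + 1.
poch : (a m : ℕ) → PS
poch a m n = pochFin a m (suc n) n

J′ : (a m : ℕ) → PS
J′ a m = poch a m ⊛ poch (m ∸ a) m ⊛ poch m m

J : ℕ → PS
J m = poch m m

-- multiplicative inverse of a series with constant term 1:
-- g 0 = 1,  g n = − Σ_{k=1}^{n} f k · g (n − k).
-- invRev f n = [g n , g (n−1) , … , g 0]
invRev : PS → ℕ → List ℤ
invRev f zero    = + 1 ∷ []
invRev f (suc n) = let prev = invRev f n in
  (- sumℤ (dot 1 prev)) ∷ prev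
  where
  -- prev = [g n , … , g 0]; pair g(n − i) with f(i + 1)
  dot : ℕ → List ℤ → List ℤ
  dot i []       = []
  dot i (x ∷ xs) = f i ℤ.* x ∷ dot (suc i) xs

head0 : List ℤ → ℤ
head0 []      = + 0
head0 (x ∷ _) = x

inv : PS → PS
inv f n = head0 (invRev f n)

rbar : (s d : ℕ) → PS
rbar s d n = + Nbar s 6 (3 ℕ.* n ℕ.+ d)

TA : PS
TA = (J 6 ^ 12) ⊛ inv ((J′ 1 6 ^ 7) ⊛ (J 2 ^ 4) ⊛ (J′ 3 6 ^ 2))

TB : PS
TB = (J 6 ^ 3) ⊛ inv (J′ 1 6 ⊛ J 2)

TC : PS
TC = (J′ 1 6 ^ 5) ⊛ (J 2 ^ 2) ⊛ (J′ 3 6 ^ 2) ⊛ inv (J 6 ^ 6)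

{-# OPTIONS --safe #-}
-- Let P k be the generating function Σ x^parts q^size of the overpartitions with parts ≤ k. The rank
-- generating function is R(z) = (1 - z) U(z) with U(z) = Σ_k z^k P k (1/z), and V = (1 + z) U satisfies
--   V(zq) + z²q V(z) = 1 - z²q.
-- Three steps of this give V(zq³) + z⁶q⁹ V(z) = 1 - 2z²q⁵ + 2z⁴q⁸ - z⁶q⁹, where no exponent of q is ≡ 1
-- modulo 3. So the part of V with exponents ≡ 1 modulo 3 satisfies a homogeneous equation under z ↦ zq³;
-- multiplied by the theta functions that cancel its poles it becomes a multiple of a theta function, and
-- comparing residues at z³ = q fixes the factor:
--   Σ N(m, 3n+1) z^m q^n = 2 (-q; q)(q³; q³)(-zq, -q/z; q) / ((zq, q/z; q)(z³q, z³q², q/z³, q²/z³; q³)).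
-- The theorem is the value of this product at the sixth roots of unity z. Everything is done with formal
-- coefficients indexed by ℤ × ℤ, where an expansion in another annulus differs by formal delta functions.
module Submission where

open import Defs
open import Algebra.Bundles using (CommutativeRing)
import Algebra.Properties.AbelianGroup
import Algebra.Solver.CommutativeMonoid
open import Data.Bool using (if_then_else_; true; false)
open import Data.Nat as ℕ using (ℕ; zero; suc; _∸_; _≤?_)
open import Data.Nat.Induction using (<-rec)
open import Data.Nat.DivMod using (m<n⇒m%n≡m)
import Data.Nat.Properties as ℕₚ
open import Data.Integer as ℤ using (ℤ; +_; -_; -[1+_]; _+_; _*_; _-_; _≤_; _<_; +≤+; +<+; -<+; ∣_∣)
import Data.Integer.Properties as ℤₚ
open import Data.Integer.DivMod using (_%ℕ_; _/ℕ_; n%ℕd<d; a≡a%ℕn+[a/ℕn]*n)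
open import Data.Integer.Tactic.RingSolver using (solve-∀)
open import Data.List using (List; []; _∷_; map; applyUpTo; upTo; _++_; concatMap; filter; length)
open import Data.List.Properties using (map-++; map-upTo; length-++; length-replicate)
open import Data.List.Relation.Binary.Permutation.Propositional as Perm using (_↭_; ↭-trans; ↭-refl)
open import Data.List.Relation.Binary.Permutation.Propositional.Properties using (shift)
open import Data.List.Relation.Unary.All as All using (All; []; _∷_)
open import Data.Product using (_×_; _,_; ∃-syntax)
open import Data.Sum using (inj₁; inj₂)
open import Function using (_∘_)
open import Level using (0ℓ)
open import Relation.Binary.Bundles using (Setoid)
open import Relation.Binary.Definitions using (tri<; tri≈; tri>)
open import Relation.Binary.PropositionalEquality hiding (J)
import Relation.Binary.Reasoning.Setoid
open import Relation.Nullary using (Dec; yes; no; contradiction)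
open import Relation.Nullary.Decidable using (does; dec-false)

-- One residue fixes the factor because a formal series with B(zq) = B(z)/z and no negative powers
-- of q is β(q) Σ z^m q^(m(m-1)/2): only β is free, and the value at z = q^(1/3) determines it by a
-- triangular recursion. That value is a sum along the lines m + 3n = k, and multiplication by 1 -
-- q/z³ telescopes such a sum into the residue. Roots of unity cannot be put into V, since for fixed
-- n its coefficients are constant and nonzero for large m. The factor 1 - z of the theta product is
-- therefore used to pass from V to R, where only |m| ≤ 3n occurs at the exponent 3n + 1 and the
-- sums over m are finite. Complex numbers are avoided: evaluation at z is a functional Σ κ(m) [z^m]
-- with a 6-periodic integer κ such that κ(m+1) + κ(m-1) = (z + 1/z) κ(m). The odd solutions have
-- κ(0) = 0, hence annihilate R; this yields the symmetry of the counts under s ↦ -s without a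
-- bijection.

module ℤ+ = Algebra.Properties.AbelianGroup ℤₚ.+-0-abelianGroup

-- The ring of integer power series.

infix 4 _≈_
_≈_ : PS → PS → Set
f ≈ g = ∀ n → f n ≡ g n

zeroPS : PS
zeroPS _ = + 0

negPS : PS → PS
negPS f n = - f n

tail : PS → PS
tail f n = f (suc n)

⊛-zero : ∀ f g → (f ⊛ g) 0 ≡ f 0 * g 0
⊛-zero f g = ℤₚ.+-identityʳ _

⊛-suc : ∀ f g n → (f ⊛ g) (suc n) ≡ f 0 * g (suc n) + (tail f ⊛ g) n
⊛-suc f g n = trans (cong sumℤ (map-upTo (λ k → f k * g (suc n ∸ k)) (suc (suc n))))
  (cong (_+_ (f 0 * g (suc n)))
    (cong sumℤ (sym (map-upTo (λ k → f (suc k) * g (n ∸ k)) (suc n)))))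

-- Splitting off the last term instead of the first. Together with `⊛-suc` it makes commutativity a
-- direct induction, without reversing a sum.
⊛-sucʳ : ∀ f g n → (f ⊛ g) (suc n) ≡ (f ⊛ tail g) n + f (suc n) * g 0
⊛-sucʳ f g zero = trans (⊛-suc f g 0)
  (cong₂ _+_ (sym (⊛-zero f (tail g))) (⊛-zero (tail f) g))
⊛-sucʳ f g (suc n) = begin
  (f ⊛ g) (suc (suc n)) ≡⟨ ⊛-suc f g (suc n) ⟩
  a + (tail f ⊛ g) (suc n) ≡⟨ cong (_+_ a) (⊛-sucʳ (tail f) g n) ⟩
  a + ((tail f ⊛ tail g) n + b) ≡⟨ ℤₚ.+-assoc a _ b ⟨
  a + (tail f ⊛ tail g) n + b ≡⟨ cong (_+ b) (⊛-suc f (tail g) n) ⟨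
  (f ⊛ tail g) (suc n) + b ∎
  where
  open ≡-Reasoning
  a = f 0 * g (suc (suc n))
  b = f (suc (suc n)) * g 0

⊛-cong : ∀ {f f′ g g′} → f ≈ f′ → g ≈ g′ → f ⊛ g ≈ f′ ⊛ g′
⊛-cong {f} {f′} {g} {g′} p q zero = trans (⊛-zero f g) (trans (cong₂ _*_ (p 0) (q 0)) (sym (⊛-zero f′ g′)))
⊛-cong {f} {f′} {g} {g′} p q (suc n) = trans (⊛-suc f g n) (trans
  (cong₂ _+_ (cong₂ _*_ (p 0) (q (suc n))) (⊛-cong (p ∘ suc) q n)) (sym (⊛-suc f′ g′ n)))

⊛-comm : ∀ f g → f ⊛ g ≈ g ⊛ f
⊛-comm f g zero = trans (⊛-zero f g) (trans (ℤₚ.*-comm (f 0) (g 0)) (sym (⊛-zero g f)))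
⊛-comm f g (suc n) = begin
  (f ⊛ g) (suc n) ≡⟨ ⊛-suc f g n ⟩
  f 0 * g (suc n) + (tail f ⊛ g) n ≡⟨ cong₂ _+_ (ℤₚ.*-comm (f 0) (g (suc n))) (⊛-comm (tail f) g n) ⟩
  g (suc n) * f 0 + (g ⊛ tail f) n ≡⟨ ℤₚ.+-comm _ ((g ⊛ tail f) n) ⟩
  (g ⊛ tail f) n + g (suc n) * f 0 ≡⟨ ⊛-sucʳ g f n ⟨
  (g ⊛ f) (suc n) ∎
  where open ≡-Reasoning

⊛-distribʳ : ∀ h f g → (f ⊕ g) ⊛ h ≈ f ⊛ h ⊕ g ⊛ h
⊛-distribʳ h f g zero = trans (⊛-zero (f ⊕ g) h) (trans (ℤₚ.*-distribʳ-+ (h 0) (f 0) (g 0))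
  (sym (cong₂ _+_ (⊛-zero f h) (⊛-zero g h))))
⊛-distribʳ h f g (suc n) = begin
  ((f ⊕ g) ⊛ h) (suc n) ≡⟨ ⊛-suc (f ⊕ g) h n ⟩
  (f 0 + g 0) * h (suc n) + ((tail f ⊕ tail g) ⊛ h) n ≡⟨ cong (_+_ ((f 0 + g 0) * h (suc n))) (⊛-distribʳ h (tail f) (tail g) n) ⟩
  (f 0 + g 0) * h (suc n) + ((tail f ⊛ h) n + (tail g ⊛ h) n) ≡⟨ lem (f 0) (g 0) (h (suc n)) _ _ ⟩
  (f 0 * h (suc n) + (tail f ⊛ h) n) + (g 0 * h (suc n) + (tail g ⊛ h) n)
    ≡⟨ cong₂ _+_ (⊛-suc f h n) (⊛-suc g h n) ⟨
  (f ⊛ h ⊕ g ⊛ h) (suc n) ∎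
  where
  open ≡-Reasoning
  lem : ∀ a b c x y → (a + b) * c + (x + y) ≡ (a * c + x) + (b * c + y)
  lem = solve-∀

·-⊛ : ∀ c f g → (c · f) ⊛ g ≈ c · (f ⊛ g)
·-⊛ c f g zero = trans (⊛-zero (c · f) g) (trans (ℤₚ.*-assoc c (f 0) (g 0)) (cong (c *_) (sym (⊛-zero f g))))
·-⊛ c f g (suc n) = begin
  ((c · f) ⊛ g) (suc n) ≡⟨ ⊛-suc (c · f) g n ⟩
  c * f 0 * g (suc n) + ((c · tail f) ⊛ g) n ≡⟨ cong (_+_ (c * f 0 * g (suc n))) (·-⊛ c (tail f) g n) ⟩
  c * f 0 * g (suc n) + c * (tail f ⊛ g) n ≡⟨ lem c (f 0) (g (suc n)) _ ⟩
  c * (f 0 * g (suc n) + (tail f ⊛ g) n) ≡⟨ cong (c *_) (⊛-suc f g n) ⟨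
  c * (f ⊛ g) (suc n) ∎
  where
  open ≡-Reasoning
  lem : ∀ c a b x → c * a * b + c * x ≡ c * (a * b + x)
  lem = solve-∀

⊛-assoc : ∀ f g h → (f ⊛ g) ⊛ h ≈ f ⊛ (g ⊛ h)
⊛-assoc f g h zero = begin
  ((f ⊛ g) ⊛ h) 0 ≡⟨ ⊛-zero (f ⊛ g) h ⟩
  (f ⊛ g) 0 * h 0 ≡⟨ cong (_* h 0) (⊛-zero f g) ⟩
  f 0 * g 0 * h 0 ≡⟨ ℤₚ.*-assoc (f 0) (g 0) (h 0) ⟩
  f 0 * (g 0 * h 0) ≡⟨ cong (f 0 *_) (⊛-zero g h) ⟨
  f 0 * (g ⊛ h) 0 ≡⟨ ⊛-zero f (g ⊛ h) ⟨
  (f ⊛ (g ⊛ h)) 0 ∎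
  where open ≡-Reasoning
⊛-assoc f g h (suc n) = begin
  ((f ⊛ g) ⊛ h) (suc n)
    ≡⟨ ⊛-suc (f ⊛ g) h n ⟩
  (f ⊛ g) 0 * h (suc n) + (tail (f ⊛ g) ⊛ h) n
    ≡⟨ cong₂ _+_ (cong (_* h (suc n)) (⊛-zero f g)) (⊛-cong {g = h} (⊛-suc f g) (λ _ → refl) n) ⟩
  f 0 * g 0 * h (suc n) + ((f 0 · tail g ⊕ tail f ⊛ g) ⊛ h) n
    ≡⟨ cong (_+_ (f 0 * g 0 * h (suc n))) (⊛-distribʳ h (f 0 · tail g) (tail f ⊛ g) n) ⟩
  f 0 * g 0 * h (suc n) + (((f 0 · tail g) ⊛ h) n + ((tail f ⊛ g) ⊛ h) n)
    ≡⟨ cong (_+_ (f 0 * g 0 * h (suc n))) (cong₂ _+_ (·-⊛ (f 0) (tail g) h n) (⊛-assoc (tail f) g h n)) ⟩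
  f 0 * g 0 * h (suc n) + (f 0 * (tail g ⊛ h) n + (tail f ⊛ (g ⊛ h)) n)
    ≡⟨ lem (f 0) (g 0) (h (suc n)) _ _ ⟩
  f 0 * (g 0 * h (suc n) + (tail g ⊛ h) n) + (tail f ⊛ (g ⊛ h)) n
    ≡⟨ cong (λ x → f 0 * x + (tail f ⊛ (g ⊛ h)) n) (⊛-suc g h n) ⟨
  f 0 * (g ⊛ h) (suc n) + (tail f ⊛ (g ⊛ h)) n
    ≡⟨ ⊛-suc f (g ⊛ h) n ⟨
  (f ⊛ (g ⊛ h)) (suc n) ∎
  where
  open ≡-Reasoning
  lem : ∀ a b c x y → a * b * c + (a * x + y) ≡ a * (b * c + x) + y
  lem = solve-∀

⊛-zeroˡ : ∀ f → zeroPS ⊛ f ≈ zeroPS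
⊛-zeroˡ f zero = ⊛-zero zeroPS f
⊛-zeroˡ f (suc n) = trans (⊛-suc zeroPS f n) (trans (ℤₚ.+-identityˡ _) (⊛-zeroˡ f n))

⊛-identityˡ : ∀ f → one ⊛ f ≈ f
⊛-identityˡ f zero = trans (⊛-zero one f) (ℤₚ.*-identityˡ (f 0))
⊛-identityˡ f (suc n) = trans (⊛-suc one f n)
  (trans (cong₂ _+_ (ℤₚ.*-identityˡ (f (suc n))) (⊛-zeroˡ f n)) (ℤₚ.+-identityʳ _))

dotSum : PS → ℕ → List ℤ → ℤ
dotSum f i []       = + 0
dotSum f i (x ∷ xs) = f i * x + dotSum f (suc i) xs

-- The auxiliary function of invRev cannot be named here; the abstraction
-- over its two arguments lets unification find it.
dot-dotSum : ∀ f n i xs → _ ≡ dotSum f i xs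

inv-suc′ : ∀ f n s → dotSum f 1 (invRev f n) ≡ s → inv f (suc n) ≡ - s
inv-suc′ f n s eq with invRev f n | 1
... | xs | i = cong -_ (trans (dot-dotSum f n i xs) eq)

dot-dotSum f n i []       = refl
dot-dotSum f n i (x ∷ xs) = cong (_+_ (f i * x)) (dot-dotSum f n (suc i) xs)

-- The offset `i` has to vary: it grows along the list, and each step absorbs the growth into a
-- shift of `f`.
dotSum-invRev : ∀ f i n → dotSum f i (invRev f n) ≡ ((λ k → f (k ℕ.+ i)) ⊛ inv f) n
dotSum-invRev f i zero    = refl
dotSum-invRev f i (suc n) = begin
  f i * inv f (suc n) + dotSum f (suc i) (invRev f n)
    ≡⟨ cong (_+_ (f i * inv f (suc n))) (dotSum-invRev f (suc i) n) ⟩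
  f i * inv f (suc n) + ((λ k → f (k ℕ.+ suc i)) ⊛ inv f) n
    ≡⟨ cong (_+_ (f i * inv f (suc n))) (⊛-cong {g = inv f} (λ k → cong f (ℕₚ.+-suc k i)) (λ _ → refl) n) ⟩
  f i * inv f (suc n) + ((λ k → f (suc k ℕ.+ i)) ⊛ inv f) n
    ≡⟨ ⊛-suc (λ k → f (k ℕ.+ i)) (inv f) n ⟨
  ((λ k → f (k ℕ.+ i)) ⊛ inv f) (suc n) ∎
  where open ≡-Reasoning

⊛-inverseʳ : ∀ f → f 0 ≡ + 1 → f ⊛ inv f ≈ one
⊛-inverseʳ f f0 zero = trans (⊛-zero f (inv f)) (trans (ℤₚ.*-identityʳ (f 0)) f0)
⊛-inverseʳ f f0 (suc n) = begin
  (f ⊛ inv f) (suc n) ≡⟨ ⊛-suc f (inv f) n ⟩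
  f 0 * inv f (suc n) + (tail f ⊛ inv f) n ≡⟨ cong₂ (λ x y → x * y + (tail f ⊛ inv f) n) f0
                                                    (inv-suc′ f n _ (trans (dotSum-invRev f 1 n)
                                                      (⊛-cong {g = inv f} (λ k → cong f (ℕₚ.+-comm k 1)) (λ _ → refl) n))) ⟩
  + 1 * - (tail f ⊛ inv f) n + (tail f ⊛ inv f) n ≡⟨ cong (_+ (tail f ⊛ inv f) n) (ℤₚ.*-identityˡ (- (tail f ⊛ inv f) n)) ⟩
  - (tail f ⊛ inv f) n + (tail f ⊛ inv f) n ≡⟨ ℤₚ.+-inverseˡ ((tail f ⊛ inv f) n) ⟩
  + 0 ∎
  where open ≡-Reasoning

-- An opaque copy of ⊛: unification would otherwise unfold products of series to coefficients.
opaque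
  infixl 7 _∙_
  _∙_ : PS → PS → PS
  _∙_ = _⊛_

  ∙≡⊛ : ∀ f g → f ∙ g ≡ f ⊛ g
  ∙≡⊛ f g = refl

  ∙-cong : ∀ {f f′ g g′} → f ≈ f′ → g ≈ g′ → f ∙ g ≈ f′ ∙ g′
  ∙-cong {f} {f′} {g} {g′} = ⊛-cong {f} {f′} {g} {g′}

  ∙-comm : ∀ f g → f ∙ g ≈ g ∙ f
  ∙-comm = ⊛-comm

  ∙-assoc : ∀ f g h → (f ∙ g) ∙ h ≈ f ∙ (g ∙ h)
  ∙-assoc = ⊛-assoc

  ∙-identityˡ : ∀ f → one ∙ f ≈ f
  ∙-identityˡ = ⊛-identityˡ

  ∙-distribʳ : ∀ h f g → (f ⊕ g) ∙ h ≈ f ∙ h ⊕ g ∙ h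
  ∙-distribʳ = ⊛-distribʳ

  ·-∙ : ∀ c f g → (c · f) ∙ g ≈ c · (f ∙ g)
  ·-∙ = ·-⊛

PS-commutativeRing : CommutativeRing 0ℓ 0ℓ
PS-commutativeRing = record
  { Carrier = PS ; _≈_ = _≈_ ; _+_ = _⊕_ ; _*_ = _∙_ ; -_ = negPS ; 0# = zeroPS ; 1# = one
  ; isCommutativeRing = record
    { isRing = record
      { +-isAbelianGroup = record
        { isGroup = record
          { isMonoid = record
            { isSemigroup = record
              { isMagma = record
                { isEquivalence = record
                  { refl = λ _ → refl ; sym = λ p n → sym (p n) ; trans = λ p q n → trans (p n) (q n) }
                ; ∙-cong = λ p q n → cong₂ _+_ (p n) (q n) }
              ; assoc = λ f g h n → ℤₚ.+-assoc (f n) (g n) (h n) }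
            ; identity = (λ f n → ℤₚ.+-identityˡ (f n)) , (λ f n → ℤₚ.+-identityʳ (f n)) }
          ; inverse = (λ f n → ℤₚ.+-inverseˡ (f n)) , (λ f n → ℤₚ.+-inverseʳ (f n))
          ; ⁻¹-cong = λ p n → cong -_ (p n) }
        ; comm = λ f g n → ℤₚ.+-comm (f n) (g n) }
      ; *-cong = ∙-cong
      ; *-assoc = ∙-assoc
      ; *-identity = ∙-identityˡ , λ f n → trans (∙-comm f one n) (∙-identityˡ f n)
      ; distrib = (λ f g h n → trans (∙-comm f (g ⊕ h) n) (trans (∙-distribʳ f g h n)
                    (cong₂ _+_ (∙-comm g f n) (∙-comm h f n)))) , ∙-distribʳ }
    ; *-comm = ∙-comm } }

module PS = CommutativeRing PS-commutativeRing
module PS-Reasoning = Relation.Binary.Reasoning.Setoid PS.setoid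

-- Formal coefficients in z and q, with binomial factors as operators.

F : Set
F = ℤ → ℤ → ℤ

infix 4 _≋_
_≋_ : F → F → Set
f ≋ g = ∀ m n → f m n ≡ g m n

F-setoid : Setoid 0ℓ 0ℓ
F-setoid = record { Carrier = F ; _≈_ = _≋_ ; isEquivalence = record
  { refl = λ _ _ → refl ; sym = λ p m n → sym (p m n) ; trans = λ p q m n → trans (p m n) (q m n) } }

module ≋ = Setoid F-setoid
module ≋-Reasoning = Relation.Binary.Reasoning.Setoid F-setoid

-- f m n is the coefficient of z^m q^n.
bin : (c a b : ℤ) → F → F
bin c a b f m n = f m n + c * f (m - a) (n - b)

mono : (c a b : ℤ) → F → F
mono c a b f m n = c * f (m - a) (n - b)

-- (c , a , b) stands for the factor 1 + c z^a q^b.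
Factor : Set
Factor = ℤ × ℤ × ℤ

op : List Factor → F → F
op []                 f = f
op ((c , a , b) ∷ xs) f = bin c a b (op xs f)

bin-cong : ∀ c a b {f g} → f ≋ g → bin c a b f ≋ bin c a b g
bin-cong c a b p m n = cong₂ (λ x y → x + c * y) (p m n) (p (m - a) (n - b))

mono-cong : ∀ c a b {f g} → f ≋ g → mono c a b f ≋ mono c a b g
mono-cong c a b p m n = cong (c *_) (p (m - a) (n - b))

op-cong : ∀ xs {f g} → f ≋ g → op xs f ≋ op xs g
op-cong []                 p = p
op-cong ((c , a , b) ∷ xs) p = bin-cong c a b (op-cong xs p)

sub-swap : ∀ m a a′ → m - a - a′ ≡ m - a′ - a
sub-swap = solve-∀

bin-comm : ∀ c a b c′ a′ b′ f → bin c a b (bin c′ a′ b′ f) ≋ bin c′ a′ b′ (bin c a b f)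
bin-comm c a b c′ a′ b′ f m n = trans
  (lem c c′ (f m n) (f (m - a′) (n - b′)) (f (m - a) (n - b)) (f (m - a - a′) (n - b - b′)))
  (cong (λ x → (f m n + c * f (m - a) (n - b)) + c′ * (f (m - a′) (n - b′) + c * x))
    (cong₂ f (sub-swap m a a′) (sub-swap n b b′)))
  where
  lem : ∀ c c′ x y u v → (x + c′ * y) + c * (u + c′ * v) ≡ (x + c * u) + c′ * (y + c * v)
  lem = solve-∀

mono-bin : ∀ c a b c′ a′ b′ f → mono c a b (bin c′ a′ b′ f) ≋ bin c′ a′ b′ (mono c a b f)
mono-bin c a b c′ a′ b′ f m n = trans
  (lem c c′ (f (m - a) (n - b)) (f (m - a - a′) (n - b - b′)))
  (cong (λ x → c * f (m - a) (n - b) + c′ * (c * x)) (cong₂ f (sub-swap m a a′) (sub-swap n b b′)))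
  where
  lem : ∀ c c′ x y → c * (x + c′ * y) ≡ c * x + c′ * (c * y)
  lem = solve-∀

bin-op : ∀ c a b xs f → bin c a b (op xs f) ≋ op xs (bin c a b f)
bin-op c a b []                    f = ≋.refl
bin-op c a b ((c′ , a′ , b′) ∷ xs) f =
  ≋.trans (bin-comm c a b c′ a′ b′ (op xs f)) (bin-cong c′ a′ b′ (bin-op c a b xs f))

mono-op : ∀ c a b xs f → mono c a b (op xs f) ≋ op xs (mono c a b f)
mono-op c a b []                    f = ≋.refl
mono-op c a b ((c′ , a′ , b′) ∷ xs) f =
  ≋.trans (mono-bin c a b c′ a′ b′ (op xs f)) (bin-cong c′ a′ b′ (mono-op c a b xs f))

op-comm : ∀ xs ys f → op xs (op ys f) ≋ op ys (op xs f)
op-comm []                 ys f = ≋.refl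
op-comm ((c , a , b) ∷ xs) ys f =
  ≋.trans (bin-cong c a b (op-comm xs ys f)) (bin-op c a b ys (op xs f))

op-++ : ∀ xs ys f → op (xs ++ ys) f ≋ op xs (op ys f)
op-++ []                 ys f = ≋.refl
op-++ ((c , a , b) ∷ xs) ys f = bin-cong c a b (op-++ xs ys f)

0F : F
0F _ _ = + 0

infixl 6 _⊞_
_⊞_ : F → F → F
(f ⊞ g) m n = f m n + g m n

⊞-cong : ∀ {f f′ g g′} → f ≋ f′ → g ≋ g′ → f ⊞ g ≋ f′ ⊞ g′
⊞-cong p q m n = cong₂ _+_ (p m n) (q m n)

⊞-identityʳ : ∀ f → f ⊞ 0F ≋ f
⊞-identityʳ f m n = ℤₚ.+-identityʳ (f m n)

op-⊞ : ∀ xs f g → op xs (f ⊞ g) ≋ op xs f ⊞ op xs g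
op-⊞ []                 f g = ≋.refl
op-⊞ ((c , a , b) ∷ xs) f g = ≋.trans (bin-cong c a b (op-⊞ xs f g)) λ m n →
  lem c (op xs f m n) (op xs g m n) (op xs f (m - a) (n - b)) (op xs g (m - a) (n - b))
  where
  lem : ∀ c x y u v → (x + y) + c * (u + v) ≡ (x + c * u) + (y + c * v)
  lem = solve-∀

op-0F : ∀ xs → op xs 0F ≋ 0F
op-0F []                 = ≋.refl
op-0F ((c , a , b) ∷ xs) m n = trans (bin-cong c a b (op-0F xs) m n) (trans (ℤₚ.+-identityˡ _) (ℤₚ.*-zeroʳ c))

-- z ↦ z q
σ : F → F
σ f m n = f m (n - m)

σ-factor : Factor → Factor
σ-factor (c , a , b) = c , a , b + a

σ-cong : ∀ {f g} → f ≋ g → σ f ≋ σ g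
σ-cong p m n = p m (n - m)

σ-op : ∀ xs f → σ (op xs f) ≋ op (map σ-factor xs) (σ f)
σ-op []                 f = ≋.refl
σ-op ((c , a , b) ∷ xs) f = ≋.trans
  (λ m n → cong (λ x → op xs f m (n - m) + c * op xs f (m - a) x) (lem m n a b))
  (bin-cong c a (b + a) (σ-op xs f))
  where
  lem : ∀ m n a b → n - m - b ≡ n - (b + a) - (m - a)
  lem = solve-∀

-- Finite theta products and their quasi-periodicity.

P : (ℕ → List Factor) → ℕ → F → F
P S zero    f = f
P S (suc N) f = op (S N) (P S N f)

P-cong : ∀ S N {f g} → f ≋ g → P S N f ≋ P S N g
P-cong S zero    p = p
P-cong S (suc N) p = op-cong (S N) (P-cong S N p)

P-op : ∀ S N xs f → P S N (op xs f) ≋ op xs (P S N f)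
P-op S zero    xs f = ≋.refl
P-op S (suc N) xs f = ≋.trans (op-cong (S N) (P-op S N xs f)) (op-comm (S N) xs (P S N f))

P-mono : ∀ S N c a b f → P S N (mono c a b f) ≋ mono c a b (P S N f)
P-mono S zero    c a b f = ≋.refl
P-mono S (suc N) c a b f = ≋.trans (op-cong (S N) (P-mono S N c a b f)) (≋.sym (mono-op c a b (S N) (P S N f)))

P-⊞ : ∀ S N f g → P S N (f ⊞ g) ≋ P S N f ⊞ P S N g
P-⊞ S zero    f g = ≋.refl
P-⊞ S (suc N) f g = ≋.trans (op-cong (S N) (P-⊞ S N f g)) (op-⊞ (S N) (P S N f) (P S N g))

-- σ moves X and Y in opposite directions, so it changes the product only at its two ends.
module Theta (X Y Z : ℕ → List Factor)
  (σX : ∀ i → map σ-factor (X i) ≡ X (suc i))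
  (σY : ∀ i → map σ-factor (Y (suc i)) ≡ Y i)
  (σZ : ∀ i → map σ-factor (Z i) ≡ Z i)
  (s a b : ℤ) (Y₀ : ∀ f → op (Y 0) f ≋ mono s a b (op (X 0) f)) where

  S : ℕ → List Factor
  S i = X i ++ Y (suc i) ++ Z i

  op-S : ∀ i f → op (S i) f ≋ op (X i) (op (Y (suc i)) (op (Z i) f))
  op-S i f = ≋.trans (op-++ (X i) (Y (suc i) ++ Z i) f) (op-cong (X i) (op-++ (Y (suc i)) (Z i) f))

  σ-op-S : ∀ i f → σ (op (S i) f) ≋ op (X (suc i)) (op (Y i) (op (Z i) (σ f)))
  σ-op-S i f = begin
    σ (op (S i) f) ≈⟨ σ-cong (op-S i f) ⟩
    σ (op (X i) (op (Y (suc i)) (op (Z i) f))) ≈⟨ σ-op (X i) _ ⟩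
    op (map σ-factor (X i)) (σ (op (Y (suc i)) (op (Z i) f)))
      ≡⟨ cong (λ xs → op xs (σ (op (Y (suc i)) (op (Z i) f)))) (σX i) ⟩
    op (X (suc i)) (σ (op (Y (suc i)) (op (Z i) f))) ≈⟨ op-cong (X (suc i)) (σ-op (Y (suc i)) (op (Z i) f)) ⟩
    op (X (suc i)) (op (map σ-factor (Y (suc i))) (σ (op (Z i) f)))
      ≡⟨ cong (λ xs → op (X (suc i)) (op xs (σ (op (Z i) f)))) (σY i) ⟩
    op (X (suc i)) (op (Y i) (σ (op (Z i) f))) ≈⟨ op-cong (X (suc i)) (op-cong (Y i) (σ-op (Z i) f)) ⟩
    op (X (suc i)) (op (Y i) (op (map σ-factor (Z i)) (σ f)))
      ≡⟨ cong (λ xs → op (X (suc i)) (op (Y i) (op xs (σ f)))) (σZ i) ⟩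
    op (X (suc i)) (op (Y i) (op (Z i) (σ f))) ∎
    where open ≋-Reasoning

  -- Finite form of the quasi-periodicity of a theta function. σ turns the factors X i, Y (i+1) into
  -- X (i+1), Y i. After multiplication by Y N on one side and X N on the other, both sides have the
  -- same factors except Y 0 against X 0, and `Y₀` trades these for a monomial.
  σ-P : ∀ N f → op (Y N) (σ (P S N f)) ≋ mono s a b (op (X N) (P S N (σ f)))
  σ-P zero    f = Y₀ (σ f)
  σ-P (suc N) f = begin
    op (Y (suc N)) (σ (op (S N) p)) ≈⟨ op-cong (Y (suc N)) (σ-op-S N p) ⟩
    op (Y (suc N)) (op (X (suc N)) (op (Y N) (op (Z N) (σ p))))
      ≈⟨ op-cong (Y (suc N)) (op-cong (X (suc N)) (op-comm (Y N) (Z N) (σ p))) ⟩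
    op (Y (suc N)) (op (X (suc N)) (op (Z N) (op (Y N) (σ p))))
      ≈⟨ op-cong (Y (suc N)) (op-cong (X (suc N)) (op-cong (Z N) (σ-P N f))) ⟩
    op (Y (suc N)) (op (X (suc N)) (op (Z N) (mono s a b (op (X N) r))))
      ≈⟨ op-cong (Y (suc N)) (op-cong (X (suc N)) (mono-op s a b (Z N) (op (X N) r))) ⟨
    op (Y (suc N)) (op (X (suc N)) (mono s a b (op (Z N) (op (X N) r))))
      ≈⟨ op-cong (Y (suc N)) (mono-op s a b (X (suc N)) (op (Z N) (op (X N) r))) ⟨
    op (Y (suc N)) (mono s a b (op (X (suc N)) (op (Z N) (op (X N) r))))
      ≈⟨ mono-op s a b (Y (suc N)) _ ⟨
    mono s a b (op (Y (suc N)) (op (X (suc N)) (op (Z N) (op (X N) r))))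
      ≈⟨ mono-cong s a b shuffle ⟩
    mono s a b (op (X (suc N)) (op (S N) r)) ∎
    where
    open ≋-Reasoning
    p = P S N f
    r = P S N (σ f)
    shuffle : op (Y (suc N)) (op (X (suc N)) (op (Z N) (op (X N) r))) ≋ op (X (suc N)) (op (S N) r)
    shuffle = begin
      op (Y (suc N)) (op (X (suc N)) (op (Z N) (op (X N) r))) ≈⟨ op-comm (Y (suc N)) (X (suc N)) _ ⟩
      op (X (suc N)) (op (Y (suc N)) (op (Z N) (op (X N) r)))
        ≈⟨ op-cong (X (suc N)) (op-cong (Y (suc N)) (op-comm (Z N) (X N) r)) ⟩
      op (X (suc N)) (op (Y (suc N)) (op (X N) (op (Z N) r)))
        ≈⟨ op-cong (X (suc N)) (op-comm (Y (suc N)) (X N) (op (Z N) r)) ⟩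
      op (X (suc N)) (op (X N) (op (Y (suc N)) (op (Z N) r))) ≈⟨ op-cong (X (suc N)) (op-S N r) ⟨
      op (X (suc N)) (op (S N) r) ∎

  -- The case of interest is a formal delta function h supported at zeros of X 0; every nonempty
  -- product contains X 0.
  P-kill : ∀ N {h} → op (X 0) h ≋ 0F → P S (suc N) h ≋ 0F
  P-kill zero {h} z = begin
    op (S 0) h ≈⟨ op-++ (X 0) (Y 1 ++ Z 0) h ⟩
    op (X 0) (op (Y 1 ++ Z 0) h) ≈⟨ op-comm (X 0) (Y 1 ++ Z 0) h ⟩
    op (Y 1 ++ Z 0) (op (X 0) h) ≈⟨ op-cong (Y 1 ++ Z 0) z ⟩
    op (Y 1 ++ Z 0) 0F ≈⟨ op-0F (Y 1 ++ Z 0) ⟩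
    0F ∎
    where open ≋-Reasoning
  P-kill (suc N) z = ≋.trans (op-cong (S (suc N)) (P-kill N z)) (op-0F (S (suc N)))

  -- The monomial of the theta product times the multiplier of f is z^-1 by the three numerical
  -- hypotheses. Apart from the end factors X (N+1) and Y (N+1) this says B(zq) = B(z)/z, and the
  -- coefficient of z^m in B/z is that of z^(m+1) in B.
  shift-P : ∀ {f h} s′ a′ b′ → σ f ≋ mono s′ a′ b′ f ⊞ h → op (X 0) h ≋ 0F →
    s * s′ ≡ + 1 → a + a′ ≡ - + 1 → b + b′ ≡ + 0 →
    ∀ N m n → op (Y (suc N)) (σ (P S (suc N) f)) m n ≡ op (X (suc N)) (P S (suc N) f) (m + + 1) n
  shift-P {f} {h} s′ a′ b′ eq z hs ha hb N m n = begin
    op (Y (suc N)) (σ B) m n ≡⟨ σ-P (suc N) f m n ⟩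
    mono s a b (op (X (suc N)) (P S (suc N) (σ f))) m n ≡⟨ mono-cong s a b (op-cong (X (suc N)) inner) m n ⟩
    mono s a b (op (X (suc N)) (mono s′ a′ b′ B)) m n ≡⟨ mono-cong s a b (mono-op s′ a′ b′ (X (suc N)) B) m n ⟨
    s * (s′ * op (X (suc N)) B (m - a - a′) (n - b - b′)) ≡⟨ ℤₚ.*-assoc s s′ (op (X (suc N)) B (m - a - a′) (n - b - b′)) ⟨
    s * s′ * op (X (suc N)) B (m - a - a′) (n - b - b′)
      ≡⟨ cong₂ _*_ hs (cong₂ (op (X (suc N)) B) (trans (l m a a′) (cong (_-_ m) ha)) (trans (l n b b′) (cong (_-_ n) hb))) ⟩
    + 1 * op (X (suc N)) B (m + + 1) (n - + 0)
      ≡⟨ trans (ℤₚ.*-identityˡ (op (X (suc N)) B (m + + 1) (n - + 0))) (cong (op (X (suc N)) B (m + + 1)) (ℤₚ.+-identityʳ n)) ⟩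
    op (X (suc N)) B (m + + 1) n ∎
    where
    open ≡-Reasoning
    B = P S (suc N) f
    l : ∀ m a a′ → m - a - a′ ≡ m - (a + a′)
    l = solve-∀
    inner : P S (suc N) (σ f) ≋ mono s′ a′ b′ B
    inner = ≋.trans (P-cong S (suc N) eq) (≋.trans (P-⊞ S (suc N) (mono s′ a′ b′ f) h)
      (≋.trans (⊞-cong (P-mono S (suc N) s′ a′ b′ f) (P-kill N z)) (⊞-identityʳ (mono s′ a′ b′ B))))

-- Supports, gradings and stabilisation of the products.

≤-by : ∀ {x y d} → + 0 ≤ d → y - x ≡ d → x ≤ y
≤-by p refl = ℤₚ.0≤i-j⇒j≤i p

<-by : ∀ {x y d} → + 0 < d → y - x ≡ d → x < y
<-by {x} {y} p refl = subst₂ _<_ (ℤₚ.+-identityʳ x) (lem x y) (ℤₚ.+-monoʳ-< x p)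
  where
  lem : ∀ x y → x + (y - x) ≡ y
  lem = solve-∀

<⇒0< : ∀ {x y} → x < y → + 0 < y - x
<⇒0< {x} {y} p = subst (_< y - x) (ℤₚ.+-inverseʳ x) (ℤₚ.+-monoˡ-< (- x) p)

0≤+ : ∀ n → + 0 ≤ + n
0≤+ n = +≤+ ℕ.z≤n

0<+ : ∀ {n} → + 0 < + suc n
0<+ = +<+ (ℕ.s≤s ℕ.z≤n)

≤⇒0≤ : ∀ {x y} → x ≤ y → + 0 ≤ y - x
≤⇒0≤ = ℤₚ.i≤j⇒0≤j-i

0≤+0≤ : ∀ {x y} → + 0 ≤ x → + 0 ≤ y → + 0 ≤ x + y
0≤+0≤ = ℤₚ.+-mono-≤

0<+0≤ : ∀ {x y} → + 0 < x → + 0 ≤ y → + 0 < x + y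
0<+0≤ = ℤₚ.+-mono-<-≤

-- The linear form α m + β n bounds the support of f from below.
Supp : (α β : ℤ) → F → Set
Supp α β f = ∀ m n → α * m + β * n < + 0 → f m n ≡ + 0

AtLeast : (α β w : ℤ) → Factor → Set
AtLeast α β w (_ , a , b) = w ≤ α * a + β * b

form-sub-< : ∀ {α β w m n a b} → w ≤ α * a + β * b → α * m + β * n < w → α * (m - a) + β * (n - b) < + 0
form-sub-< {α} {β} {w} {m} {n} {a} {b} p q =
  <-by (0<+0≤ (<⇒0< q) (≤⇒0≤ p)) (lem α β w m n a b)
  where
  lem : ∀ α β w m n a b → + 0 - (α * (m - a) + β * (n - b)) ≡ w - (α * m + β * n) + (α * a + β * b - w)
  lem = solve-∀

bin-stab : ∀ {α β w f m n} c a b → Supp α β f → w ≤ α * a + β * b → α * m + β * n < w → bin c a b f m n ≡ f m n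
bin-stab {α} {β} {w} {f} {m} {n} c a b s p q =
  trans (cong (λ x → f m n + c * x) (s (m - a) (n - b) (form-sub-< {α} {β} p q)))
        (trans (cong (_+_ (f m n)) (ℤₚ.*-zeroʳ c)) (ℤₚ.+-identityʳ (f m n)))

bin-supp : ∀ {α β f} c a b → Supp α β f → + 0 ≤ α * a + β * b → Supp α β (bin c a b f)
bin-supp {α} {β} {f} c a b s p m n q = trans (bin-stab {α} {β} {+ 0} {f} c a b s p q) (s m n q)

op-supp : ∀ {α β f xs} → Supp α β f → All (AtLeast α β (+ 0)) xs → Supp α β (op xs f)
op-supp s []                             = s
op-supp {α} {β} {f} {(c , a , b) ∷ xs} s (p ∷ ps) =
  bin-supp {α} {β} {op xs f} c a b (op-supp {α} {β} s ps) p

AtLeast-≤ : ∀ {α β v w xs} → v ≤ w → All (AtLeast α β w) xs → All (AtLeast α β v) xs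
AtLeast-≤ p = All.map (ℤₚ.≤-trans p)

op-stab : ∀ {α β w f m n xs} → Supp α β f → + 0 ≤ w → All (AtLeast α β w) xs → α * m + β * n < w →
          op xs f m n ≡ f m n
op-stab s 0≤w [] q = refl
op-stab {α} {β} {w} {f} {xs = (c , a , b) ∷ xs} s 0≤w (p ∷ ps) q =
  trans (bin-stab {α} {β} {w} {op xs f} c a b (op-supp {α} {β} s (AtLeast-≤ {α} {β} 0≤w ps)) p q)
        (op-stab {α} {β} s 0≤w ps q)

-- Factors of `S i` raise the grading by at least i, so each coefficient of `P S N f` is eventually
-- constant in N when f is bounded below.
Level : (α β : ℤ) → (ℕ → List Factor) → Set
Level α β S = ∀ i → All (AtLeast α β (+ i)) (S i)

P-supp : ∀ {α β S f} N → Level α β S → Supp α β f → Supp α β (P S N f)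
P-supp zero lev s = s
P-supp {α} {β} (suc N) lev s = op-supp {α} {β} (P-supp {α} {β} N lev s) (AtLeast-≤ {α} {β} (0≤+ _) (lev N))

P-stab-+ : ∀ {α β S f m n} k N → Level α β S → Supp α β f → α * m + β * n < + N → P S (k ℕ.+ N) f m n ≡ P S N f m n
P-stab-+ zero N lev s q = refl
P-stab-+ {α} {β} (suc k) N lev s q = trans
  (op-stab {α} {β} (P-supp {α} {β} (k ℕ.+ N) lev s) (0≤+ _) (lev (k ℕ.+ N))
    (ℤₚ.<-≤-trans q (+≤+ (ℕₚ.m≤n+m N k))))
  (P-stab-+ {α} {β} k N lev s q)

P-stab-≤ : ∀ {α β S f m n N N′} → N ℕ.≤ N′ → Level α β S → Supp α β f → α * m + β * n < + N →
           P S N′ f m n ≡ P S N f m n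
P-stab-≤ {α} {β} {S} {f} {m} {n} {N} {N′} p lev s q =
  trans (cong (λ k → P S k f m n) (sym (ℕₚ.m∸n+n≡m p))) (P-stab-+ {α} {β} (N′ ∸ N) N lev s q)

P-stab : ∀ {α β S f m n} N N′ → Level α β S → Supp α β f → α * m + β * n < + N → α * m + β * n < + N′ →
         P S N f m n ≡ P S N′ f m n
P-stab {α} {β} N N′ lev s q q′ with ℕₚ.≤-total N N′
... | inj₁ p = sym (P-stab-≤ {α} {β} p lev s q)
... | inj₂ p = P-stab-≤ {α} {β} p lev s q′

i<1+∣i∣ : ∀ i → i < + suc ∣ i ∣
i<1+∣i∣ (+ n)     = +<+ (ℕₚ.n<1+n n)
i<1+∣i∣ -[1+ n ]  = -<+

form01 : ∀ m n → + 0 * m + + 1 * n ≡ n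
form01 = solve-∀

lim : (ℕ → List Factor) → F → F
lim S f m n = P S (suc ∣ n ∣) f m n

P-lim : ∀ {S f m n} N → Level (+ 0) (+ 1) S → Supp (+ 0) (+ 1) f → n < + N → P S N f m n ≡ lim S f m n
P-lim {S} {f} {m} {n} N lev s q = P-stab {+ 0} {+ 1} N (suc ∣ n ∣) lev s
  (subst (_< + N) (sym (form01 m n)) q) (subst (_< + suc ∣ n ∣) (sym (form01 m n)) (i<1+∣i∣ n))

-- The end factors act trivially on a fixed coefficient once N is large, but in two gradings: `p` is
-- bounded below in n, while `σ p` is bounded below in n - m. N is taken large for both.
lim-shift : ∀ {S f} (X Y : ℕ → List Factor) → Level (+ 0) (+ 1) S → Supp (+ 0) (+ 1) f →
  Level (+ 0) (+ 1) X → Level (- + 1) (+ 1) Y →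
  (∀ N m n → op (Y (suc N)) (σ (P S (suc N) f)) m n ≡ op (X (suc N)) (P S (suc N) f) (m + + 1) n) →
  ∀ m n → lim S f m (n - m) ≡ lim S f (m + + 1) n
lim-shift {S} {f} X Y levS s levX levY rel m n = begin
  lim S f m (n - m) ≡⟨ P-lim (suc N) levS s (ℤₚ.<-≤-trans (i<1+∣i∣ (n - m)) (+≤+ (ℕ.s≤s (ℕₚ.m≤n+m ∣ n - m ∣ ∣ n ∣)))) ⟨
  σ p m n ≡⟨ op-stab { - + 1} {+ 1} {+ suc N} supp-σ (0≤+ _) (levY (suc N))
                                    (subst (_< + suc N) (sym (form m n)) (ℤₚ.<-≤-trans (i<1+∣i∣ (n - m)) (+≤+ (ℕ.s≤s (ℕₚ.m≤n+m ∣ n - m ∣ ∣ n ∣))))) ⟨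
  op (Y (suc N)) (σ p) m n ≡⟨ rel N m n ⟩
  op (X (suc N)) p (m + + 1) n ≡⟨ op-stab {+ 0} {+ 1} {+ suc N} (P-supp {+ 0} {+ 1} (suc N) levS s) (0≤+ _) (levX (suc N))
                                    (subst (_< + suc N) (sym (form01 (m + + 1) n)) n<) ⟩
  p (m + + 1) n ≡⟨ P-lim (suc N) levS s n< ⟩
  lim S f (m + + 1) n ∎
  where
  open ≡-Reasoning
  N = ∣ n ∣ ℕ.+ ∣ n - m ∣
  p = P S (suc N) f
  n< : n < + suc N
  n< = ℤₚ.<-≤-trans (i<1+∣i∣ n) (+≤+ (ℕ.s≤s (ℕₚ.m≤m+n ∣ n ∣ ∣ n - m ∣)))
  form : ∀ m n → - + 1 * m + + 1 * n ≡ n - m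
  form = solve-∀
  supp-σ : Supp (- + 1) (+ 1) (σ p)
  supp-σ m n q = P-supp {+ 0} {+ 1} (suc N) levS s m (n - m)
    (subst (_< + 0) (trans (form m n) (sym (form01 m (n - m)))) q)

-- Uniqueness for the theta shift equation.

∑ : (ℕ → ℤ) → ℕ → ℤ
∑ f zero    = + 0
∑ f (suc n) = ∑ f n + f n

∑-cong : ∀ {f g} n → (∀ i → i ℕ.< n → f i ≡ g i) → ∑ f n ≡ ∑ g n
∑-cong zero    p = refl
∑-cong (suc n) p = cong₂ _+_ (∑-cong n (λ i q → p i (ℕₚ.m<n⇒m<1+n q))) (p n (ℕₚ.n<1+n n))

∑-zero : ∀ {f} n → (∀ i → i ℕ.< n → f i ≡ + 0) → ∑ f n ≡ + 0
∑-zero zero    p = refl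
∑-zero (suc n) p = cong₂ _+_ (∑-zero n (λ i q → p i (ℕₚ.m<n⇒m<1+n q))) (p n (ℕₚ.n<1+n n))

∑-single : ∀ {f} n j → j ℕ.< n → (∀ i → i ≢ j → f i ≡ + 0) → ∑ f n ≡ f j
∑-single {f} (suc n) j j<n p with j ℕₚ.≟ n
... | yes refl = trans (cong (_+ f j) (∑-zero n (λ i q → p i (ℕₚ.<⇒≢ q)))) (ℤₚ.+-identityˡ (f j))
... | no j≢n = trans (cong₂ _+_ (∑-single n j (ℕₚ.≤∧≢⇒< (ℕₚ.≤-pred j<n) j≢n) p) (p n (j≢n ∘ sym)))
                     (ℤₚ.+-identityʳ (f j))

-- The shift equation means Δ m n = Δ 0 (n - m(m-1)/2), so Δ is a power series in q times Σ z^m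
-- q^(m(m-1)/2). The aim is that vanishing at z = q^(1/3) forces Δ = 0.
module Unique (Δ : F) (shift : ∀ m n → Δ m (n - m) ≡ Δ (m + + 1) n) (supp : Supp (+ 0) (+ 1) Δ) where

  fwd : ∀ m n → Δ (m + + 1) n ≡ Δ m (n - m)
  fwd m n = sym (shift m n)

  bwd : ∀ m n → Δ m n ≡ Δ (m + + 1) (n + m)
  bwd m n = trans (cong (Δ m) (lem m n)) (shift m (n + m))
    where
    lem : ∀ m n → n ≡ n + m - m
    lem = solve-∀

  fwd³ : ∀ m n → Δ (m + + 3) n ≡ Δ m (n - + 3 * m - + 3)
  fwd³ m n = trans (cong (λ x → Δ x n) (l1 m)) (trans (fwd (m + + 1 + + 1) n)
    (trans (fwd (m + + 1) _) (trans (fwd m _) (cong (Δ m) (l2 m n)))))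
    where
    l1 : ∀ m → m + + 3 ≡ m + + 1 + + 1 + + 1
    l1 = solve-∀
    l2 : ∀ m n → n - (m + + 1 + + 1) - (m + + 1) - m ≡ n - + 3 * m - + 3
    l2 = solve-∀

  bwd³ : ∀ m n → Δ m n ≡ Δ (m + + 3) (n + + 3 * m + + 3)
  bwd³ m n = trans (cong (Δ m) (l m n)) (sym (fwd³ m (n + + 3 * m + + 3)))
    where
    l : ∀ m n → n ≡ n + + 3 * m + + 3 - + 3 * m - + 3
    l = solve-∀

  -- Here s = 3d(3d - 1)/2; only s ≥ 0 matters later.
  pos-multiple : ∀ d → ∃[ s ] ∀ x → Δ (+ 3 * + d) x ≡ Δ (+ 0) (x - + s)
  pos-multiple zero    = 0 , λ x → cong (Δ (+ 0)) (sym (ℤₚ.+-identityʳ x))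
  pos-multiple (suc d) with pos-multiple d
  ... | s , eq = s ℕ.+ 9 ℕ.* d ℕ.+ 3 , λ x → begin
    Δ (+ 3 * + suc d) x ≡⟨ cong (λ y → Δ y x) (l1 (+ d)) ⟩
    Δ (+ 3 * + d + + 3) x ≡⟨ fwd³ (+ 3 * + d) x ⟩
    Δ (+ 3 * + d) (x - + 3 * (+ 3 * + d) - + 3) ≡⟨ eq _ ⟩
    Δ (+ 0) (x - + 3 * (+ 3 * + d) - + 3 - + s) ≡⟨ cong (Δ (+ 0)) (trans (l2 x (+ d) (+ s))
                                                 (cong (λ y → x - (+ s + y + + 3)) (sym (ℤₚ.pos-* 9 d)))) ⟩
    Δ (+ 0) (x - + (s ℕ.+ 9 ℕ.* d ℕ.+ 3)) ∎
    where
    open ≡-Reasoning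
    l1 : ∀ d → + 3 * (+ 1 + d) ≡ + 3 * d + + 3
    l1 = solve-∀
    l2 : ∀ x d s → x - + 3 * (+ 3 * d) - + 3 - s ≡ x - (s + + 9 * d + + 3)
    l2 = solve-∀

  -- Here s = 3e(3e + 1)/2. The weak bound 2e ≤ s suffices in `off-diagonal`, where it outweighs the
  -- excess e of the exponent of q.
  neg-multiple : ∀ e → ∃[ s ] 2 ℕ.* e ℕ.≤ s × (∀ x → Δ (- (+ 3 * + e)) x ≡ Δ (+ 0) (x - + s))
  neg-multiple zero    = 0 , ℕ.z≤n , λ x → cong (Δ (+ 0)) (sym (ℤₚ.+-identityʳ x))
  neg-multiple (suc e) with neg-multiple e
  ... | s , 2e≤s , eq = s ℕ.+ (9 ℕ.* e ℕ.+ 6)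
    , subst (ℕ._≤ s ℕ.+ (9 ℕ.* e ℕ.+ 6)) (sym (ℕₚ.*-suc 2 e)) (subst (ℕ._≤ s ℕ.+ (9 ℕ.* e ℕ.+ 6)) (ℕₚ.+-comm (2 ℕ.* e) 2)
        (ℕₚ.+-mono-≤ 2e≤s (ℕₚ.≤-trans (ℕₚ.m≤m+n 2 4) (ℕₚ.m≤n+m 6 (9 ℕ.* e)))))
    , λ x → begin
    Δ (- (+ 3 * + suc e)) x ≡⟨ bwd³ _ x ⟩
    Δ (- (+ 3 * + suc e) + + 3) (x + + 3 * - (+ 3 * + suc e) + + 3) ≡⟨ cong₂ Δ (l1 (+ e)) refl ⟩
    Δ (- (+ 3 * + e)) (x + + 3 * - (+ 3 * + suc e) + + 3) ≡⟨ eq _ ⟩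
    Δ (+ 0) (x + + 3 * - (+ 3 * + suc e) + + 3 - + s) ≡⟨ cong (Δ (+ 0)) (trans (l2 x (+ e) (+ s))
                                                 (cong (λ y → x - (+ s + (y + + 6))) (sym (ℤₚ.pos-* 9 e)))) ⟩
    Δ (+ 0) (x - + (s ℕ.+ (9 ℕ.* e ℕ.+ 6))) ∎
    where
    open ≡-Reasoning
    l1 : ∀ e → - (+ 3 * (+ 1 + e)) + + 3 ≡ - (+ 3 * e)
    l1 = solve-∀
    l2 : ∀ x e s → x + + 3 * - (+ 3 * (+ 1 + e)) + + 3 - s ≡ x - (s + (+ 9 * e + + 6))
    l2 = solve-∀

  Δ-neg : ∀ x → x < + 0 → Δ (+ 0) x ≡ + 0
  Δ-neg x p = supp (+ 0) x (subst (_< + 0) (sym (form01 (+ 0) x)) p)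

  below : ∀ J → (∀ {j} → j ℕ.< J → Δ (+ 0) (+ j) ≡ + 0) → ∀ x → x < + J → Δ (+ 0) x ≡ + 0
  below J ih (+ j)    (+<+ p) = ih p
  below J ih -[1+ j ] p       = Δ-neg -[1+ j ] -<+

  line : ℕ → ℕ → ℤ
  line k i = Δ (+ k - + 3 * + i) (+ i)

  -- On the line m + 3n = 3J, the shift equation carries every entry with n ≠ J to some Δ 0 x with x
  -- < J, which the induction hypothesis kills. So the line sums form a triangular system with
  -- diagonal entries Δ 0 J.
  off-diagonal : ∀ J → (∀ {j} → j ℕ.< J → Δ (+ 0) (+ j) ≡ + 0) → ∀ i → i ≢ J → line (3 ℕ.* J) i ≡ + 0
  off-diagonal J ih i i≢J with ℕₚ.<-cmp i J
  ... | tri≈ _ i≡J _ = contradiction i≡J i≢J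
  ... | tri< i<J _ _ with pos-multiple (J ∸ i)
  ...   | s , eq = begin
    Δ (+ (3 ℕ.* J) - + 3 * + i) (+ i) ≡⟨ cong (λ x → Δ x (+ i)) index ⟩
    Δ (+ 3 * + (J ∸ i)) (+ i) ≡⟨ eq (+ i) ⟩
    Δ (+ 0) (+ i - + s) ≡⟨ below J ih _ (ℤₚ.≤-<-trans (ℤₚ.i-j≤i (+ i) (+ s)) (+<+ i<J)) ⟩
    + 0 ∎
    where
    open ≡-Reasoning
    l : ∀ d i → + 3 * (d + i) - + 3 * i ≡ + 3 * d
    l = solve-∀
    index : + (3 ℕ.* J) - + 3 * + i ≡ + 3 * + (J ∸ i)
    index = trans (cong (_- + 3 * + i) (trans (ℤₚ.pos-* 3 J) (cong (λ x → + 3 * + x) (sym (ℕₚ.m∸n+n≡m (ℕₚ.<⇒≤ i<J))))))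
                  (l (+ (J ∸ i)) (+ i))
  off-diagonal J ih i i≢J | tri> _ _ J<i with neg-multiple (i ∸ J)
  ...   | s , 2e≤s , eq = begin
    Δ (+ (3 ℕ.* J) - + 3 * + i) (+ i) ≡⟨ cong (λ x → Δ x (+ i)) index ⟩
    Δ (- (+ 3 * + (i ∸ J))) (+ i) ≡⟨ eq (+ i) ⟩
    Δ (+ 0) (+ i - + s) ≡⟨ below J ih _ (<-by (0<+0≤ (+<+ (ℕₚ.m<n⇒0<n∸m J<i)) (≤⇒0≤ (+≤+ 2e≤s)))
                                               (trans (cong (λ x → + J - (+ x - + s)) (sym i≡)) (trans (l2 (+ (i ∸ J)) (+ J) (+ s))
                                                 (cong (λ x → + (i ∸ J) + (+ s - x)) (sym (ℤₚ.pos-* 2 (i ∸ J))))))) ⟩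
    + 0 ∎
    where
    open ≡-Reasoning
    i≡ : i ∸ J ℕ.+ J ≡ i
    i≡ = ℕₚ.m∸n+n≡m (ℕₚ.<⇒≤ J<i)
    l : ∀ e J → + 3 * J - + 3 * (e + J) ≡ - (+ 3 * e)
    l = solve-∀
    l2 : ∀ e J s → J - (e + J - s) ≡ e + (s - + 2 * e)
    l2 = solve-∀
    index : + (3 ℕ.* J) - + 3 * + i ≡ - (+ 3 * + (i ∸ J))
    index = trans (cong₂ (λ x y → x - + 3 * + y) (ℤₚ.pos-* 3 J) (sym i≡)) (l (+ (i ∸ J)) (+ J))

  Zero : ℤ → Set
  Zero m = ∀ n → Δ m n ≡ + 0

  Zero-suc : ∀ m → Zero m → Zero (m + + 1)
  Zero-suc m z n = trans (fwd m n) (z (n - m))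

  Zero-pred : ∀ m → Zero (m + + 1) → Zero m
  Zero-pred m z n = trans (bwd m n) (z (n + m))

  Zero-all : Zero (+ 0) → ∀ m → Zero m
  Zero-all z (+ zero)      = z
  Zero-all z (+ suc m)     = subst Zero (cong (+_) (ℕₚ.+-comm m 1)) (Zero-suc (+ m) (Zero-all z (+ m)))
  Zero-all z -[1+ zero ]   = Zero-pred -[1+ 0 ] z
  Zero-all z -[1+ suc m ]  = Zero-pred -[1+ suc m ] (Zero-all z -[1+ m ])

  vanish : (∀ k → ∃[ N ] k ℕ.< N × ∑ (line k) N ≡ + 0) → Δ ≋ 0F
  vanish sums = Zero-all λ n → below (suc ∣ n ∣) (λ {j} _ → diagonal j) n (i<1+∣i∣ n)
    where
    diagonal : ∀ J → Δ (+ 0) (+ J) ≡ + 0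
    diagonal = <-rec _ λ J ih → let N , k<N , eq = sums (3 ℕ.* J) in begin
      Δ (+ 0) (+ J) ≡⟨ cong (λ x → Δ x (+ J)) (index J) ⟨
      -- The index J lies in the range of summation because J ≤ 3J < N.
      line (3 ℕ.* J) J ≡⟨ ∑-single N J (ℕₚ.≤-<-trans (ℕₚ.m≤n*m J 3) k<N) (off-diagonal J ih) ⟨
      ∑ (line (3 ℕ.* J)) N ≡⟨ eq ⟩
      + 0 ∎
      where
      open ≡-Reasoning
      index : ∀ J → + (3 ℕ.* J) - + 3 * + J ≡ + 0
      index J = trans (cong (_- + 3 * + J) (ℤₚ.pos-* 3 J)) (ℤₚ.+-inverseʳ (+ 3 * + J))

∑-- : ∀ f g n → ∑ (λ i → f i - g i) n ≡ ∑ f n - ∑ g n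
∑-- f g zero    = refl
∑-- f g (suc n) = trans (cong (_+ (f n - g n)) (∑-- f g n)) (l (∑ f n) (∑ g n) (f n) (g n))
  where
  l : ∀ a b c d → a - b + (c - d) ≡ a + c - (b + d)
  l = solve-∀

-- The sum over m + 3n = k is the coefficient of q^(k/3) in the value at z = q^(1/3). The infinite
-- sum is encoded as partial sums that are eventually constant.
LineSum : F → (ℕ → ℤ) → Set
LineSum f b = ∀ k → ∃[ n₀ ] ∀ N → n₀ ℕ.≤ N → ∑ (λ i → f (+ k - + 3 * + i) (+ i)) (suc N) ≡ b k

shift-unique : ∀ {B C b c} →
  (∀ m n → B m (n - m) ≡ B (m + + 1) n) → (∀ m n → C m (n - m) ≡ C (m + + 1) n) →
  Supp (+ 0) (+ 1) B → Supp (+ 0) (+ 1) C → LineSum B b → LineSum C c → (∀ k → b k ≡ c k) → B ≋ C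
shift-unique {B} {C} {b} {c} hB hC sB sC lB lC eq m n = ℤₚ.i-j≡0⇒i≡j (B m n) (C m n) (U.vanish sums m n)
  where
  Δ : F
  Δ m n = B m n - C m n
  module U = Unique Δ (λ m n → cong₂ _-_ (hB m n) (hC m n)) (λ m n q → cong₂ _-_ (sB m n q) (sC m n q))
  sums : ∀ k → ∃[ N ] k ℕ.< N × ∑ (U.line k) N ≡ + 0
  sums k with lB k | lC k
  ... | n₁ , h₁ | n₂ , h₂ = suc M , ℕ.s≤s (ℕₚ.m≤m+n k (n₁ ℕ.+ n₂)) , trans
    (∑-- (λ i → B (+ k - + 3 * + i) (+ i)) (λ i → C (+ k - + 3 * + i) (+ i)) (suc M))
    (ℤₚ.i≡j⇒i-j≡0 (trans (h₁ M (ℕₚ.≤-trans (ℕₚ.m≤m+n n₁ n₂) (ℕₚ.m≤n+m (n₁ ℕ.+ n₂) k))) (trans (eq k)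
      (sym (h₂ M (ℕₚ.≤-trans (ℕₚ.m≤n+m n₂ n₁) (ℕₚ.m≤n+m (n₁ ℕ.+ n₂) k)))))))
    where
    M = k ℕ.+ (n₁ ℕ.+ n₂)

-- Residues at z³ = q.

↑ : PS → ℤ → ℤ
↑ f (+ n)    = f n
↑ f -[1+ _ ] = + 0

↑-cong : ∀ {φ ψ} → φ ≈ ψ → ∀ k → ↑ φ k ≡ ↑ ψ k
↑-cong e (+ n)    = e n
↑-cong e -[1+ n ] = refl

X^ : ℕ → PS
X^ e n = if does (n ℕₚ.≟ e) then + 1 else + 0

onePlus : ℤ → ℕ → PS
onePlus c e = one ⊕ c · X^ e

tail-X^ : ∀ e → tail (X^ (suc e)) ≈ X^ e
tail-X^ e n with n ℕₚ.≟ e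
... | yes refl = refl
... | no _     = refl

shiftPS : ∀ e f n → (X^ e ⊛ f) n ≡ ↑ f (+ n - + e)
shiftPS zero f n = trans (⊛-cong {g = f} X^0 (λ _ → refl) n)
    (trans (⊛-identityˡ f n) (cong (↑ f) (sym (ℤₚ.+-identityʳ (+ n)))))
  where
  X^0 : X^ 0 ≈ one
  X^0 zero    = refl
  X^0 (suc n) = refl
shiftPS (suc e) f zero    = trans (⊛-zero (X^ (suc e)) f) (ℤₚ.*-zeroˡ (f 0))
shiftPS (suc e) f (suc n) = begin
  (X^ (suc e) ⊛ f) (suc n) ≡⟨ ⊛-suc (X^ (suc e)) f n ⟩
  + 0 * f (suc n) + (tail (X^ (suc e)) ⊛ f) n ≡⟨ cong₂ _+_ (ℤₚ.*-zeroˡ (f (suc n))) (⊛-cong {g = f} (tail-X^ e) (λ _ → refl) n) ⟩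
  + 0 + (X^ e ⊛ f) n ≡⟨ ℤₚ.+-identityˡ ((X^ e ⊛ f) n) ⟩
  (X^ e ⊛ f) n ≡⟨ shiftPS e f n ⟩
  ↑ f (+ n - + e) ≡⟨ cong (↑ f) (l (+ n) (+ e)) ⟩
  ↑ f (+ suc n - + suc e) ∎
  where
  open ≡-Reasoning
  l : ∀ n e → n - e ≡ + 1 + n - (+ 1 + e)
  l = solve-∀

neg-sub : ∀ n e → ∃[ k ] -[1+ n ] - + e ≡ -[1+ k ]
neg-sub n zero    = n , refl
neg-sub n (suc e) = suc (n ℕ.+ e) , refl

onePlus-∙ : ∀ c e f k → ↑ (f ∙ onePlus c e) k ≡ ↑ f k + c * ↑ f (k - + e)
onePlus-∙ c e f (+ n) = begin
  (f ∙ onePlus c e) n ≡⟨ cong (λ h → h n) (∙≡⊛ f (onePlus c e)) ⟩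
  (f ⊛ onePlus c e) n ≡⟨ ⊛-comm f (onePlus c e) n ⟩
  (onePlus c e ⊛ f) n ≡⟨ ⊛-distribʳ f one (c · X^ e) n ⟩
  (one ⊛ f) n + ((c · X^ e) ⊛ f) n ≡⟨ cong₂ _+_ (⊛-identityˡ f n) (trans (·-⊛ c (X^ e) f n) (cong (c *_) (shiftPS e f n))) ⟩
  f n + c * ↑ f (+ n - + e) ∎
  where open ≡-Reasoning
onePlus-∙ c e f -[1+ n ] with -[1+ n ] - + e | neg-sub n e
... | _ | k , refl = sym (trans (ℤₚ.+-identityˡ (c * + 0)) (ℤₚ.*-zeroʳ c))

-- For the expansion f of a meromorphic function, φ (q^(1/3)) is the residue at the pole z³ = q.
Tends : F → PS → Set
Tends f φ = ∀ k → ∃[ n₀ ] ∀ n → + n₀ ≤ n → f (k - + 3 * n) n ≡ ↑ φ k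

-- On z³ = q the factor 1 + c z^a q^b takes the value 1 + c q^(e/3); the variable of φ stands for
-- q^(1/3).
Tends-bin : ∀ {f φ} c a b e → a + + 3 * b ≡ + e → Tends f φ → Tends (bin c a b f) (φ ∙ onePlus c e)
Tends-bin {f} {φ} c a b e w t k with t k | t (k - + e)
... | n₁ , p₁ | n₂ , p₂ = n₁ ℕ.+ (n₂ ℕ.+ ∣ b ∣) , λ n q → trans
  (cong₂ (λ x y → x + c * y)
    (p₁ n (ℤₚ.≤-trans (+≤+ (ℕₚ.m≤m+n n₁ (n₂ ℕ.+ ∣ b ∣))) q))
    (trans (cong (λ x → f x (n - b)) (trans (l k n a b) (cong (λ x → k - x - + 3 * (n - b)) w)))
      (p₂ (n - b) (≤-by (0≤+0≤ (≤⇒0≤ q) (0≤+0≤ (0≤+ n₁) (≤⇒0≤ (b≤∣b∣ b)))) (l₂ n (+ n₁) (+ n₂) (+ ∣ b ∣) b)))))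
  (sym (onePlus-∙ c e φ k))
  where
  l : ∀ k n a b → k - + 3 * n - a ≡ k - (a + + 3 * b) - + 3 * (n - b)
  l = solve-∀
  l₂ : ∀ n n₁ n₂ B b → n - b - n₂ ≡ n - (n₁ + (n₂ + B)) + (n₁ + (B - b))
  l₂ = solve-∀
  b≤∣b∣ : ∀ b → b ≤ + ∣ b ∣
  b≤∣b∣ (+ n)     = ℤₚ.≤-refl
  b≤∣b∣ -[1+ n ]  = ℤ.-≤+

Tends-cong : ∀ {f φ ψ} → φ ≈ ψ → Tends f φ → Tends f ψ
Tends-cong {f} {φ} {ψ} p t k with t k
... | n₀ , h = n₀ , λ n q → trans (h n q) (↑-cong p k)

prod : (ℕ → PS) → ℕ → PS
prod f zero    = one
prod f (suc N) = prod f N ∙ f N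

lineSeries : List (ℤ × ℕ) → PS
lineSeries []             = one
lineSeries ((c , e) ∷ xs) = lineSeries xs ∙ onePlus c e

data AtLine : List Factor → List (ℤ × ℕ) → Set where
  []  : AtLine [] []
  _∷_ : ∀ {c a b e xs ys} → a + + 3 * b ≡ + e → AtLine xs ys → AtLine ((c , a , b) ∷ xs) ((c , e) ∷ ys)

Tends-op : ∀ {f φ xs ys} → AtLine xs ys → Tends f φ → Tends (op xs f) (φ ∙ lineSeries ys)
Tends-op {f} {φ} [] t = Tends-cong {f} (λ n → sym (PS.*-identityʳ φ n)) t
Tends-op {f} {φ} (_∷_ {c} {a} {b} {e} {xs} {ys} w ws) t =
  Tends-cong {bin c a b (op xs f)} (∙-assoc φ (lineSeries ys) (onePlus c e)) (Tends-bin {op xs f} c a b e w (Tends-op {f} ws t))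

Tends-P : ∀ {S f φ} {W : ℕ → List (ℤ × ℕ)} N → (∀ i → AtLine (S i) (W i)) → Tends f φ →
          Tends (P S N f) (φ ∙ prod (λ i → lineSeries (W i)) N)
Tends-P {S} {f} {φ} zero    w t = Tends-cong {f} (λ n → sym (PS.*-identityʳ φ n)) t
Tends-P {S} {f} {φ} {W} (suc N) w t = Tends-cong {op (S N) (P S N f)}
  (∙-assoc φ (prod (λ i → lineSeries (W i)) N) (lineSeries (W N)))
  (Tends-op {P S N f} (w N) (Tends-P {S} {f} N w t))

-- Multiplication by 1 - q/z³ makes each entry on the line cancel against its predecessor, and below
-- n = 0 there is none. What survives is the last entry, whose limit is the residue of `f`.
telescope : ∀ f → Supp (+ 0) (+ 1) f → ∀ k N →
  ∑ (λ i → bin (- + 1) (- + 3) (+ 1) f (k - + 3 * + i) (+ i)) (suc N) ≡ f (k - + 3 * + N) (+ N)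
telescope f s k zero = trans (ℤₚ.+-identityˡ _)
  (bin-stab {+ 0} {+ 1} {+ 1} {f} (- + 1) (- + 3) (+ 1) s (+≤+ ℕₚ.≤-refl)
    (subst (_< + 1) (sym (form01 (k - + 3 * + 0) (+ 0))) 0<+))
telescope f s k (suc N) = trans (cong₂ (λ x y → x + (f (k - + 3 * + suc N) (+ suc N) + - + 1 * y)) (telescope f s k N)
    (cong₂ f (l k (+ N)) refl)) (l₂ (f (k - + 3 * + N) (+ N)) (f (k - + 3 * + suc N) (+ suc N)))
  where
  l : ∀ k N → k - + 3 * (+ 1 + N) - (- + 3) ≡ k - + 3 * N
  l = solve-∀
  l₂ : ∀ x y → x + (y + - + 1 * x) ≡ y
  l₂ = solve-∀

form13 : ∀ k n → + 1 * (k - + 3 * n) + + 3 * n ≡ k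
form13 = solve-∀

-- In the grading m + 3n the whole line has degree k, so the truncation after k + 1 blocks is right
-- for all i at once, although `lim` truncates at a level that grows with i.
line-lim : ∀ {S f} k i → Level (+ 0) (+ 1) S → Level (+ 1) (+ 3) S → Supp (+ 0) (+ 1) f → Supp (+ 1) (+ 3) f →
  lim S f (+ k - + 3 * + i) (+ i) ≡ P S (suc k) f (+ k - + 3 * + i) (+ i)
line-lim {S} {f} k i lev lev′ s s′ = trans
  (sym (P-lim (suc (i ℕ.+ k)) lev s (+<+ (ℕ.s≤s (ℕₚ.m≤m+n i k)))))
  (P-stab {+ 1} {+ 3} (suc (i ℕ.+ k)) (suc k) lev′ s′
    (subst (_< + suc (i ℕ.+ k)) (sym (form13 (+ k) (+ i))) (+<+ (ℕ.s≤s (ℕₚ.m≤n+m k i))))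
    (subst (_< + suc k) (sym (form13 (+ k) (+ i))) (+<+ (ℕₚ.n<1+n k))))

line-sum : ∀ {S f f° φ} k → Level (+ 0) (+ 1) S → Level (+ 1) (+ 3) S → Supp (+ 0) (+ 1) f → Supp (+ 1) (+ 3) f →
  Supp (+ 0) (+ 1) f° → bin (- + 1) (- + 3) (+ 1) f° ≋ P S (suc k) f → Tends f° φ →
  ∃[ n₀ ] ∀ N → n₀ ℕ.≤ N → ∑ (λ i → lim S f (+ k - + 3 * + i) (+ i)) (suc N) ≡ φ k
line-sum {S} {f} {f°} k lev lev′ s s′ s° eq t with t (+ k)
... | n₀ , h = n₀ , λ N q → trans
  (∑-cong (suc N) (λ i _ → trans (line-lim k i lev lev′ s s′) (sym (eq (+ k - + 3 * + i) (+ i)))))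
  (trans (telescope f° s° (+ k) N) (h (+ N) (+≤+ q)))

-- Overpartitions with bounded parts.

ε : ℤ → ℤ
ε (+ zero)  = + 1
ε (+ suc _) = + 0
ε -[1+ _ ]  = + 0

δ : F
δ m n = ε m * ε n

∑-extend : ∀ {f M N} → M ℕ.≤ N → (∀ i → M ℕ.≤ i → f i ≡ + 0) → ∑ f N ≡ ∑ f M
∑-extend {f} {M} {N} M≤N z = trans (cong (∑ f) (sym (ℕₚ.m∸n+n≡m M≤N))) (go (N ∸ M))
  where
  go : ∀ d → ∑ f (d ℕ.+ M) ≡ ∑ f M
  go zero    = refl
  go (suc d) = trans (cong₂ _+_ (go d) (z (d ℕ.+ M) (ℕₚ.m≤n+m M d))) (ℤₚ.+-identityʳ (∑ f M))

∑-head : ∀ f n → ∑ f (suc n) ≡ f 0 + ∑ (f ∘ suc) n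
∑-head f zero    = ℤₚ.+-comm (+ 0) (f 0)
∑-head f (suc n) = trans (cong (_+ f (suc n)) (∑-head f n)) (ℤₚ.+-assoc (f 0) (∑ (f ∘ suc) n) (f (suc n)))

sumℤ-applyUpTo : ∀ f n → sumℤ (applyUpTo f n) ≡ ∑ f n
sumℤ-applyUpTo f zero    = refl
sumℤ-applyUpTo f (suc n) = trans (cong (_+_ (f 0)) (sumℤ-applyUpTo (f ∘ suc) n)) (sym (∑-head f n))

sumℤ-++ : ∀ xs ys → sumℤ (xs ++ ys) ≡ sumℤ xs + sumℤ ys
sumℤ-++ []       ys = sym (ℤₚ.+-identityˡ (sumℤ ys))
sumℤ-++ (x ∷ xs) ys = trans (cong (_+_ x) (sumℤ-++ xs ys)) (sym (ℤₚ.+-assoc x (sumℤ xs) (sumℤ ys)))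

weigh : {A : Set} → (A → ℤ) → List A → ℤ
weigh w xs = sumℤ (map w xs)

weigh-++ : ∀ {A} (w : A → ℤ) xs ys → weigh w (xs ++ ys) ≡ weigh w xs + weigh w ys
weigh-++ w xs ys = trans (cong sumℤ (map-++ w xs ys)) (sumℤ-++ (map w xs) (map w ys))

weigh-concatMap : ∀ {A B} (w : B → ℤ) (f : A → List B) xs → weigh w (concatMap f xs) ≡ weigh (weigh w ∘ f) xs
weigh-concatMap w f []       = refl
weigh-concatMap w f (x ∷ xs) = trans (weigh-++ w (f x) (concatMap f xs)) (cong (_+_ (weigh w (f x))) (weigh-concatMap w f xs))

weigh-map : ∀ {A B} (w : B → ℤ) (f : A → B) {v : A → ℤ} → (∀ x → w (f x) ≡ v x) → ∀ xs → weigh w (map f xs) ≡ weigh v xs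
weigh-map w f p []       = refl
weigh-map w f p (x ∷ xs) = cong₂ _+_ (p x) (weigh-map w f p xs)

-- p k j n is the number of overpartitions of n into j parts, all ≤ k.
p : ℕ → F
p k j (+ n)    = weigh (λ π → ε (+ length π - j)) (ovpBounded k n)
p k j -[1+ n ] = + 0

added : ℕ → ℤ → ℤ → ℕ → ℤ
added k j n i = + 2 * p k (j - + suc i) (n - + (suc i ℕ.* suc k))

neg⇒0 : ∀ k j n → n < + 0 → p k j n ≡ + 0
neg⇒0 k j -[1+ n ] _ = refl
neg⇒0 k j (+ n) (+<+ ())

-- A general weight serves both the count by number of parts and the count by rank. The factor 2 in
-- `added` is the choice of overlining the first copy of the part k + 1.
weigh-ovpBounded-suc : ∀ k n j (w : Overpartition → ℤ) →
  (∀ i b π → w (block (suc i) (suc k) b ++ π) ≡ ε (+ length π - (j - + suc i))) →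
  weigh w (ovpBounded (suc k) n) ≡ weigh w (ovpBounded k n) + ∑ (added k j (+ n)) n
weigh-ovpBounded-suc k n j w hw = trans (weigh-++ w (ovpBounded k n) _)
  (cong (_+_ (weigh w (ovpBounded k n)))
    (trans (weigh-concatMap w new (upTo n))
      (trans (cong sumℤ (map-upTo (weigh w ∘ new) n)) (trans (sumℤ-applyUpTo (weigh w ∘ new) n) (∑-cong n (λ i _ → term i))))))
  where
  both : ℕ → ℕ → List Overpartition
  both i s = concatMap (λ b → map (λ π → block (suc i) (suc k) b ++ π) (ovpBounded k (n ∸ s))) (false ∷ true ∷ [])
  new : ℕ → List Overpartition
  new i = if does (suc i ℕ.* suc k ≤? n) then both i (suc i ℕ.* suc k) else []
  v : ℕ → Overpartition → ℤ
  v i π = ε (+ length π - (j - + suc i))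
  dup : ∀ x → x + (x + + 0) ≡ + 2 * x
  dup = solve-∀
  branch : ∀ i s (d : Dec (s ℕ.≤ n)) → weigh w (if does d then both i s else []) ≡ + 2 * p k (j - + suc i) (+ n - + s)
  branch i s (yes le) = begin
    weigh w (both i s) ≡⟨ weigh-concatMap w (λ b → map (λ π → block (suc i) (suc k) b ++ π) l) (false ∷ true ∷ []) ⟩
    _ ≡⟨ cong₂ (λ x y → x + (y + + 0))
                                 (weigh-map w (λ π → block (suc i) (suc k) false ++ π) {v i} (hw i false) l)
                                 (weigh-map w (λ π → block (suc i) (suc k) true ++ π) {v i} (hw i true) l) ⟩
    weigh (v i) l + (weigh (v i) l + + 0) ≡⟨ dup (weigh (v i) l) ⟩
    + 2 * weigh (v i) l ≡⟨ cong (λ x → + 2 * p k (j - + suc i) x)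
                                (trans (sym (ℤₚ.⊖-≥ le)) (sym (ℤₚ.m-n≡m⊖n n s))) ⟩
    + 2 * p k (j - + suc i) (+ n - + s) ∎
    where
    open ≡-Reasoning
    l = ovpBounded k (n ∸ s)
  branch i s (no nle) = sym (cong (+ 2 *_) (neg⇒0 k (j - + suc i) (+ n - + s)
      (<-by (<⇒0< (+<+ (ℕₚ.≰⇒> nle))) (l (+ n) (+ s)))))
    where
    l : ∀ n s → + 0 - (n - s) ≡ s - n
    l = solve-∀
  term : ∀ i → weigh w (new i) ≡ added k j (+ n) i
  term i = branch i (suc i ℕ.* suc k) (suc i ℕ.* suc k ≤? n)

length-block : ∀ i k b → length (block i k b) ≡ i
length-block zero    k b = refl
length-block (suc i) k b = cong suc (length-replicate i)

length-block-++ : ∀ i k b π → + length (block i k b ++ π) ≡ + i + + length π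
length-block-++ i k b π = cong +_ (trans (length-++ (block i k b)) (cong (ℕ._+ length π) (length-block i k b)))

Q : ℕ → F
Q k j n = ∑ (added k j n) ∣ n ∣

p-suc : ∀ k j n → p (suc k) j n ≡ p k j n + Q k j n
p-suc k j (+ n)    = weigh-ovpBounded-suc k n j (λ π → ε (+ length π - j)) λ i b π →
  cong ε (trans (cong (_- j) (length-block-++ (suc i) (suc k) b π)) (l (+ suc i) (+ length π) j))
  where
  l : ∀ i x j → i + x - j ≡ x - (j - i)
  l = solve-∀
p-suc k j -[1+ n ] = sym (trans (ℤₚ.+-identityˡ (Q k j -[1+ n ]))
  (∑-zero (suc n) (λ i _ → cong (+ 2 *_) (neg⇒0 k (j - + suc i) (-[1+ n ] - + (suc i ℕ.* suc k)) -<+))))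

p-zero : p 0 ≋ δ
p-zero j (+ zero)  = trans (ℤₚ.+-identityʳ _) (trans (ε-neg j) (sym (ℤₚ.*-identityʳ (ε j))))
  where
  ε-neg : ∀ j → ε (+ 0 - j) ≡ ε j
  ε-neg (+ zero)  = refl
  ε-neg (+ suc j) = refl
  ε-neg -[1+ j ]  = refl
p-zero j (+ suc n) = sym (ℤₚ.*-zeroʳ (ε j))
p-zero j -[1+ n ]  = sym (ℤₚ.*-zeroʳ (ε j))

added-vanish : ∀ k j n i → n < + (suc i ℕ.* suc k) → added k j n i ≡ + 0
added-vanish k j n i q = cong (+ 2 *_) (neg⇒0 k (j - + suc i) (n - + (suc i ℕ.* suc k))
  (<-by (<⇒0< q) (l n (+ (suc i ℕ.* suc k)))))
  where
  l : ∀ n s → + 0 - (n - s) ≡ s - n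
  l = solve-∀

Q-bound : ∀ k j n M → ∣ n ∣ ℕ.≤ M → ∑ (added k j n) M ≡ Q k j n
Q-bound k j n M le = ∑-extend le λ i ∣n∣≤i → added-vanish k j n i
  (ℤₚ.<-≤-trans (i<1+∣i∣ n) (+≤+ (ℕₚ.≤-trans (ℕ.s≤s ∣n∣≤i) (ℕₚ.m≤m*n (suc i) (suc k)))))

-- Remove one copy of the part k + 1: the first summand comes from exactly one copy, the second from
-- at least two. The common upper limit M lets the two sums be compared termwise.
Q-rec : ∀ k j n → Q k j n ≡ + 2 * p k (j - + 1) (n - + suc k) + Q k (j - + 1) (n - + suc k)
Q-rec k j n = begin
  Q k j n ≡⟨ Q-bound k j n (suc M) (ℕₚ.≤-trans (ℕₚ.m≤m+n ∣ n ∣ ∣ n′ ∣) (ℕₚ.n≤1+n M)) ⟨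
  ∑ (added k j n) (suc M) ≡⟨ ∑-head (added k j n) M ⟩
  added k j n 0 + ∑ (added k j n ∘ suc) M ≡⟨ cong₂ _+_ (cong (λ x → + 2 * p k (j - + 1) (n - + x)) (ℕₚ.+-identityʳ (suc k)))
                                               (∑-cong M (λ i _ → cong (+ 2 *_) (cong₂ (p k) (l₁ j (+ suc i)) (l₂ n i)))) ⟩
  + 2 * p k (j - + 1) n′ + ∑ (added k (j - + 1) n′) M ≡⟨ cong (_+_ (+ 2 * p k (j - + 1) n′)) (Q-bound k (j - + 1) n′ M (ℕₚ.m≤n+m ∣ n′ ∣ ∣ n ∣)) ⟩
  + 2 * p k (j - + 1) n′ + Q k (j - + 1) n′ ∎
  where
  open ≡-Reasoning
  n′ = n - + suc k
  M = ∣ n ∣ ℕ.+ ∣ n′ ∣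
  l₁ : ∀ j i → j - (+ 1 + i) ≡ j - + 1 - i
  l₁ = solve-∀
  l₃ : ∀ n k s → n - (k + s) ≡ n - k - s
  l₃ = solve-∀
  l₂ : ∀ n i → n - + (suc (suc i) ℕ.* suc k) ≡ n - + suc k - + (suc i ℕ.* suc k)
  l₂ n i = l₃ n (+ suc k) (+ (suc i ℕ.* suc k))

-- With y = x q^(k+1), the multiplicities of the part k + 1 contribute 1 + 2(y + y² + ...) = (1 +
-- y)/(1 - y).
p-rec : ∀ k → bin (- + 1) (+ 1) (+ suc k) (p (suc k)) ≋ bin (+ 1) (+ 1) (+ suc k) (p k)
p-rec k j n = begin
  p (suc k) j n + - + 1 * p (suc k) j′ n′ ≡⟨ cong₂ (λ x y → x + - + 1 * y) (trans (p-suc k j n) (cong (_+_ (p k j n)) (Q-rec k j n))) (p-suc k j′ n′) ⟩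
  p k j n + (+ 2 * p k j′ n′ + Q k j′ n′) + - + 1 * (p k j′ n′ + Q k j′ n′)
                                                  ≡⟨ l (p k j n) (p k j′ n′) (Q k j′ n′) ⟩
  p k j n + + 1 * p k j′ n′ ∎
  where
  open ≡-Reasoning
  j′ = j - + 1
  n′ = n - + suc k
  l : ∀ x y z → x + (+ 2 * y + z) + - + 1 * (y + z) ≡ x + + 1 * y
  l = solve-∀

0≤* : ∀ n {x} → + 0 ≤ x → + 0 ≤ + n * x
0≤* n {x} q = subst (_≤ + n * x) (ℤₚ.*-zeroʳ (+ n)) (ℤₚ.*-monoˡ-≤-nonNeg (+ n) q)

-- A copy of the part k + 1 contributes α + β (k + 1) to the grading. The two instances used say
-- that the number of parts is nonnegative and does not exceed the size.
p-supp : ∀ α β → (∀ k → + 0 ≤ α + β * + suc k) → Supp α β δ → ∀ k → Supp α β (p k)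
p-supp α β w s zero    j n q = trans (p-zero j n) (s j n q)
p-supp α β w s (suc k) j n q = trans (p-suc k j n) (cong₂ _+_ (p-supp α β w s k j n q)
  (∑-zero ∣ n ∣ λ i _ → cong (+ 2 *_) (p-supp α β w s k (j - + suc i) (n - + (suc i ℕ.* suc k))
    (<-by (0<+0≤ (<⇒0< q) (0≤* (suc i) (w k)))
      (trans (cong (λ x → + 0 - (α * (j - + suc i) + β * (n - x))) (ℤₚ.pos-* (suc i) (suc k)))
        (l α β j n (+ suc i) (+ suc k)))))))
  where
  l : ∀ α β j n i k → + 0 - (α * (j - i) + β * (n - i * k)) ≡ + 0 - (α * j + β * n) + i * (α + β * k)
  l = solve-∀

δ-supp : ∀ α β → Supp α β δ
δ-supp α β (+ zero) (+ zero) q = contradiction (subst (_< + 0) (l α β) q) λ { (+<+ ()) }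
  where
  l : ∀ α β → α * + 0 + β * + 0 ≡ + 0
  l = solve-∀
δ-supp α β (+ zero)  (+ suc n) q = refl
δ-supp α β (+ zero)  -[1+ n ]  q = refl
δ-supp α β (+ suc m) n q = ℤₚ.*-zeroˡ (ε n)
δ-supp α β -[1+ m ]  n q = ℤₚ.*-zeroˡ (ε n)

-- In a grading that gives z^a q^b positive degree, 1 + c z^a q^b can be cancelled from series
-- bounded below, by induction on the degree.
bin-injective : ∀ {α β f g} c a b → Supp α β f → Supp α β g → + 1 ≤ α * a + β * b →
                bin c a b f ≋ bin c a b g → f ≋ g
bin-injective {α} {β} {f} {g} c a b sf sg w eq m n = go (suc ∣ α * m + β * n ∣) m n (i<1+∣i∣ _)
  where
  go : ∀ N m n → α * m + β * n < + N → f m n ≡ g m n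
  go zero    m n q = trans (sf m n q) (sym (sg m n q))
  go (suc N) m n q = ℤ+.∙-cancelʳ (c * g (m - a) (n - b)) (f m n) (g m n)
    (trans (cong (λ x → f m n + c * x) (sym (go N (m - a) (n - b) q′))) (eq m n))
    where
    l : ∀ α β m n a b N → N - (α * (m - a) + β * (n - b)) ≡ + 1 + N - (α * m + β * n) + (α * a + β * b - + 1)
    l = solve-∀
    q′ : α * (m - a) + β * (n - b) < + N
    q′ = <-by (0<+0≤ (<⇒0< q) (≤⇒0≤ w)) (l α β m n a b (+ N))

-- x ↦ x/q, where x marks the parts
τ : F → F
τ f j n = f j (n + j)

τ-bin : ∀ c a b f → τ (bin c a b f) ≋ bin c a (b - a) (τ f)
τ-bin c a b f j n = cong (λ x → f j (n + j) + c * f (j - a) x) (l j n a b)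
  where
  l : ∀ j n a b → n + j - b ≡ n - (b - a) + (j - a)
  l = solve-∀

p-supp-parts : ∀ k → Supp (+ 1) (+ 0) (p k)
p-supp-parts = p-supp (+ 1) (+ 0) (λ k → 0≤+ _) (δ-supp (+ 1) (+ 0))

p-supp-size : ∀ k → Supp (- + 1) (+ 1) (p k)
p-supp-size = p-supp (- + 1) (+ 1) (λ k → subst (+ 0 ≤_) (l k) (0≤+ _)) (δ-supp (- + 1) (+ 1))
  where
  l : ∀ k → + k ≡ - + 1 + + 1 * + suc k
  l k = l′ (+ k)
    where
    l′ : ∀ k → k ≡ - + 1 + + 1 * (+ 1 + k)
    l′ = solve-∀

-- Removing the first column of the Ferrers diagram: (1 - x) P (k+1) (x/q) = (1 + x) P k (x).
p-column : ∀ k → bin (- + 1) (+ 1) (+ 0) (τ (p (suc k))) ≋ bin (+ 1) (+ 1) (+ 0) (p k)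
p-column zero = begin
  bin (- + 1) (+ 1) (+ 0) (τ (p 1)) ≈⟨ τ-bin (- + 1) (+ 1) (+ 1) (p 1) ⟨
  τ (bin (- + 1) (+ 1) (+ 1) (p 1)) ≈⟨ (λ j n → p-rec 0 j (n + j)) ⟩
  τ (bin (+ 1) (+ 1) (+ 1) (p 0)) ≈⟨ τ-bin (+ 1) (+ 1) (+ 1) (p 0) ⟩
  bin (+ 1) (+ 1) (+ 0) (τ (p 0)) ≈⟨ bin-cong (+ 1) (+ 1) (+ 0) τ-p₀ ⟩
  bin (+ 1) (+ 1) (+ 0) (p 0) ∎
  where
  open ≋-Reasoning
  τ-δ : τ δ ≋ δ
  τ-δ (+ zero)  n = cong (λ x → + 1 * ε x) (ℤₚ.+-identityʳ n)
  τ-δ (+ suc j) n = trans (ℤₚ.*-zeroˡ (ε (n + + suc j))) (sym (ℤₚ.*-zeroˡ (ε n)))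
  τ-δ -[1+ j ]  n = trans (ℤₚ.*-zeroˡ (ε (n + -[1+ j ]))) (sym (ℤₚ.*-zeroˡ (ε n)))
  τ-p₀ : τ (p 0) ≋ p 0
  τ-p₀ j n = trans (p-zero j (n + j)) (trans (τ-δ j n) (sym (p-zero j n)))
-- Both sides are multiplied by 1 - x q^K, which `p-rec` exchanges for 1 + x q^K while lowering the
-- bound on the parts; the factor is cancelled in the grading by number of parts.
p-column (suc k) = bin-injective {+ 1} {+ 0} (- + 1) (+ 1) (+ K)
  (bin-supp {+ 1} {+ 0} {τ (p (suc K))} (- + 1) (+ 1) (+ 0) (λ j n q → p-supp-parts (suc K) j (n + j) q) (0≤+ _))
  (bin-supp {+ 1} {+ 0} {p K} (+ 1) (+ 1) (+ 0) (p-supp-parts K) (0≤+ _))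
  (+≤+ ℕₚ.≤-refl)
  (begin
    bin (- + 1) (+ 1) (+ K) (bin (- + 1) (+ 1) (+ 0) (τ (p (suc K))))
      ≈⟨ bin-comm (- + 1) (+ 1) (+ K) (- + 1) (+ 1) (+ 0) (τ (p (suc K))) ⟩
    bin (- + 1) (+ 1) (+ 0) (bin (- + 1) (+ 1) (+ K) (τ (p (suc K))))
      ≈⟨ bin-cong (- + 1) (+ 1) (+ 0) (τ-bin (- + 1) (+ 1) (+ suc K) (p (suc K))) ⟨
    bin (- + 1) (+ 1) (+ 0) (τ (bin (- + 1) (+ 1) (+ suc K) (p (suc K))))
      ≈⟨ bin-cong (- + 1) (+ 1) (+ 0) (λ j n → p-rec K j (n + j)) ⟩
    bin (- + 1) (+ 1) (+ 0) (τ (bin (+ 1) (+ 1) (+ suc K) (p K)))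
      ≈⟨ bin-cong (- + 1) (+ 1) (+ 0) (τ-bin (+ 1) (+ 1) (+ suc K) (p K)) ⟩
    bin (- + 1) (+ 1) (+ 0) (bin (+ 1) (+ 1) (+ K) (τ (p K)))
      ≈⟨ bin-comm (- + 1) (+ 1) (+ 0) (+ 1) (+ 1) (+ K) (τ (p K)) ⟩
    bin (+ 1) (+ 1) (+ K) (bin (- + 1) (+ 1) (+ 0) (τ (p K)))
      ≈⟨ bin-cong (+ 1) (+ 1) (+ K) (p-column k) ⟩
    bin (+ 1) (+ 1) (+ K) (bin (+ 1) (+ 1) (+ 0) (p k))
      ≈⟨ bin-comm (+ 1) (+ 1) (+ K) (+ 1) (+ 1) (+ 0) (p k) ⟩
    bin (+ 1) (+ 1) (+ 0) (bin (+ 1) (+ 1) (+ K) (p k))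
      ≈⟨ bin-cong (+ 1) (+ 1) (+ 0) (p-rec k) ⟨
    bin (+ 1) (+ 1) (+ 0) (bin (- + 1) (+ 1) (+ K) (p K))
      ≈⟨ bin-comm (+ 1) (+ 1) (+ 0) (- + 1) (+ 1) (+ K) (p K) ⟩
    bin (- + 1) (+ 1) (+ K) (bin (+ 1) (+ 1) (+ 0) (p K)) ∎)
  where
  open ≋-Reasoning
  K = suc k

-- The functional equation of V.

uTerm : ℤ → ℤ → ℕ → ℤ
uTerm m n k = p k (+ k - m) n

tTerm : ℤ → ℤ → ℕ → ℤ
tTerm m n k = p k (+ k - m) (n - + k)

-- Truncations of U(z) and of the auxiliary series T(z) = Σ_k (zq)^k P k (1/z), which links U(z)
-- with U(zq) and is eliminated in `combine`.
uₖ tₖ : ℕ → F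
uₖ K m n = ∑ (uTerm m n) K
tₖ K m n = ∑ (tTerm m n) K

u : F
u m n = uₖ (suc (∣ m ∣ ℕ.+ ∣ n ∣)) m n

i≤∣i∣ : ∀ i → i ≤ + ∣ i ∣
i≤∣i∣ (+ n)     = ℤₚ.≤-refl
i≤∣i∣ -[1+ n ]  = ℤ.-≤+

-- A term with k > m + n would count overpartitions of n into k - m > n parts.
uₖ-u : ∀ K m n → suc (∣ m ∣ ℕ.+ ∣ n ∣) ℕ.≤ K → uₖ K m n ≡ u m n
uₖ-u K m n le = ∑-extend le λ k q → p-supp-size k (+ k - m) n
  (<-by (0<+0≤ (<⇒0< (+<+ q)) (0≤+0≤ (≤⇒0≤ (i≤∣i∣ m)) (≤⇒0≤ (i≤∣i∣ n)))) (l (+ k) m n (+ ∣ m ∣) (+ ∣ n ∣)))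
  where
  l : ∀ k m n M N → + 0 - (- + 1 * (k - m) + + 1 * n) ≡ k - (M + N) + (M - m + (N - n))
  l = solve-∀

-- Truncated form of (1 + zq) T + z = 1 + (z - z²) U, which is `p-rec` at x = 1/z summed over k. The
-- orders K and K + 1 are matched so that no boundary term remains.
t-u : ∀ K m n → tₖ (suc K) m n + tₖ K (m - + 1) (n - + 1) + p 0 (+ 1 - m) n
                     ≡ p 0 (+ 0 - m) n + uₖ (suc K) (m - + 1) n - uₖ K (m - + 2) n
t-u zero m n = trans (cong₂ (λ x y → + 0 + p 0 (+ 0 - m) x + + 0 + p 0 y n) (l₁ n) (l₂ m))
  (l₃ (p 0 (+ 0 - m) n) (p 0 (+ 0 - (m - + 1)) n))
  where
  l₁ : ∀ n → n - + 0 ≡ n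
  l₁ = solve-∀
  l₂ : ∀ m → + 1 - m ≡ + 0 - (m - + 1)
  l₂ = solve-∀
  l₃ : ∀ x y → + 0 + x + + 0 + y ≡ x + (+ 0 + y) - + 0
  l₃ = solve-∀
t-u (suc K) m n = begin
  t + a + (t′ + p K (+ K - (m - + 1)) (n - + 1 - + K)) + z
    ≡⟨ cong₂ (λ x y → t + a + (t′ + p K x y) + z) (i₁ m (+ K)) (i₂ n (+ K)) ⟩
  t + a + (t′ + b) + z ≡⟨ l₁ t a t′ b z ⟩
  t + t′ + z + (a + b) ≡⟨ cong₂ _+_ (t-u K m n) step ⟩
  z′ + U - U′ + (c - d) ≡⟨ l₂ z′ U U′ c d ⟩
  z′ + (U + c) - (U′ + d) ≡⟨ cong₂ (λ x y → z′ + (U + p (suc K) x n) - (U′ + p K y n)) (i₃ m (+ K)) (i₄ m (+ K)) ⟩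
  p 0 (+ 0 - m) n + uₖ (suc (suc K)) (m - + 1) n - uₖ (suc K) (m - + 2) n ∎
  where
  open ≡-Reasoning
  j = + 2 + + K - m
  t = tₖ (suc K) m n
  t′ = tₖ K (m - + 1) (n - + 1)
  z = p 0 (+ 1 - m) n
  z′ = p 0 (+ 0 - m) n
  U = uₖ (suc K) (m - + 1) n
  U′ = uₖ K (m - + 2) n
  a = p (suc K) (+ suc K - m) (n - + suc K)
  b = p K (+ suc K - m) (n - + suc K)
  c = p (suc K) j n
  d = p K j n
  i₁ : ∀ m K → K - (m - + 1) ≡ + 1 + K - m
  i₁ = solve-∀
  i₂ : ∀ n K → n - + 1 - K ≡ n - (+ 1 + K)
  i₂ = solve-∀
  i₃ : ∀ m K → + 2 + K - m ≡ + 1 + K - (m - + 1)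
  i₃ = solve-∀
  i₄ : ∀ m K → + 2 + K - m ≡ K - (m - + 2)
  i₄ = solve-∀
  i₅ : ∀ m K → + 2 + K - m - + 1 ≡ + 1 + K - m
  i₅ = solve-∀
  l₁ : ∀ t a t′ b z → t + a + (t′ + b) + z ≡ t + t′ + z + (a + b)
  l₁ = solve-∀
  l₂ : ∀ z U U′ c d → z + U - U′ + (c - d) ≡ z + (U + c) - (U′ + d)
  l₂ = solve-∀
  l₃ : ∀ a b d → a + b ≡ (d + + 1 * b) - d - - + 1 * a
  l₃ = solve-∀
  l₄ : ∀ a c d → (c + - + 1 * a) - d - - + 1 * a ≡ c - d
  l₄ = solve-∀
  rec : c + - + 1 * a ≡ d + + 1 * b
  rec = subst (λ x → c + - + 1 * p (suc K) x (n - + suc K) ≡ d + + 1 * p K x (n - + suc K)) (i₅ m (+ K)) (p-rec K j n)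
  step : a + b ≡ c - d
  step = trans (l₃ a b d) (trans (cong (λ x → x - d - - + 1 * a) (sym rec)) (l₄ a c d))

-- Truncated form of (1 - 1/z) U(zq) = 1 - 1/z + (1 + z) q T, which is `p-column` at x = 1/z summed
-- over k.
u-column : ∀ K m n → uₖ (suc K) m (n - m) - uₖ (suc K) (m + + 1) (n - (m + + 1))
  ≡ p 0 (+ 0 - m) (n - m) - p 0 (+ 0 - (m + + 1)) (n - (m + + 1)) + tₖ K (m - + 1) (n - + 1) + tₖ K m (n - + 1)
u-column zero m n = l (p 0 (+ 0 - m) (n - m)) (p 0 (+ 0 - (m + + 1)) (n - (m + + 1)))
  where
  l : ∀ x y → + 0 + x - (+ 0 + y) ≡ x - y + + 0 + + 0
  l = solve-∀
u-column (suc K) m n = begin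
  U + a - (U′ + b) ≡⟨ l₁ U U′ a b ⟩
  U - U′ + (a - b) ≡⟨ cong₂ _+_ (u-column K m n) step ⟩
  z + t + t′ + (c + d) ≡⟨ l₂ z t t′ c d ⟩
  z + (t + c) + (t′ + d) ≡⟨ cong₂ (λ x y → z + (t + p K x (n - + 1 - + K)) + (t′ + p K y (n - + 1 - + K))) (i₁ m (+ K)) refl ⟩
  z + tₖ (suc K) (m - + 1) (n - + 1) + tₖ (suc K) m (n - + 1) ∎
  where
  open ≡-Reasoning
  j = + suc K - m
  U = uₖ (suc K) m (n - m)
  U′ = uₖ (suc K) (m + + 1) (n - (m + + 1))
  z = p 0 (+ 0 - m) (n - m) - p 0 (+ 0 - (m + + 1)) (n - (m + + 1))
  t = tₖ K (m - + 1) (n - + 1)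
  t′ = tₖ K m (n - + 1)
  a = p (suc K) j (n - m)
  b = p (suc K) (+ suc K - (m + + 1)) (n - (m + + 1))
  c = p K j (n - + 1 - + K)
  d = p K (+ K - m) (n - + 1 - + K)
  i₁ : ∀ m K → + 1 + K - m ≡ K - (m - + 1)
  i₁ = solve-∀
  i₂ : ∀ m n K → n - + 1 - K + (+ 1 + K - m) ≡ n - m
  i₂ = solve-∀
  i₃ : ∀ m K → + 1 + K - m - + 1 ≡ + 1 + K - (m + + 1)
  i₃ = solve-∀
  i₄ : ∀ m n K → n - + 1 - K - + 0 + (+ 1 + K - m - + 1) ≡ n - (m + + 1)
  i₄ = solve-∀
  i₅ : ∀ m K → + 1 + K - m - + 1 ≡ K - m
  i₅ = solve-∀
  i₆ : ∀ n K → n - + 1 - K - + 0 ≡ n - + 1 - K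
  i₆ = solve-∀
  l₁ : ∀ U U′ a b → U + a - (U′ + b) ≡ U - U′ + (a - b)
  l₁ = solve-∀
  l₂ : ∀ z t t′ c d → z + t + t′ + (c + d) ≡ z + (t + c) + (t′ + d)
  l₂ = solve-∀
  l₃ : ∀ a b → a - b ≡ a + - + 1 * b
  l₃ = solve-∀
  l₄ : ∀ c d → c + + 1 * d ≡ c + d
  l₄ = solve-∀
  step : a - b ≡ c + d
  step = begin
    a - b ≡⟨ l₃ a b ⟩
    a + - + 1 * b ≡⟨ cong₂ (λ x y → p (suc K) j x + - + 1 * y) (sym (i₂ m n (+ K))) (cong₂ (p (suc K)) (sym (i₃ m (+ K))) (sym (i₄ m n (+ K)))) ⟩
    _ ≡⟨ p-column K j (n - + 1 - + K) ⟩
    c + + 1 * p K (j - + 1) (n - + 1 - + K - + 0) ≡⟨ cong₂ (λ x y → c + + 1 * p K x y) (i₅ m (+ K)) (i₆ n (+ K)) ⟩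
    c + + 1 * d ≡⟨ l₄ c d ⟩
    c + d ∎

ε-neg : ∀ j → ε (+ 0 - j) ≡ ε j
ε-neg (+ zero)  = refl
ε-neg (+ suc j) = refl
ε-neg -[1+ j ]  = refl

p₀-flip : ∀ m n → p 0 (+ 0 - m) n ≡ δ m n
p₀-flip m n = trans (p-zero (+ 0 - m) n) (cong (_* ε n) (ε-neg m))

σ-δ : σ δ ≋ δ
σ-δ (+ zero)  n = cong (λ x → + 1 * ε x) (ℤₚ.+-identityʳ n)
σ-δ (+ suc m) n = trans (ℤₚ.*-zeroˡ (ε (n - + suc m))) (sym (ℤₚ.*-zeroˡ (ε n)))
σ-δ -[1+ m ]  n = trans (ℤₚ.*-zeroˡ (ε (n - -[1+ m ]))) (sym (ℤₚ.*-zeroˡ (ε n)))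

v : F
v m n = u m n + u (m - + 1) n

-- σ v + z² q v - (1 - z² q) vanishes off the pole z = 1 and is a formal delta function there.
X : F
X m n = v m (n - m) + v (m - + 2) (n - + 1) - δ m n + δ (m - + 2) (n - + 1)

private
  six : ℤ → ℤ → ℤ → ℤ → ℤ → ℤ → ℤ
  six a b c d e f = a + b + (c + d) - e + f

  six-cong : ∀ {a b c d e f a′ b′ c′ d′ e′ f′} → a ≡ a′ → b ≡ b′ → c ≡ c′ → d ≡ d′ → e ≡ e′ → f ≡ f′ →
             six a b c d e f ≡ six a′ b′ c′ d′ e′ f′
  six-cong refl refl refl refl refl refl = refl

  -- Elimination of T. The hypotheses are `u-column` and zq times it, then `t-u` multiplied by zq
  -- and by q; the T's cancel in their sum, leaving (1 - 1/z) X = 0.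
  combine : ∀ {A₁ A₂ A₃ A₄ B₁ B₂ B₃ B₄ d₀ d₁ d₂ d₃ d₄ T₁ T₂ T₃ T₄} →
    A₁ - B₁ ≡ d₀ - d₂ + T₁ + T₂ → A₂ - B₂ ≡ d₃ - d₄ + T₃ + T₄ →
    T₁ + T₃ + d₁ ≡ d₃ + A₃ - A₄ → T₂ + T₄ + d₃ ≡ d₄ + B₃ - B₄ → A₃ ≡ B₄ →
    six A₁ A₂ A₃ A₄ d₀ d₁ ≡ six B₁ B₂ B₃ B₄ d₂ d₃
  combine {A₁} {A₂} {A₃} {A₄} {B₁} {B₂} {B₃} {B₄} {d₀} {d₁} {d₂} {d₃} {d₄} {T₁} {T₂} {T₃} {T₄} e₁ e₂ e₃ e₄ refl =
    ℤₚ.i-j≡0⇒i≡j (six A₁ A₂ A₃ A₄ d₀ d₁) (six B₁ B₂ B₃ A₃ d₂ d₃) (trans (l A₁ A₂ A₃ A₄ B₁ B₂ B₃ d₀ d₁ d₂ d₃ d₄ T₁ T₂ T₃ T₄)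
      (cong₂ _+_ (cong₂ _+_ (ℤₚ.i≡j⇒i-j≡0 e₁) (ℤₚ.i≡j⇒i-j≡0 e₂)) (cong₂ _+_ (ℤₚ.i≡j⇒i-j≡0 e₃) (ℤₚ.i≡j⇒i-j≡0 e₄))))
    where
    l : ∀ A₁ A₂ A₃ A₄ B₁ B₂ B₃ d₀ d₁ d₂ d₃ d₄ T₁ T₂ T₃ T₄ →
      A₁ + A₂ + (A₃ + A₄) - d₀ + d₁ - (B₁ + B₂ + (B₃ + A₃) - d₂ + d₃) ≡
      A₁ - B₁ - (d₀ - d₂ + T₁ + T₂) + (A₂ - B₂ - (d₃ - d₄ + T₃ + T₄)) +
      (T₁ + T₃ + d₁ - (d₃ + A₃ - A₄) + (T₂ + T₄ + d₃ - (d₄ + B₃ - A₃)))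
    l = solve-∀

X-step : ∀ m n → X m n ≡ X (m + + 1) n
X-step m n = trans (six-cong
    (raw (2 ℕ.+ K) m (n - m) refl refl (ℕₚ.m≤n⇒m≤1+n (ℕₚ.m≤n⇒m≤1+n r₁)))
    (raw (1 ℕ.+ K) (m - + 1) (n - + 1 - (m - + 1)) refl (i₁ m n) (ℕₚ.m≤n⇒m≤1+n r₂))
    (raw (1 ℕ.+ K) (m - + 1 - + 1) (n - + 1) (i₂ m) refl (ℕₚ.m≤n⇒m≤1+n r₃))
    (raw K (m - + 1 - + 2) (n - + 1) (i₃ m) refl r₄)
    refl refl)
  (trans (combine
      {uₖ (2 ℕ.+ K) m (n - m)} {uₖ (1 ℕ.+ K) (m - + 1) (n - + 1 - (m - + 1))}
      {uₖ (1 ℕ.+ K) (m - + 1 - + 1) (n - + 1)} {uₖ K (m - + 1 - + 2) (n - + 1)}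
      {uₖ (2 ℕ.+ K) (m + + 1) (n - (m + + 1))} {uₖ (1 ℕ.+ K) (m - + 1 + + 1) (n - + 1 - (m - + 1 + + 1))}
      {uₖ (1 ℕ.+ K) (m - + 1) (n - + 1)} {uₖ K (m - + 2) (n - + 1)}
      {δ m n} {δ (m - + 2) (n - + 1)} {δ (m + + 1) n} {δ (m - + 1) (n - + 1)} {δ m (n - + 1)}
      {tₖ (1 ℕ.+ K) (m - + 1) (n - + 1)} {tₖ (1 ℕ.+ K) m (n - + 1)}
      {tₖ K (m - + 1 - + 1) (n - + 1 - + 1)} {tₖ K (m - + 1) (n - + 1 - + 1)}
      e₁ e₂ e₃ e₄ A₃≡B₄) (sym (six-cong
    (raw (2 ℕ.+ K) (m + + 1) (n - (m + + 1)) refl refl (ℕₚ.m≤n⇒m≤1+n (ℕₚ.m≤n⇒m≤1+n r₅)))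
    (raw (1 ℕ.+ K) (m - + 1 + + 1) (n - + 1 - (m - + 1 + + 1)) (i₄ m) (i₅ m n) (ℕₚ.m≤n⇒m≤1+n r₆))
    (raw (1 ℕ.+ K) (m - + 1) (n - + 1) (i₆ m) refl (ℕₚ.m≤n⇒m≤1+n r₇))
    (raw K (m - + 2) (n - + 1) (i₇ m) refl r₈)
    refl (cong (λ x → δ x (n - + 1)) (i₆ m)))))
  where
  -- K is at least the truncation bound of each of the eight values of `u` in X m n and X (m + 1) n.
  -- The orders K, K + 1 and K + 2 demanded by the truncated identities therefore all give exact
  -- values.
  b : ℤ → ℤ → ℕ
  b m n = suc (∣ m ∣ ℕ.+ ∣ n ∣)
  K₈ = b (m - + 2) (n - + 1)
  K₇ = b (m - + 1) (n - + 1) ℕ.+ K₈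
  K₆ = b (m - + 1 + + 1) (n - + 1 - (m - + 1 + + 1)) ℕ.+ K₇
  K₅ = b (m + + 1) (n - (m + + 1)) ℕ.+ K₆
  K₄ = b (m - + 1 - + 2) (n - + 1) ℕ.+ K₅
  K₃ = b (m - + 1 - + 1) (n - + 1) ℕ.+ K₄
  K₂ = b (m - + 1) (n - + 1 - (m - + 1)) ℕ.+ K₃
  K = b m (n - m) ℕ.+ K₂
  t₂ : K₂ ℕ.≤ K
  t₂ = ℕₚ.m≤n+m K₂ (b m (n - m))
  t₃ : K₃ ℕ.≤ K
  t₃ = ℕₚ.≤-trans (ℕₚ.m≤n+m K₃ (b (m - + 1) (n - + 1 - (m - + 1)))) t₂
  t₄ : K₄ ℕ.≤ K
  t₄ = ℕₚ.≤-trans (ℕₚ.m≤n+m K₄ (b (m - + 1 - + 1) (n - + 1))) t₃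
  t₅ : K₅ ℕ.≤ K
  t₅ = ℕₚ.≤-trans (ℕₚ.m≤n+m K₅ (b (m - + 1 - + 2) (n - + 1))) t₄
  t₆ : K₆ ℕ.≤ K
  t₆ = ℕₚ.≤-trans (ℕₚ.m≤n+m K₆ (b (m + + 1) (n - (m + + 1)))) t₅
  t₇ : K₇ ℕ.≤ K
  t₇ = ℕₚ.≤-trans (ℕₚ.m≤n+m K₇ (b (m - + 1 + + 1) (n - + 1 - (m - + 1 + + 1)))) t₆
  r₁ = ℕₚ.m≤m+n (b m (n - m)) K₂
  r₂ = ℕₚ.≤-trans (ℕₚ.m≤m+n (b (m - + 1) (n - + 1 - (m - + 1))) K₃) t₂
  r₃ = ℕₚ.≤-trans (ℕₚ.m≤m+n (b (m - + 1 - + 1) (n - + 1)) K₄) t₃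
  r₄ = ℕₚ.≤-trans (ℕₚ.m≤m+n (b (m - + 1 - + 2) (n - + 1)) K₅) t₄
  r₅ = ℕₚ.≤-trans (ℕₚ.m≤m+n (b (m + + 1) (n - (m + + 1))) K₆) t₅
  r₆ = ℕₚ.≤-trans (ℕₚ.m≤m+n (b (m - + 1 + + 1) (n - + 1 - (m - + 1 + + 1))) K₇) t₆
  r₇ = ℕₚ.≤-trans (ℕₚ.m≤m+n (b (m - + 1) (n - + 1)) K₈) t₇
  r₈ : K₈ ℕ.≤ K
  r₈ = ℕₚ.≤-trans (ℕₚ.m≤n+m K₈ (b (m - + 1) (n - + 1))) t₇
  raw : ∀ K m n {m′ n′} → m′ ≡ m → n′ ≡ n → b m n ℕ.≤ K → u m′ n′ ≡ uₖ K m n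
  raw K m n refl refl le = sym (uₖ-u K m n le)
  i₁ : ∀ m n → n - m ≡ n - + 1 - (m - + 1)
  i₁ = solve-∀
  i₂ : ∀ m → m - + 2 ≡ m - + 1 - + 1
  i₂ = solve-∀
  i₃ : ∀ m → m - + 2 - + 1 ≡ m - + 1 - + 2
  i₃ = solve-∀
  i₄ : ∀ m → m + + 1 - + 1 ≡ m - + 1 + + 1
  i₄ = solve-∀
  i₅ : ∀ m n → n - (m + + 1) ≡ n - + 1 - (m - + 1 + + 1)
  i₅ = solve-∀
  i₆ : ∀ m → m + + 1 - + 2 ≡ m - + 1
  i₆ = solve-∀
  i₇ : ∀ m → m + + 1 - + 2 - + 1 ≡ m - + 2
  i₇ = solve-∀
  i₈ : ∀ m → + 1 - (m - + 1) ≡ + 0 - (m - + 2)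
  i₈ = solve-∀
  i₉ : ∀ m → + 1 - m ≡ + 0 - (m - + 1)
  i₉ = solve-∀
  i₁₀ : ∀ m → m - + 1 + + 1 ≡ m
  i₁₀ = solve-∀
  A₃≡B₄ : uₖ (1 ℕ.+ K) (m - + 1 - + 1) (n - + 1) ≡ uₖ K (m - + 2) (n - + 1)
  A₃≡B₄ = trans (sym (raw (1 ℕ.+ K) (m - + 1 - + 1) (n - + 1) (i₂ m) refl (ℕₚ.m≤n⇒m≤1+n r₃)))
                (raw K (m - + 2) (n - + 1) refl refl r₈)
  σδ : ∀ m n → p 0 (+ 0 - m) (n - m) ≡ δ m n
  σδ m n = trans (p₀-flip m (n - m)) (σ-δ m n)
  e₁ : uₖ (2 ℕ.+ K) m (n - m) - uₖ (2 ℕ.+ K) (m + + 1) (n - (m + + 1)) ≡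
       δ m n - δ (m + + 1) n + tₖ (1 ℕ.+ K) (m - + 1) (n - + 1) + tₖ (1 ℕ.+ K) m (n - + 1)
  e₁ = trans (u-column (1 ℕ.+ K) m n)
    (cong₂ (λ x y → x - y + tₖ (1 ℕ.+ K) (m - + 1) (n - + 1) + tₖ (1 ℕ.+ K) m (n - + 1)) (σδ m n) (σδ (m + + 1) n))
  e₂ : uₖ (1 ℕ.+ K) (m - + 1) (n - + 1 - (m - + 1)) - uₖ (1 ℕ.+ K) (m - + 1 + + 1) (n - + 1 - (m - + 1 + + 1)) ≡
       δ (m - + 1) (n - + 1) - δ m (n - + 1) + tₖ K (m - + 1 - + 1) (n - + 1 - + 1) + tₖ K (m - + 1) (n - + 1 - + 1)
  e₂ = trans (u-column K (m - + 1) (n - + 1))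
    (cong₂ (λ x y → x - y + tₖ K (m - + 1 - + 1) (n - + 1 - + 1) + tₖ K (m - + 1) (n - + 1 - + 1))
      (σδ (m - + 1) (n - + 1)) (trans (σδ (m - + 1 + + 1) (n - + 1)) (cong (λ x → δ x (n - + 1)) (i₁₀ m))))
  e₃ : tₖ (1 ℕ.+ K) (m - + 1) (n - + 1) + tₖ K (m - + 1 - + 1) (n - + 1 - + 1) + δ (m - + 2) (n - + 1) ≡
       δ (m - + 1) (n - + 1) + uₖ (1 ℕ.+ K) (m - + 1 - + 1) (n - + 1) - uₖ K (m - + 1 - + 2) (n - + 1)
  e₃ = trans (cong (_+_ (tₖ (1 ℕ.+ K) (m - + 1) (n - + 1) + tₖ K (m - + 1 - + 1) (n - + 1 - + 1)))
      (sym (trans (cong (λ x → p 0 x (n - + 1)) (i₈ m)) (p₀-flip (m - + 2) (n - + 1)))))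
    (trans (t-u K (m - + 1) (n - + 1))
      (cong (λ x → x + uₖ (1 ℕ.+ K) (m - + 1 - + 1) (n - + 1) - uₖ K (m - + 1 - + 2) (n - + 1)) (p₀-flip (m - + 1) (n - + 1))))
  e₄ : tₖ (1 ℕ.+ K) m (n - + 1) + tₖ K (m - + 1) (n - + 1 - + 1) + δ (m - + 1) (n - + 1) ≡
       δ m (n - + 1) + uₖ (1 ℕ.+ K) (m - + 1) (n - + 1) - uₖ K (m - + 2) (n - + 1)
  e₄ = trans (cong (_+_ (tₖ (1 ℕ.+ K) m (n - + 1) + tₖ K (m - + 1) (n - + 1 - + 1)))
      (sym (trans (cong (λ x → p 0 x (n - + 1)) (i₉ m)) (p₀-flip (m - + 1) (n - + 1)))))
    (trans (t-u K m (n - + 1))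
      (cong (λ x → x + uₖ (1 ℕ.+ K) (m - + 1) (n - + 1) - uₖ K (m - + 2) (n - + 1)) (p₀-flip m (n - + 1))))

X-const : ∀ m n → X m n ≡ X (+ 0) n
X-const (+ zero)     n = refl
X-const (+ suc m)    n = trans (cong (λ x → X (+ x) n) (ℕₚ.+-comm 1 m)) (trans (sym (X-step (+ m) n)) (X-const (+ m) n))
X-const -[1+ zero ]  n = X-step -[1+ 0 ] n
X-const -[1+ suc m ] n = trans (X-step -[1+ suc m ] n) (X-const -[1+ m ] n)

ξ : ℤ → ℤ
ξ = X (+ 0)

-- The exponents ≡ 1 modulo 3: shift equation, support and residue.

ε-≢ : ∀ {i} → i ≢ + 0 → ε i ≡ + 0
ε-≢ {+ zero}  p = contradiction refl p
ε-≢ {+ suc n} p = refl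
ε-≢ { -[1+ n ]} p = refl

δ-≢ : ∀ {m} n → m ≢ + 0 → δ m n ≡ + 0
δ-≢ n p = trans (cong (_* ε n) (ε-≢ p)) (ℤₚ.*-zeroˡ (ε n))

3k≢ : ∀ r k → r ℕ.< 2 → 3 ℕ.* k ≢ suc r
3k≢ r zero    _ ()
3k≢ zero          (suc k) _ eq with () ← trans (sym (ℕₚ.*-suc 3 k)) eq
3k≢ (suc zero)    (suc k) _ eq with () ← trans (sym (ℕₚ.*-suc 3 k)) eq
3k≢ (suc (suc r)) (suc k) (ℕ.s≤s (ℕ.s≤s ()))

3x+r≢0 : ∀ r x → r ℕ.< 2 → + 3 * x + + suc r ≢ + 0
3x+r≢0 r x r<2 eq = 3k≢ r ∣ x ∣ r<2 (trans (sym (ℤₚ.abs-* (+ 3) x)) (trans (cong ∣_∣ 3x≡) (ℤₚ.∣-i∣≡∣i∣ (+ suc r))))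
  where
  l : ∀ y r → y ≡ y + r + - r
  l = solve-∀
  3x≡ : + 3 * x ≡ - + suc r
  3x≡ = trans (l (+ 3 * x) (+ suc r)) (trans (cong (_+ - + suc r) eq) (ℤₚ.+-identityˡ (- + suc r)))

-- Off m = 0 there is nothing to show, and at m = 0 the exponent is 3x + 1 or 3x + 2, never 0. The
-- term c m accounts for substitutions z ↦ z q^i.
δ-mod3 : ∀ r x c {m n} → r ℕ.< 2 → n ≡ + 3 * x + + suc r + c * m → δ m n ≡ + 0
δ-mod3 r x c {+ zero} r<2 refl = trans (ℤₚ.*-identityˡ _) (ε-≢ (λ eq → 3x+r≢0 r x r<2
  (trans (sym (trans (cong (_+_ (+ 3 * x + + suc r)) (ℤₚ.*-zeroʳ c)) (ℤₚ.+-identityʳ (+ 3 * x + + suc r)))) eq)))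
δ-mod3 r x c {+ suc m} {n} _ _ = ℤₚ.*-zeroˡ (ε n)
δ-mod3 r x c { -[1+ m ]} {n} _ _ = ℤₚ.*-zeroˡ (ε n)

-- As q³ is renamed q, the substitution z ↦ zq³ becomes σ.
third : F → F
third f m n = f m (+ 3 * n + + 1)

g : F
g = third v

-- The exponents ≡ 1 of the delta functions X(zq²), -z²q⁵ X(zq) and z⁴q⁸ X(z), simplified by
-- `X-const`. In the renamed q they live at z³ = q^-2, z³ = q^-1 and z = 1.
Ξ₁ Ξ₂ Ξ₃ Ξ : F
Ξ₁ m n = ξ (+ 3 * n + + 1 - + 2 * m)
Ξ₂ m n = - ξ (+ 3 * n - + 2 - m)
Ξ₃ m n = ξ (+ 3 * n - + 7)
Ξ = Ξ₁ ⊞ Ξ₂ ⊞ Ξ₃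

-- Take the functional equation at zq², subtract z²q⁵ times the one at zq and add z⁴q⁸ times the one
-- at z: the middle terms V₂ and V₃ cancel, and `δ-mod3` removes the polynomial part.
g-shift : σ g ≋ mono (- + 1) (+ 6) (+ 3) g ⊞ Ξ
g-shift m n = begin
  v m (+ 3 * (n - m) + + 1) ≡⟨ cong (v m) (i₁ m n) ⟩
  V₁ ≡⟨ l V₁ V₂ V₃ V₄ _ _ _ _ _ _ z₁ z₂ z₃ z₄ z₅ z₆ ⟩
  - + 1 * V₄ + (X m (N - + 2 * m) + - (V₂ + V₃ - δ (m - + 2) (N - m - + 3) + δ (m - + 2 - + 2) (N - m - + 3 - + 1)) + (V₃ + V₄ - δ (m - + 4) (N - + 8) + δ (m - + 4 - + 2) (N - + 8 - + 1)))
    ≡⟨ cong₂ (λ x y → - + 1 * V₄ + (X m (N - + 2 * m) + - x + y)) X₂ X₃ ⟩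
  - + 1 * V₄ + (X m (N - + 2 * m) + - X (m - + 2) (N - m - + 3) + X (m - + 4) (N - + 8))
    ≡⟨ cong₂ _+_ (cong (λ x → - + 1 * v (m - + 6) x) (i₂ n)) (cong₂ _+_ (cong₂ (λ x y → x + - y)
         (X-const m (N - + 2 * m)) (trans (X-const (m - + 2) (N - m - + 3)) (cong ξ (i₃ m n)))) (trans (X-const (m - + 4) (N - + 8)) (cong ξ (i₄ n)))) ⟩
  - + 1 * v (m - + 6) (+ 3 * (n - + 3) + + 1) + (ξ (N - + 2 * m) + - ξ (+ 3 * n - + 2 - m) + ξ (+ 3 * n - + 7)) ∎
  where
  open ≡-Reasoning
  N = + 3 * n + + 1
  V₁ = v m (N - + 2 * m - m)
  V₂ = v (m - + 2) (N - + 2 * m - + 1)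
  V₃ = v (m - + 4) (N - m - + 4)
  V₄ = v (m - + 6) (N - + 9)
  i₁ : ∀ m n → + 3 * (n - m) + + 1 ≡ + 3 * n + + 1 - + 2 * m - m
  i₁ = solve-∀
  i₂ : ∀ n → + 3 * n + + 1 - + 9 ≡ + 3 * (n - + 3) + + 1
  i₂ = solve-∀
  i₃ : ∀ m n → + 3 * n + + 1 - m - + 3 ≡ + 3 * n - + 2 - m
  i₃ = solve-∀
  i₄ : ∀ n → + 3 * n + + 1 - + 8 ≡ + 3 * n - + 7
  i₄ = solve-∀
  j₁ : ∀ N m → N - + 2 * m - + 1 ≡ N - m - + 3 - (m - + 2)
  j₁ = solve-∀
  j₂ : ∀ m → m - + 4 ≡ m - + 2 - + 2
  j₂ = solve-∀
  j₃ : ∀ N m → N - m - + 4 ≡ N - m - + 3 - + 1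
  j₃ = solve-∀
  j₄ : ∀ N m → N - m - + 4 ≡ N - + 8 - (m - + 4)
  j₄ = solve-∀
  j₅ : ∀ m → m - + 6 ≡ m - + 4 - + 2
  j₅ = solve-∀
  j₆ : ∀ N → N - + 9 ≡ N - + 8 - + 1
  j₆ = solve-∀
  X₂ : V₂ + V₃ - δ (m - + 2) (N - m - + 3) + δ (m - + 2 - + 2) (N - m - + 3 - + 1) ≡ X (m - + 2) (N - m - + 3)
  X₂ = cong₂ (λ x y → x + y - δ (m - + 2) (N - m - + 3) + δ (m - + 2 - + 2) (N - m - + 3 - + 1))
    (cong (v (m - + 2)) (j₁ N m)) (cong₂ v (j₂ m) (j₃ N m))
  X₃ : V₃ + V₄ - δ (m - + 4) (N - + 8) + δ (m - + 4 - + 2) (N - + 8 - + 1) ≡ X (m - + 4) (N - + 8)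
  X₃ = cong₂ (λ x y → x + y - δ (m - + 4) (N - + 8) + δ (m - + 4 - + 2) (N - + 8 - + 1))
    (cong (v (m - + 4)) (j₄ N m)) (cong₂ v (j₅ m) (j₆ N))
  k₁ : ∀ m n → + 3 * n + + 1 - + 2 * m ≡ + 3 * n + + 1 + - + 2 * m
  k₁ = solve-∀
  k₂ : ∀ m n → + 3 * n + + 1 - + 2 * m - + 1 ≡ + 3 * (n - + 2) + + 2 + - + 2 * (m - + 2)
  k₂ = solve-∀
  k₃ : ∀ m n → + 3 * n + + 1 - m - + 3 ≡ + 3 * (n - + 2) + + 2 + - + 1 * (m - + 2)
  k₃ = solve-∀
  k₄ : ∀ m n → + 3 * n + + 1 - m - + 3 - + 1 ≡ + 3 * (n - + 3) + + 2 + - + 1 * (m - + 2 - + 2)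
  k₄ = solve-∀
  k₅ : ∀ m n → + 3 * n + + 1 - + 8 ≡ + 3 * (n - + 3) + + 2 + + 0 * (m - + 4)
  k₅ = solve-∀
  k₆ : ∀ m n → + 3 * n + + 1 - + 8 - + 1 ≡ + 3 * (n - + 3) + + 1 + + 0 * (m - + 4 - + 2)
  k₆ = solve-∀
  0<2 = ℕ.s≤s (ℕ.z≤n {1})
  1<2 = ℕ.s≤s (ℕ.s≤s (ℕ.z≤n {0}))
  z₁ : δ m (N - + 2 * m) ≡ + 0
  z₁ = δ-mod3 0 n (- + 2) 0<2 (k₁ m n)
  z₂ : δ (m - + 2) (N - + 2 * m - + 1) ≡ + 0
  z₂ = δ-mod3 1 (n - + 2) (- + 2) 1<2 (k₂ m n)
  z₃ : δ (m - + 2) (N - m - + 3) ≡ + 0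
  z₃ = δ-mod3 1 (n - + 2) (- + 1) 1<2 (k₃ m n)
  z₄ : δ (m - + 2 - + 2) (N - m - + 3 - + 1) ≡ + 0
  z₄ = δ-mod3 1 (n - + 3) (- + 1) 1<2 (k₄ m n)
  z₅ : δ (m - + 4) (N - + 8) ≡ + 0
  z₅ = δ-mod3 1 (n - + 3) (+ 0) {m - + 4} 1<2 (k₅ m n)
  z₆ : δ (m - + 4 - + 2) (N - + 8 - + 1) ≡ + 0
  z₆ = δ-mod3 0 (n - + 3) (+ 0) {m - + 4 - + 2} 0<2 (k₆ m n)
  l : ∀ V₁ V₂ V₃ V₄ d₁ d₂ d₃ d₄ d₅ d₆ → d₁ ≡ + 0 → d₂ ≡ + 0 → d₃ ≡ + 0 → d₄ ≡ + 0 → d₅ ≡ + 0 → d₆ ≡ + 0 →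
    V₁ ≡ - + 1 * V₄ + (V₁ + V₂ - d₁ + d₂ + - (V₂ + V₃ - d₃ + d₄) + (V₃ + V₄ - d₅ + d₆))
  l V₁ V₂ V₃ V₄ d₁ d₂ d₃ d₄ d₅ d₆ refl refl refl refl refl refl = l′ V₁ V₂ V₃ V₄
    where
    l′ : ∀ V₁ V₂ V₃ V₄ → V₁ ≡ - + 1 * V₄ + (V₁ + V₂ - + 0 + + 0 + - (V₂ + V₃ - + 0 + + 0) + (V₃ + V₄ - + 0 + + 0))
    l′ = solve-∀

u-neg : ∀ m n → n < + 0 → u m n ≡ + 0
u-neg m n q = ∑-zero (suc (∣ m ∣ ℕ.+ ∣ n ∣)) λ k _ → neg⇒0 k (+ k - m) n q

u-low : ∀ m n → m + n < + 0 → u m n ≡ + 0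
u-low m n q = ∑-zero (suc (∣ m ∣ ℕ.+ ∣ n ∣)) λ k _ → p-supp-size k (+ k - m) n
  (<-by (0<+0≤ (<⇒0< q) (0≤+ k)) (l (+ k) m n))
  where
  l : ∀ k m n → + 0 - (- + 1 * (k - m) + + 1 * n) ≡ + 0 - (m + n) + k
  l = solve-∀

-- For positive size the empty overpartition, the only contribution to k = 0, is excluded; this
-- improves `u-low` by one.
u-low′ : ∀ m n → + 0 < n → m + n ≤ + 0 → u m n ≡ + 0
u-low′ m (+ suc n) _ q = ∑-zero (suc (∣ m ∣ ℕ.+ suc n)) λ
  { zero    _ → trans (p-zero (+ 0 - m) (+ suc n)) (ℤₚ.*-zeroʳ (ε (+ 0 - m)))
  ; (suc k) _ → p-supp-size (suc k) (+ suc k - m) (+ suc n)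
      (<-by (0<+0≤ (+<+ (ℕ.s≤s (ℕ.z≤n {k}))) (≤⇒0≤ q)) (l (+ suc k) m (+ suc n))) }
  where
  l : ∀ k m n → + 0 - (- + 1 * (k - m) + + 1 * n) ≡ k + (+ 0 - (m + n))
  l = solve-∀
u-low′ m (+ zero) (+<+ ()) q

v-neg : ∀ m n → n < + 0 → v m n ≡ + 0
v-neg m n q = cong₂ _+_ (u-neg m n q) (u-neg (m - + 1) n q)

v-low : ∀ m n → m + n < + 0 → v m n ≡ + 0
v-low m n q = cong₂ _+_ (u-low m n q) (u-low (m - + 1) n (<-by (0<+0≤ (<⇒0< q) (0≤+ 1)) (l m n)))
  where
  l : ∀ m n → + 0 - (m - + 1 + n) ≡ + 0 - (m + n) + + 1
  l = solve-∀

3n+1<0 : ∀ n → n < + 0 → + 3 * n + + 1 < + 0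
3n+1<0 n q = <-by (0<+0≤ {+ 2} 0<+ (0≤* 3 (≤⇒0≤ (ℤₚ.i<j⇒suc[i]≤j q)))) (l n)
  where
  l : ∀ n → + 0 - (+ 3 * n + + 1) ≡ + 2 + + 3 * (+ 0 - (+ 1 + n))
  l = solve-∀

third-supp-n : ∀ {f} → (∀ m n → n < + 0 → f m n ≡ + 0) → Supp (+ 0) (+ 1) (third f)
third-supp-n s m n q = s m (+ 3 * n + + 1) (3n+1<0 n (subst (_< + 0) (form01 m n) q))

u₁-supp-n : Supp (+ 0) (+ 1) (third u)
u₁-supp-n = third-supp-n u-neg

-- The size 3n + 1 is positive for n ≥ 0, so `u-low′` yields m + 3n ≥ 0 where `u-low` would only
-- yield m + 3n ≥ -1.
u₁-supp-line : Supp (+ 1) (+ 3) (third u)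
u₁-supp-line m n q with n ℤₚ.<? + 0
... | yes n<0 = u-neg m (+ 3 * n + + 1) (3n+1<0 n n<0)
... | no n≮0 = u-low′ m (+ 3 * n + + 1)
  (<-by {d = + 1 + + 3 * n} (0<+0≤ {+ 1} 0<+ (0≤* 3 (ℤₚ.≮⇒≥ n≮0))) (l₁ n))
  (≤-by (≤⇒0≤ (ℤₚ.i<j⇒suc[i]≤j q)) (l₂ m n))
  where
  l₁ : ∀ n → + 3 * n + + 1 - + 0 ≡ + 1 + + 3 * n
  l₁ = solve-∀
  l₂ : ∀ m n → + 0 - (m + (+ 3 * n + + 1)) ≡ + 0 - (+ 1 + (+ 1 * m + + 3 * n))
  l₂ = solve-∀

g≋ : bin (+ 1) (+ 1) (+ 0) (third u) ≋ g
g≋ m n = cong₂ _+_ (refl {x = u m (+ 3 * n + + 1)})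
  (trans (ℤₚ.*-identityˡ (u (m - + 1) (+ 3 * (n - + 0) + + 1))) (cong (λ x → u (m - + 1) (+ 3 * x + + 1)) (ℤₚ.+-identityʳ n)))

supp-≋ : ∀ {α β f f′} → f ≋ f′ → Supp α β f → Supp α β f′
supp-≋ e s m n q = trans (sym (e m n)) (s m n q)

g-supp-n : Supp (+ 0) (+ 1) g
g-supp-n = supp-≋ {+ 0} {+ 1} g≋ (bin-supp {+ 0} {+ 1} {third u} (+ 1) (+ 1) (+ 0) u₁-supp-n (0≤+ _))

g-supp-line : Supp (+ 1) (+ 3) g
g-supp-line = supp-≋ {+ 1} {+ 3} g≋ (bin-supp {+ 1} {+ 3} {third u} (+ 1) (+ 1) (+ 0) u₁-supp-line (0≤+ _))

row : ℕ → PS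
row k n = ∑ (λ j → p k (+ j) (+ n)) (suc n)

tot : PS
tot n = row n n

p-stable : ∀ d k j n → n ≤ + k → p (d ℕ.+ k) j n ≡ p k j n
p-stable zero    k j n q = refl
p-stable (suc d) k j n q = trans (p-suc (d ℕ.+ k) j n) (trans (cong₂ _+_ (p-stable d k j n q)
  (∑-zero ∣ n ∣ (λ i _ → added-vanish (d ℕ.+ k) j n i
    (ℤₚ.≤-<-trans q (+<+ (ℕₚ.≤-trans (ℕ.s≤s (ℕₚ.m≤n+m k d)) (ℕₚ.m≤n*m (suc (d ℕ.+ k)) (suc i))))))))
  (ℤₚ.+-identityʳ (p k j n)))

row-stable : ∀ d n → row (d ℕ.+ n) n ≡ tot n
row-stable d n = ∑-cong (suc n) λ j _ → p-stable d n (+ j) (+ n) ℤₚ.≤-refl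

∑-split : ∀ f a b → ∑ f (a ℕ.+ b) ≡ ∑ f a + ∑ (λ i → f (a ℕ.+ i)) b
∑-split f a zero    = trans (cong (∑ f) (ℕₚ.+-identityʳ a)) (sym (ℤₚ.+-identityʳ (∑ f a)))
∑-split f a (suc b) = trans (cong (∑ f) (ℕₚ.+-suc a b)) (trans (cong (_+ f (a ℕ.+ b)) (∑-split f a b))
  (ℤₚ.+-assoc (∑ f a) (∑ (λ i → f (a ℕ.+ i)) b) (f (a ℕ.+ b))))

-- For m ≥ n the terms have k = m + j ≥ n, so the bound on the parts is no restriction and the sum
-- runs over all numbers of parts j.
u-large : ∀ d n → u (+ (d ℕ.+ n)) (+ n) ≡ tot n
u-large d n = begin
  ∑ (uTerm (+ M) (+ n)) (suc (M ℕ.+ n)) ≡⟨ cong (∑ (uTerm (+ M) (+ n))) (sym (ℕₚ.+-suc M n)) ⟩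
  ∑ (uTerm (+ M) (+ n)) (M ℕ.+ suc n) ≡⟨ ∑-split (uTerm (+ M) (+ n)) M (suc n) ⟩
  ∑ (uTerm (+ M) (+ n)) M + ∑ (λ j → uTerm (+ M) (+ n) (M ℕ.+ j)) (suc n)
    ≡⟨ cong₂ _+_ (∑-zero M low) (∑-cong (suc n) high) ⟩
  + 0 + tot n ≡⟨ ℤₚ.+-identityˡ (tot n) ⟩
  tot n ∎
  where
  open ≡-Reasoning
  M = d ℕ.+ n
  l : ∀ k M n → + 0 - (+ 1 * (k - M) + + 0 * n) ≡ M - k
  l = solve-∀
  l₂ : ∀ M j → M + j - M ≡ j
  l₂ = solve-∀
  low : ∀ k → k ℕ.< M → uTerm (+ M) (+ n) k ≡ + 0
  low k q = p-supp-parts k (+ k - + M) (+ n) (<-by (<⇒0< (+<+ q)) (l (+ k) (+ M) (+ n)))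
  high : ∀ j → j ℕ.< suc n → uTerm (+ M) (+ n) (M ℕ.+ j) ≡ p n (+ j) (+ n)
  high j _ = trans (cong₂ (λ x k → p k x (+ n)) (l₂ (+ M) (+ j)) (trans (ℕₚ.+-comm M j) (sym (ℕₚ.+-assoc j d n))))
    (p-stable (j ℕ.+ d) n (+ j) (+ n) ℤₚ.≤-refl)

-- X does not depend on m, so it is read at a large m: there σ v vanishes and v = u + u/shifted has
-- reached its constant value 2 tot.
ξ-pos : ∀ n → ξ (+ suc n) ≡ + 2 * tot n
ξ-pos n = trans (sym (X-const (+ M) (+ suc n))) (trans
  (cong₂ _+_ (cong₂ _-_ (cong₂ _+_ (v-neg (+ M) (+ suc n - + M) (<-by {d = + 2} 0<+ (l₁ (+ n))))
       (cong₂ _+_ (u-large 1 n) (u-large 0 n)))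
     (δ-≢ {+ M} (+ suc n) λ ())) (δ-≢ {+ suc n} (+ n) λ ()))
  (l₂ (tot n)))
  where
  M = 3 ℕ.+ n
  l₁ : ∀ n → + 0 - (+ 1 + n - (+ 3 + n)) ≡ + 2
  l₁ = solve-∀
  l₂ : ∀ t → + 0 + (t + t) - + 0 + + 0 ≡ + 2 * t
  l₂ = solve-∀

ξ-nonpos : ∀ n → n < + 1 → ξ n ≡ + 0
ξ-nonpos n q = trans (sym (X-const (+ 3) n)) (cong₂ _+_ (cong₂ _-_ (cong₂ _+_
    (v-neg (+ 3) (n - + 3) (<-by (0<+0≤ (<⇒0< q) (0≤+ 2)) (l₁ n)))
    (v-neg (+ 1) (n - + 1) (<-by (<⇒0< q) (l₂ n))))
  (δ-≢ {+ 3} n λ ())) (δ-≢ {+ 1} (n - + 1) λ ()))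
  where
  l₁ : ∀ n → + 0 - (n - + 3) ≡ + 1 - n + + 2
  l₁ = solve-∀
  l₂ : ∀ n → + 0 - (n - + 1) ≡ + 1 - n
  l₂ = solve-∀

ξ-tot : ∀ k → ξ (k + + 1) ≡ ↑ (+ 2 · tot) k
ξ-tot (+ n)    = trans (cong (ξ ∘ +_) (ℕₚ.+-comm n 1)) (ξ-pos n)
ξ-tot -[1+ n ] = ξ-nonpos (-[1+ n ] + + 1) (ℤₚ.+-monoˡ-< (+ 1) { -[1+ n ]} {+ 0} -<+)

-- Now X is read at very negative m, where z²q v vanishes: X m (k + 1) is v m (k + 1 - m), which is
-- the entry of `g` on the line m + 3n = k. Its value is already known from the other end.
Tends-g : Tends g (+ 2 · tot)
Tends-g k = suc (∣ k ∣ ℕ.+ ∣ k ∣) , λ n q → trans (value n (m<0 n q) (low n q)) (ξ-tot k)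
  where
  l₁ : ∀ k n → + 3 * n + + 1 ≡ k + + 1 - (k - + 3 * n)
  l₁ = solve-∀
  l₂ : ∀ v → v ≡ v + + 0 - + 0 + + 0
  l₂ = solve-∀
  l₃ : ∀ k n K → + 0 - (k - + 3 * n) ≡ n - (+ 1 + (K + K)) + (K + (K - k) + + 2 * n + + 1)
  l₃ = solve-∀
  l₄ : ∀ k n K → + 0 - (k - + 3 * n - + 2 + (k + + 1 - + 1)) ≡ n - (+ 1 + (K + K)) + (+ 2 * (K - k) + + 2 * n + + 3)
  l₄ = solve-∀
  nonneg : ∀ n → + suc (∣ k ∣ ℕ.+ ∣ k ∣) ≤ n → + 0 ≤ n
  nonneg n = ℤₚ.≤-trans (0≤+ _)
  m<0 : ∀ n → + suc (∣ k ∣ ℕ.+ ∣ k ∣) ≤ n → k - + 3 * n < + 0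
  m<0 n q = <-by (subst (+ 0 <_) (ℤₚ.+-comm (+ ∣ k ∣ + (+ ∣ k ∣ - k) + + 2 * n + + 1) (n - + suc (∣ k ∣ ℕ.+ ∣ k ∣)))
      (0<+0≤ (subst (+ 0 <_) (ℤₚ.+-comm (+ 1) (+ ∣ k ∣ + (+ ∣ k ∣ - k) + + 2 * n))
        (0<+0≤ {+ 1} 0<+ (0≤+0≤ (0≤+0≤ (0≤+ (∣ k ∣)) (≤⇒0≤ (i≤∣i∣ k))) (0≤* 2 (nonneg n q))))) (≤⇒0≤ q)))
    (l₃ k n (+ ∣ k ∣))
  low : ∀ n → + suc (∣ k ∣ ℕ.+ ∣ k ∣) ≤ n → k - + 3 * n - + 2 + (k + + 1 - + 1) < + 0
  low n q = <-by (subst (+ 0 <_) (ℤₚ.+-comm (+ 2 * (+ ∣ k ∣ - k) + + 2 * n + + 3) (n - + suc (∣ k ∣ ℕ.+ ∣ k ∣)))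
      (0<+0≤ (subst (+ 0 <_) (ℤₚ.+-comm (+ 3) (+ 2 * (+ ∣ k ∣ - k) + + 2 * n))
        (0<+0≤ {+ 3} 0<+ (0≤+0≤ (0≤* 2 (≤⇒0≤ (i≤∣i∣ k))) (0≤* 2 (nonneg n q))))) (≤⇒0≤ q)))
    (l₄ k n (+ ∣ k ∣))
  value : ∀ n → k - + 3 * n < + 0 → k - + 3 * n - + 2 + (k + + 1 - + 1) < + 0 → g (k - + 3 * n) n ≡ ξ (k + + 1)
  value n m<0 low = trans (cong (v m) (l₁ k n)) (trans (l₂ (v m (k + + 1 - m)))
    (trans (sym (cong₂ _+_ (cong₂ _-_ (cong (_+_ (v m (k + + 1 - m))) (v-low (m - + 2) (k + + 1 - + 1) low))
        (δ-≢ {m} (k + + 1) (ℤₚ.<⇒≢ m<0))) (δ-≢ {m - + 2} (k + + 1 - + 1) (ℤₚ.<⇒≢ (ℤₚ.≤-<-trans (ℤₚ.i-j≤i m (+ 2)) m<0)))))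
      (X-const m (k + + 1))))
    where
    m = k - + 3 * n

-- Infinite products of power series.

⊛-cong≤ : ∀ {f f′ g g′} n → (∀ i → i ℕ.≤ n → f i ≡ f′ i) → (∀ i → i ℕ.≤ n → g i ≡ g′ i) → (f ⊛ g) n ≡ (f′ ⊛ g′) n
⊛-cong≤ {f} {f′} {g} {g′} zero p q =
  trans (⊛-zero f g) (trans (cong₂ _*_ (p 0 ℕ.z≤n) (q 0 ℕ.z≤n)) (sym (⊛-zero f′ g′)))
⊛-cong≤ {f} {f′} {g} {g′} (suc n) p q = trans (⊛-suc f g n) (trans
  (cong₂ _+_ (cong₂ _*_ (p 0 ℕ.z≤n) (q (suc n) ℕₚ.≤-refl))
    (⊛-cong≤ n (λ i le → p (suc i) (ℕ.s≤s le)) (λ i le → q i (ℕₚ.m≤n⇒m≤1+n le))))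
  (sym (⊛-suc f′ g′ n)))

∙-cong≤ : ∀ {f f′ g g′} n → (∀ i → i ℕ.≤ n → f i ≡ f′ i) → (∀ i → i ℕ.≤ n → g i ≡ g′ i) → (f ∙ g) n ≡ (f′ ∙ g′) n
∙-cong≤ {f} {f′} {g} {g′} n p q = trans (cong (λ h → h n) (∙≡⊛ f g))
  (trans (⊛-cong≤ {f} {f′} {g} {g′} n p q) (cong (λ h → h n) (sym (∙≡⊛ f′ g′))))

-- f i = 1 + O(q^(i+1)), which makes the infinite product below meaningful
Unit : (ℕ → PS) → Set
Unit f = ∀ i n → n ℕ.≤ i → f i n ≡ one n

opaque
  ∏ : (ℕ → PS) → PS
  ∏ f n = prod f (suc n) n

  ∏-def : ∀ f n → ∏ f n ≡ prod f (suc n) n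
  ∏-def f n = refl

∙-one≤ : ∀ f {g} n → (∀ i → i ℕ.≤ n → g i ≡ one i) → (f ∙ g) n ≡ f n
∙-one≤ f n p = trans (∙-cong≤ n (λ _ _ → refl) p) (PS.*-identityʳ f n)

prod-stab : ∀ {f} d N n → Unit f → n ℕ.≤ N → prod f (d ℕ.+ N) n ≡ prod f N n
prod-stab zero    N n un le = refl
prod-stab {f} (suc d) N n un le = trans
  (∙-one≤ (prod f (d ℕ.+ N)) n (λ i i≤n → un (d ℕ.+ N) i (ℕₚ.≤-trans i≤n (ℕₚ.≤-trans le (ℕₚ.m≤n+m N d)))))
  (prod-stab d N n un le)

prod-∏ : ∀ {f} N n → Unit f → n ℕ.≤ N → prod f N n ≡ ∏ f n
prod-∏ {f} N n un le = sym (trans (∏-def f n) (sym (trans (cong (λ k → prod f k n) (sym (ℕₚ.m∸n+n≡m le)))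
  (trans (prod-stab (N ∸ n) n n un ℕₚ.≤-refl) (sym (prod-stab 1 n n un ℕₚ.≤-refl))))))

prod-cong : ∀ {f g} N → (∀ i → f i ≈ g i) → prod f N ≈ prod g N
prod-cong zero    e = PS.refl
prod-cong (suc N) e = ∙-cong (prod-cong N e) (e N)

∏-cong : ∀ {f g} → (∀ i → f i ≈ g i) → ∏ f ≈ ∏ g
∏-cong {f} {g} e n = trans (∏-def f n) (trans (prod-cong (suc n) e n) (sym (∏-def g n)))

medial : ∀ a b c d → (a ∙ b) ∙ (c ∙ d) ≈ (a ∙ c) ∙ (b ∙ d)
medial a b c d = begin
  (a ∙ b) ∙ (c ∙ d) ≈⟨ PS.*-assoc a b (c ∙ d) ⟩
  a ∙ (b ∙ (c ∙ d)) ≈⟨ PS.*-cong PS.refl (PS.*-assoc b c d) ⟨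
  a ∙ ((b ∙ c) ∙ d) ≈⟨ PS.*-cong PS.refl (PS.*-cong (PS.*-comm b c) PS.refl) ⟩
  a ∙ ((c ∙ b) ∙ d) ≈⟨ PS.*-cong PS.refl (PS.*-assoc c b d) ⟩
  a ∙ (c ∙ (b ∙ d)) ≈⟨ PS.*-assoc a c (b ∙ d) ⟨
  (a ∙ c) ∙ (b ∙ d) ∎
  where open PS-Reasoning

prod-∙ : ∀ f g N → prod (λ i → f i ∙ g i) N ≈ prod f N ∙ prod g N
prod-∙ f g zero    = PS.sym (PS.*-identityˡ one)
prod-∙ f g (suc N) = PS.trans (PS.*-cong (prod-∙ f g N) PS.refl) (medial (prod f N) (prod g N) (f N) (g N))

Unit-∙ : ∀ {f g} → Unit f → Unit g → Unit (λ i → f i ∙ g i)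
Unit-∙ {f} un un′ i n le = trans (∙-one≤ (f i) n (λ k k≤n → un′ i k (ℕₚ.≤-trans k≤n le))) (un i n le)

∏-∙ : ∀ {f g} → Unit f → Unit g → ∏ (λ i → f i ∙ g i) ≈ ∏ f ∙ ∏ g
∏-∙ {f} {g} un un′ n = trans (∏-def (λ i → f i ∙ g i) n) (trans (prod-∙ f g (suc n) n)
  (∙-cong≤ n (λ i le → prod-∏ (suc n) i un (ℕₚ.m≤n⇒m≤1+n le)) (λ i le → prod-∏ (suc n) i un′ (ℕₚ.m≤n⇒m≤1+n le))))

block2 block3 : (ℕ → PS) → ℕ → PS
block2 f i = f (2 ℕ.* i) ∙ f (1 ℕ.+ 2 ℕ.* i)
block3 f i = f (3 ℕ.* i) ∙ (f (1 ℕ.+ 3 ℕ.* i) ∙ f (2 ℕ.+ 3 ℕ.* i))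

prod-block2 : ∀ f N → prod f (2 ℕ.* N) ≈ prod (block2 f) N
prod-block2 f zero    = PS.refl
prod-block2 f (suc N) = begin
  prod f (2 ℕ.* suc N) ≡⟨ cong (prod f) (ℕₚ.*-suc 2 N) ⟩
  prod f (2 ℕ.* N) ∙ f (2 ℕ.* N) ∙ f (1 ℕ.+ 2 ℕ.* N) ≈⟨ PS.*-assoc (prod f (2 ℕ.* N)) (f (2 ℕ.* N)) (f (1 ℕ.+ 2 ℕ.* N)) ⟩
  prod f (2 ℕ.* N) ∙ block2 f N ≈⟨ PS.*-cong (prod-block2 f N) PS.refl ⟩
  prod (block2 f) N ∙ block2 f N ∎
  where open PS-Reasoning

prod-block3 : ∀ f N → prod f (3 ℕ.* N) ≈ prod (block3 f) N
prod-block3 f zero    = PS.refl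
prod-block3 f (suc N) = begin
  prod f (3 ℕ.* suc N) ≡⟨ cong (prod f) (ℕₚ.*-suc 3 N) ⟩
  r ∙ a ∙ b ∙ c ≈⟨ PS.*-assoc (r ∙ a) b c ⟩
  r ∙ a ∙ (b ∙ c) ≈⟨ PS.*-assoc r a (b ∙ c) ⟩
  r ∙ block3 f N ≈⟨ PS.*-cong (prod-block3 f N) PS.refl ⟩
  prod (block3 f) N ∙ block3 f N ∎
  where
  open PS-Reasoning
  r = prod f (3 ℕ.* N)
  a = f (3 ℕ.* N)
  b = f (1 ℕ.+ 3 ℕ.* N)
  c = f (2 ℕ.+ 3 ℕ.* N)

∏-block2 : ∀ {f} → Unit f → ∏ f ≈ ∏ (block2 f)
∏-block2 {f} un n = trans (sym (prod-∏ (2 ℕ.* suc n) n un (ℕₚ.≤-trans (ℕₚ.n≤1+n n) (ℕₚ.m≤n*m (suc n) 2)))) (trans (prod-block2 f (suc n) n) (sym (∏-def (block2 f) n)))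

∏-block3 : ∀ {f} → Unit f → ∏ f ≈ ∏ (block3 f)
∏-block3 {f} un n = trans (sym (prod-∏ (3 ℕ.* suc n) n un (ℕₚ.≤-trans (ℕₚ.n≤1+n n) (ℕₚ.m≤n*m (suc n) 3)))) (trans (prod-block3 f (suc n) n) (sym (∏-def (block3 f) n)))

-- For `line₁`, where the factor dropped at index 0 leaves one family of factors an index behind the
-- others.
delay : (ℕ → PS) → ℕ → PS
delay f zero    = one
delay f (suc i) = f i

prod-delay : ∀ f N → prod (delay f) (suc N) ≈ prod f N
prod-delay f zero    = PS.*-identityˡ one
prod-delay f (suc N) = PS.*-cong (prod-delay f N) PS.refl

∏-delay : ∀ {f} → Unit f → ∏ (delay f) ≈ ∏ f
∏-delay {f} un n = trans (∏-def (delay f) n) (trans (prod-delay f n n) (prod-∏ n n un ℕₚ.≤-refl))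

onePlus-low : ∀ c e n → n ℕ.< e → onePlus c e n ≡ one n
onePlus-low c e n n<e = trans
  (cong (λ b → one n + c * (if b then + 1 else + 0)) (dec-false (n ℕₚ.≟ e) (ℕₚ.<⇒≢ n<e)))
  (trans (cong (_+_ (one n)) (ℤₚ.*-zeroʳ c)) (ℤₚ.+-identityʳ (one n)))

Unit-onePlus : ∀ c (e : ℕ → ℕ) → (∀ i → i ℕ.< e i) → Unit (λ i → onePlus c (e i))
Unit-onePlus c e lt i n le = onePlus-low c (e i) n (ℕₚ.≤-<-trans le (lt i))

-- The product (-c q^a; q^m)∞.
E : ℤ → ℕ → ℕ → PS
E c a m = ∏ (λ i → onePlus c (a ℕ.+ m ℕ.* i))

E⁻ E⁺ : ℕ → ℕ → PS
E⁻ = E (- + 1)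
E⁺ = E (+ 1)

prog< : ∀ a m i → i ℕ.< suc a ℕ.+ suc m ℕ.* i
prog< a m i = ℕ.s≤s (ℕₚ.≤-trans (ℕₚ.m≤n*m i (suc m)) (ℕₚ.m≤n+m (suc m ℕ.* i) a))

Unit-E : ∀ c a m → Unit (λ i → onePlus c (suc a ℕ.+ suc m ℕ.* i))
Unit-E c a m = Unit-onePlus c (λ i → suc a ℕ.+ suc m ℕ.* i) (prog< a m)

E-split2 : ∀ c a m → E c (suc a) (suc m) ≈ E c (suc a) (2 ℕ.* suc m) ∙ E c (suc a ℕ.+ suc m) (2 ℕ.* suc m)
E-split2 c a m = PS.trans (∏-block2 (Unit-E c a m)) (PS.trans
  (∏-cong λ i → PS.*-cong (PS.reflexive (cong (onePlus c) (l₁ i))) (PS.reflexive (cong (onePlus c) (l₂ i))))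
  (∏-∙ (Unit-E c a (m ℕ.+ 1 ℕ.* suc m)) (Unit-E c (a ℕ.+ suc m) (m ℕ.+ 1 ℕ.* suc m))))
  where
  l₁ : ∀ i → suc a ℕ.+ suc m ℕ.* (2 ℕ.* i) ≡ suc a ℕ.+ (2 ℕ.* suc m) ℕ.* i
  l₁ i = cong (suc a ℕ.+_) (trans (sym (ℕₚ.*-assoc (suc m) 2 i)) (cong (ℕ._* i) (ℕₚ.*-comm (suc m) 2)))
  l₂ : ∀ i → suc a ℕ.+ suc m ℕ.* (1 ℕ.+ 2 ℕ.* i) ≡ suc a ℕ.+ suc m ℕ.+ (2 ℕ.* suc m) ℕ.* i
  l₂ i = trans (cong (suc a ℕ.+_) (ℕₚ.*-suc (suc m) (2 ℕ.* i))) (trans (sym (ℕₚ.+-assoc (suc a) (suc m) _))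
    (cong (suc a ℕ.+ suc m ℕ.+_) (trans (sym (ℕₚ.*-assoc (suc m) 2 i)) (cong (ℕ._* i) (ℕₚ.*-comm (suc m) 2)))))

E-split3 : ∀ c a m → E c (suc a) (suc m) ≈
  E c (suc a) (3 ℕ.* suc m) ∙ (E c (suc a ℕ.+ suc m) (3 ℕ.* suc m) ∙ E c (suc a ℕ.+ 2 ℕ.* suc m) (3 ℕ.* suc m))
E-split3 c a m = PS.trans (∏-block3 (Unit-E c a m)) (PS.trans
  (∏-cong λ i → PS.*-cong (PS.reflexive (cong (onePlus c) (l 0 i)))
    (PS.*-cong (PS.reflexive (cong (onePlus c) (l 1 i))) (PS.reflexive (cong (onePlus c) (l 2 i)))))
  (PS.trans (∏-cong λ i → PS.*-cong (PS.reflexive (cong (λ x → onePlus c (x ℕ.+ (3 ℕ.* suc m) ℕ.* i)) (ℕₚ.+-identityʳ (suc a))))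
    (PS.*-cong (PS.reflexive (cong (λ x → onePlus c (suc a ℕ.+ x ℕ.+ (3 ℕ.* suc m) ℕ.* i)) (ℕₚ.*-identityˡ (suc m)))) PS.refl))
  (PS.trans (∏-∙ (Unit-E c a k) (Unit-∙ (Unit-E c (a ℕ.+ suc m) k) (Unit-E c (a ℕ.+ 2 ℕ.* suc m) k)))
    (PS.*-cong PS.refl (∏-∙ (Unit-E c (a ℕ.+ suc m) k) (Unit-E c (a ℕ.+ 2 ℕ.* suc m) k))))))
  where
  k = m ℕ.+ 2 ℕ.* suc m
  l : ∀ r i → suc a ℕ.+ suc m ℕ.* (r ℕ.+ 3 ℕ.* i) ≡ suc a ℕ.+ r ℕ.* suc m ℕ.+ (3 ℕ.* suc m) ℕ.* i
  l r i = trans (cong (suc a ℕ.+_) (trans (ℕₚ.*-distribˡ-+ (suc m) r (3 ℕ.* i)) (cong₂ ℕ._+_ (ℕₚ.*-comm (suc m) r)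
      (trans (sym (ℕₚ.*-assoc (suc m) 3 i)) (cong (ℕ._* i) (ℕₚ.*-comm (suc m) 3))))))
    (sym (ℕₚ.+-assoc (suc a) (r ℕ.* suc m) _))

-- The product for the number of overpartitions.

∑-+ : ∀ f g n → ∑ (λ i → f i + g i) n ≡ ∑ f n + ∑ g n
∑-+ f g zero    = refl
∑-+ f g (suc n) = trans (cong (_+ (f n + g n)) (∑-+ f g n)) (l (∑ f n) (∑ g n) (f n) (g n))
  where
  l : ∀ a b c d → a + b + (c + d) ≡ a + c + (b + d)
  l = solve-∀

∑-* : ∀ c f n → ∑ (λ i → c * f i) n ≡ c * ∑ f n
∑-* c f zero    = sym (ℤₚ.*-zeroʳ c)
∑-* c f (suc n) = trans (cong (_+ c * f n) (∑-* c f n)) (sym (ℤₚ.*-distribˡ-+ c (∑ f n) (f n)))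

-- The terms at the ends of the shifted range vanish: no overpartition has -1 parts, or more parts
-- than its size.
row-shift : ∀ k n e → ∑ (λ j → p k (+ j - + 1) (+ n - + suc e)) (suc n) ≡ ↑ (row k) (+ n - + suc e)
row-shift k n e = go (+ n - + suc e) below
  where
  l : ∀ n e → n - (n - (+ 1 + e)) ≡ + 1 + e
  l = solve-∀
  below : + n - + suc e < + n
  below = <-by (+<+ (ℕ.s≤s (ℕ.z≤n {e}))) (l (+ n) (+ e))
  go : ∀ d → d < + n → ∑ (λ j → p k (+ j - + 1) d) (suc n) ≡ ↑ (row k) d
  go -[1+ d ] _       = ∑-zero {λ j → p k (+ j - + 1) -[1+ d ]} (suc n) (λ _ _ → refl)
  go (+ d)    (+<+ q) = trans (∑-head (λ j → p k (+ j - + 1) (+ d)) n) (trans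
    (cong₂ _+_ (p-supp-parts k -[1+ 0 ] (+ d) -<+) (∑-extend {λ j → p k (+ j) (+ d)} q λ j d<j →
      p-supp-size k (+ j) (+ d) (<-by (<⇒0< (+<+ d<j)) (l₂ (+ j) (+ d)))))
    (ℤₚ.+-identityˡ (row k d)))
    where
    l₂ : ∀ j d → + 0 - (- + 1 * j + + 1 * d) ≡ j - d
    l₂ = solve-∀

row-bin : ∀ k c e n → (row k ∙ onePlus c (suc e)) n ≡ ∑ (λ j → bin c (+ 1) (+ suc e) (p k) (+ j) (+ n)) (suc n)
row-bin k c e n = sym (begin
  ∑ (λ j → p k (+ j) (+ n) + c * p k (+ j - + 1) (+ n - + suc e)) (suc n)
    ≡⟨ ∑-+ (λ j → p k (+ j) (+ n)) (λ j → c * p k (+ j - + 1) (+ n - + suc e)) (suc n) ⟩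
  row k n + ∑ (λ j → c * p k (+ j - + 1) (+ n - + suc e)) (suc n)
    ≡⟨ cong (_+_ (row k n)) (trans (∑-* c (λ j → p k (+ j - + 1) (+ n - + suc e)) (suc n)) (cong (c *_) (row-shift k n e))) ⟩
  row k n + c * ↑ (row k) (+ n - + suc e)
    ≡⟨ onePlus-∙ c (suc e) (row k) (+ n) ⟨
  (row k ∙ onePlus c (suc e)) n ∎)
  where open ≡-Reasoning

-- This is `p-rec` at x = 1.
row-rec : ∀ k → row (suc k) ∙ onePlus (- + 1) (suc k) ≈ row k ∙ onePlus (+ 1) (suc k)
row-rec k n = trans (row-bin (suc k) (- + 1) k n) (trans
  (∑-cong (suc n) (λ j _ → p-rec k (+ j) (+ n))) (sym (row-bin k (+ 1) k n)))

row-zero : row 0 ≈ one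
row-zero zero    = refl
row-zero (suc n) = ∑-zero (suc (suc n)) (λ j _ → trans (p-zero (+ j) (+ suc n)) (ℤₚ.*-zeroʳ (ε (+ j))))

factors : ℤ → ℕ → PS
factors c i = onePlus c (1 ℕ.+ 1 ℕ.* i)

row-prod : ∀ N → row N ∙ prod (factors (- + 1)) N ≈ prod (factors (+ 1)) N
row-prod zero    = PS.trans (PS.*-identityʳ (row 0)) row-zero
row-prod (suc N) = begin
  row (suc N) ∙ (prod (factors (- + 1)) N ∙ factors (- + 1) N) ≈⟨ PS.*-congˡ (PS.*-comm (prod (factors (- + 1)) N) (factors (- + 1) N)) ⟩
  row (suc N) ∙ (factors (- + 1) N ∙ prod (factors (- + 1)) N) ≈⟨ PS.*-assoc (row (suc N)) (factors (- + 1) N) (prod (factors (- + 1)) N) ⟨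
  row (suc N) ∙ factors (- + 1) N ∙ prod (factors (- + 1)) N ≡⟨ cong (λ e → row (suc N) ∙ onePlus (- + 1) (suc e) ∙ prod (factors (- + 1)) N) (ℕₚ.*-identityˡ N) ⟩
  row (suc N) ∙ onePlus (- + 1) (suc N) ∙ prod (factors (- + 1)) N ≈⟨ PS.*-congʳ (row-rec N) ⟩
  row N ∙ onePlus (+ 1) (suc N) ∙ prod (factors (- + 1)) N ≡⟨ cong (λ e → row N ∙ onePlus (+ 1) (suc e) ∙ prod (factors (- + 1)) N) (ℕₚ.*-identityˡ N) ⟨
  row N ∙ factors (+ 1) N ∙ prod (factors (- + 1)) N ≈⟨ PS.*-assoc (row N) (factors (+ 1) N) (prod (factors (- + 1)) N) ⟩
  row N ∙ (factors (+ 1) N ∙ prod (factors (- + 1)) N) ≈⟨ PS.*-congˡ (PS.*-comm (factors (+ 1) N) (prod (factors (- + 1)) N)) ⟩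
  row N ∙ (prod (factors (- + 1)) N ∙ factors (+ 1) N) ≈⟨ PS.*-assoc (row N) (prod (factors (- + 1)) N) (factors (+ 1) N) ⟨
  row N ∙ prod (factors (- + 1)) N ∙ factors (+ 1) N ≈⟨ PS.*-congʳ (row-prod N) ⟩
  prod (factors (+ 1)) N ∙ factors (+ 1) N ∎
  where open PS-Reasoning

tot-product : tot ∙ E⁻ 1 1 ≈ E⁺ 1 1
tot-product n = trans
  (∙-cong≤ n (λ i le → sym (trans (cong (λ k → row k i) (sym (ℕₚ.m∸n+n≡m le))) (row-stable (n ∸ i) i)))
             (λ i le → sym (prod-∏ n i (Unit-E (- + 1) 0 0) le)))
  (trans (row-prod n n) (prod-∏ n n (Unit-E (+ 1) 0 0) ℕₚ.≤-refl))

-- The product formula for g.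

module CM = Algebra.Solver.CommutativeMonoid PS.*-commutativeMonoid

-- Factors of (z, q/z; q)(z³q, q²/z³, z³q², q/z³; q³) and of (-z, -q/z; q)(-q; q)(q³; q³).
X₁ Y₁ Z₁ X₂ Y₂ Z₂ : ℕ → List Factor
X₁ i = (- + 1 , + 3 , + 3 * + i + + 2) ∷ (- + 1 , + 3 , + 3 * + i + + 1) ∷ (- + 1 , + 1 , + 1 * + i + + 0) ∷ []
Y₁ i = (- + 1 , - + 3 , + 3 * + i + - + 2) ∷ (- + 1 , - + 3 , + 3 * + i + - + 1) ∷ (- + 1 , - + 1 , + 1 * + i + + 0) ∷ []
Z₁ i = []
X₂ i = (+ 1 , + 1 , + 1 * + i + + 0) ∷ []
Y₂ i = (+ 1 , - + 1 , + 1 * + i + + 0) ∷ []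
Z₂ i = (+ 1 , + 0 , + 1 * + i + + 1) ∷ (- + 1 , + 0 , + 3 * + i + + 3) ∷ []

up : ∀ r s i → r * + i + s + r ≡ r * + suc i + s
up r s i = l r s (+ i)
  where
  l : ∀ r s i → r * i + s + r ≡ r * (+ 1 + i) + s
  l = solve-∀

down : ∀ r s i → r * + suc i + s + - r ≡ r * + i + s
down r s i = l r s (+ i)
  where
  l : ∀ r s i → r * (+ 1 + i) + s + - r ≡ r * i + s
  l = solve-∀

factor≡ : ∀ (c a : ℤ) {b b′ : ℤ} → b ≡ b′ → _≡_ {A = Factor} (c , a , b) (c , a , b′)
factor≡ c a refl = refl

σX₁ : ∀ i → map σ-factor (X₁ i) ≡ X₁ (suc i)
σX₁ i = cong₂ _∷_ (factor≡ (- + 1) (+ 3) (up (+ 3) (+ 2) i)) (cong₂ _∷_ (factor≡ (- + 1) (+ 3) (up (+ 3) (+ 1) i))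
  (cong (_∷ []) (factor≡ (- + 1) (+ 1) (up (+ 1) (+ 0) i))))

σY₁ : ∀ i → map σ-factor (Y₁ (suc i)) ≡ Y₁ i
σY₁ i = cong₂ _∷_ (factor≡ (- + 1) (- + 3) (down (+ 3) (- + 2) i)) (cong₂ _∷_ (factor≡ (- + 1) (- + 3) (down (+ 3) (- + 1) i))
  (cong (_∷ []) (factor≡ (- + 1) (- + 1) (down (+ 1) (+ 0) i))))

σX₂ : ∀ i → map σ-factor (X₂ i) ≡ X₂ (suc i)
σX₂ i = cong (_∷ []) (factor≡ (+ 1) (+ 1) (up (+ 1) (+ 0) i))

σY₂ : ∀ i → map σ-factor (Y₂ (suc i)) ≡ Y₂ i
σY₂ i = cong (_∷ []) (factor≡ (+ 1) (- + 1) (down (+ 1) (+ 0) i))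

σZ₂ : ∀ i → map σ-factor (Z₂ i) ≡ Z₂ i
σZ₂ i = cong₂ _∷_ (factor≡ (+ 1) (+ 0) (ℤₚ.+-identityʳ (+ 1 * + i + + 1)))
  (cong (_∷ []) (factor≡ (- + 1) (+ 0) (ℤₚ.+-identityʳ (+ 3 * + i + + 3))))

flip : ∀ c a b → c * c ≡ + 1 → ∀ f → bin c (- a) (- b) f ≋ mono c (- a) (- b) (bin c a b f)
flip c a b c² f m n = sym (begin
  c * (f m′ n′ + c * f (m - - a - a) (n - - b - b)) ≡⟨ cong (λ x → c * (f m′ n′ + c * x)) (cong₂ f (l m a) (l n b)) ⟩
  c * (f m′ n′ + c * f m n) ≡⟨ l₂ c (f m′ n′) (f m n) ⟩
  (c * c) * f m n + c * f m′ n′ ≡⟨ cong (λ x → x * f m n + c * f m′ n′) c² ⟩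
  + 1 * f m n + c * f m′ n′ ≡⟨ cong (_+ c * f m′ n′) (ℤₚ.*-identityˡ (f m n)) ⟩
  f m n + c * f m′ n′ ∎)
  where
  open ≡-Reasoning
  m′ = m - - a
  n′ = n - - b
  l : ∀ m a → m - - a - a ≡ m
  l = solve-∀
  l₂ : ∀ c x y → c * (x + c * y) ≡ (c * c) * y + c * x
  l₂ = solve-∀

-- Three flips, contributing -z^-1, -z^-3 q^-1 and -z^-3 q^-2. Against the multiplier -z⁶q³ of `g`
-- their product leaves exactly z^-1.
Y₀₁ : ∀ f → op (Y₁ 0) f ≋ mono (- + 1) (- + 7) (- + 3) (op (X₁ 0) f)
Y₀₁ f = begin
  b₃⁻ (b₂⁻ (b₁⁻ f)) ≈⟨ bin-cong (- + 1) (- + 3) (- + 2) (bin-cong (- + 1) (- + 3) (- + 1) (flip (- + 1) (+ 1) (+ 0) refl f)) ⟩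
  b₃⁻ (b₂⁻ (μ₁ (b₁ f))) ≈⟨ bin-cong (- + 1) (- + 3) (- + 2) (mono-bin (- + 1) (- + 1) (+ 0) (- + 1) (- + 3) (- + 1) (b₁ f)) ⟨
  b₃⁻ (μ₁ (b₂⁻ (b₁ f))) ≈⟨ mono-bin (- + 1) (- + 1) (+ 0) (- + 1) (- + 3) (- + 2) (b₂⁻ (b₁ f)) ⟨
  μ₁ (b₃⁻ (b₂⁻ (b₁ f))) ≈⟨ mono-cong (- + 1) (- + 1) (+ 0) (bin-cong (- + 1) (- + 3) (- + 2) (flip (- + 1) (+ 3) (+ 1) refl (b₁ f))) ⟩
  μ₁ (b₃⁻ (μ₂ (b₂ (b₁ f)))) ≈⟨ mono-cong (- + 1) (- + 1) (+ 0) (mono-bin (- + 1) (- + 3) (- + 1) (- + 1) (- + 3) (- + 2) (b₂ (b₁ f))) ⟨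
  μ₁ (μ₂ (b₃⁻ (b₂ (b₁ f)))) ≈⟨ mono-cong (- + 1) (- + 1) (+ 0) (mono-cong (- + 1) (- + 3) (- + 1) (flip (- + 1) (+ 3) (+ 2) refl (b₂ (b₁ f)))) ⟩
  μ₁ (μ₂ (μ₃ (b₃ (b₂ (b₁ f))))) ≈⟨ (λ m n → collect m n (b₃ (b₂ (b₁ f)))) ⟩
  mono (- + 1) (- + 7) (- + 3) (b₃ (b₂ (b₁ f))) ∎
  where
  open ≋-Reasoning
  b₁ = bin (- + 1) (+ 1) (+ 0)
  b₂ = bin (- + 1) (+ 3) (+ 1)
  b₃ = bin (- + 1) (+ 3) (+ 2)
  b₁⁻ = bin (- + 1) (- + 1) (+ 0)
  b₂⁻ = bin (- + 1) (- + 3) (- + 1)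
  b₃⁻ = bin (- + 1) (- + 3) (- + 2)
  μ₁ = mono (- + 1) (- + 1) (+ 0)
  μ₂ = mono (- + 1) (- + 3) (- + 1)
  μ₃ = mono (- + 1) (- + 3) (- + 2)
  i₁ : ∀ m → m - - + 1 - - + 3 - - + 3 ≡ m - - + 7
  i₁ = solve-∀
  i₂ : ∀ n → n - + 0 - - + 1 - - + 2 ≡ n - - + 3
  i₂ = solve-∀
  l : ∀ x → - + 1 * (- + 1 * (- + 1 * x)) ≡ - + 1 * x
  l = solve-∀
  collect : ∀ m n h → μ₁ (μ₂ (μ₃ h)) m n ≡ mono (- + 1) (- + 7) (- + 3) h m n
  collect m n h = trans (l (h (m - - + 1 - - + 3 - - + 3) (n - + 0 - - + 1 - - + 2))) (cong (- + 1 *_) (cong₂ h (i₁ m) (i₂ n)))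

module Θ₁ = Theta X₁ Y₁ Z₁ σX₁ σY₁ (λ _ → refl) (- + 1) (- + 7) (- + 3) Y₀₁
module Θ₂ = Theta X₂ Y₂ Z₂ σX₂ σY₂ σZ₂ (+ 1) (- + 1) (+ 0) (flip (+ 1) (+ 1) (+ 0) refl)

S₁ S₂ : ℕ → List Factor
S₁ = Θ₁.S
S₂ = Θ₂.S

0≤lin : ∀ k l i → + 0 ≤ + k * + i + + l
0≤lin k l i = 0≤+0≤ (0≤* k (0≤+ i)) (0≤+ l)

-- The degree exceeds i by k i + l; nonnegative k and l are given explicitly and the identity is
-- left to the ring solver.
at : ∀ α β a r s k l i → (∀ x → α * a + β * (r * x + s) - x ≡ + k * x + + l) → + i ≤ α * a + β * (r * + i + s)
at α β a r s k l i h = ≤-by (0≤lin k l i) (h (+ i))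

at-suc : ∀ α β a r s k l i → (∀ x → α * a + β * (r * (+ 1 + x) + s) - x ≡ + k * x + + l) →
         + i ≤ α * a + β * (r * + suc i + s)
at-suc α β a r s k l i h = ≤-by (0≤lin k l i) (h (+ i))

X₁-level : Level (+ 0) (+ 1) X₁
X₁-level i = at (+ 0) (+ 1) (+ 3) (+ 3) (+ 2) 2 2 i solve-∀ ∷ at (+ 0) (+ 1) (+ 3) (+ 3) (+ 1) 2 1 i solve-∀
  ∷ at (+ 0) (+ 1) (+ 1) (+ 1) (+ 0) 0 0 i solve-∀ ∷ []

Y₁-level : Level (- + 1) (+ 1) Y₁
Y₁-level i = at (- + 1) (+ 1) (- + 3) (+ 3) (- + 2) 2 1 i solve-∀ ∷ at (- + 1) (+ 1) (- + 3) (+ 3) (- + 1) 2 2 i solve-∀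
  ∷ at (- + 1) (+ 1) (- + 1) (+ 1) (+ 0) 0 1 i solve-∀ ∷ []

X₂-level : Level (+ 0) (+ 1) X₂
X₂-level i = at (+ 0) (+ 1) (+ 1) (+ 1) (+ 0) 0 0 i solve-∀ ∷ []

Y₂-level : Level (- + 1) (+ 1) Y₂
Y₂-level i = at (- + 1) (+ 1) (- + 1) (+ 1) (+ 0) 0 1 i solve-∀ ∷ []

S₁-level : Level (+ 0) (+ 1) S₁
S₁-level i = at (+ 0) (+ 1) (+ 3) (+ 3) (+ 2) 2 2 i solve-∀ ∷ at (+ 0) (+ 1) (+ 3) (+ 3) (+ 1) 2 1 i solve-∀
  ∷ at (+ 0) (+ 1) (+ 1) (+ 1) (+ 0) 0 0 i solve-∀
  ∷ at-suc (+ 0) (+ 1) (- + 3) (+ 3) (- + 2) 2 1 i solve-∀ ∷ at-suc (+ 0) (+ 1) (- + 3) (+ 3) (- + 1) 2 2 i solve-∀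
  ∷ at-suc (+ 0) (+ 1) (- + 1) (+ 1) (+ 0) 0 1 i solve-∀ ∷ []

-- The factor q/z³ has degree 0 in this grading and so just meets the bound at i = 0; it is the
-- factor that cancels the pole.
S₁-level-line : Level (+ 1) (+ 3) S₁
S₁-level-line i = at (+ 1) (+ 3) (+ 3) (+ 3) (+ 2) 8 9 i solve-∀ ∷ at (+ 1) (+ 3) (+ 3) (+ 3) (+ 1) 8 6 i solve-∀
  ∷ at (+ 1) (+ 3) (+ 1) (+ 1) (+ 0) 2 1 i solve-∀
  ∷ at-suc (+ 1) (+ 3) (- + 3) (+ 3) (- + 2) 8 0 i solve-∀ ∷ at-suc (+ 1) (+ 3) (- + 3) (+ 3) (- + 1) 8 3 i solve-∀
  ∷ at-suc (+ 1) (+ 3) (- + 1) (+ 1) (+ 0) 2 2 i solve-∀ ∷ []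

S₂-level : Level (+ 0) (+ 1) S₂
S₂-level i = at (+ 0) (+ 1) (+ 1) (+ 1) (+ 0) 0 0 i solve-∀ ∷ at-suc (+ 0) (+ 1) (- + 1) (+ 1) (+ 0) 0 1 i solve-∀
  ∷ at (+ 0) (+ 1) (+ 0) (+ 1) (+ 1) 0 1 i solve-∀ ∷ at (+ 0) (+ 1) (+ 0) (+ 3) (+ 3) 2 3 i solve-∀ ∷ []

S₂-level-line : Level (+ 1) (+ 3) S₂
S₂-level-line i = at (+ 1) (+ 3) (+ 1) (+ 1) (+ 0) 2 1 i solve-∀ ∷ at-suc (+ 1) (+ 3) (- + 1) (+ 1) (+ 0) 2 2 i solve-∀
  ∷ at (+ 1) (+ 3) (+ 0) (+ 1) (+ 1) 2 3 i solve-∀ ∷ at (+ 1) (+ 3) (+ 0) (+ 3) (+ 3) 8 9 i solve-∀ ∷ []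

Ξ₁-kill : bin (- + 1) (+ 3) (+ 2) Ξ₁ ≋ 0F
Ξ₁-kill m n = trans (cong (λ x → Ξ₁ m n + - + 1 * ξ x) (l m n)) (l₂ (Ξ₁ m n))
  where
  l : ∀ m n → + 3 * (n - + 2) + + 1 - + 2 * (m - + 3) ≡ + 3 * n + + 1 - + 2 * m
  l = solve-∀
  l₂ : ∀ x → x + - + 1 * x ≡ + 0
  l₂ = solve-∀

Ξ₂-kill : bin (- + 1) (+ 3) (+ 1) Ξ₂ ≋ 0F
Ξ₂-kill m n = trans (cong (λ x → Ξ₂ m n + - + 1 * - ξ x) (l m n)) (l₂ (Ξ₂ m n))
  where
  l : ∀ m n → + 3 * (n - + 1) - + 2 - (m - + 3) ≡ + 3 * n - + 2 - m
  l = solve-∀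
  l₂ : ∀ x → x + - + 1 * x ≡ + 0
  l₂ = solve-∀

Ξ₃-kill : bin (- + 1) (+ 1) (+ 0) Ξ₃ ≋ 0F
Ξ₃-kill m n = trans (cong (λ x → Ξ₃ m n + - + 1 * ξ x) (l n)) (l₂ (Ξ₃ m n))
  where
  l : ∀ n → + 3 * (n - + 0) - + 7 ≡ + 3 * n - + 7
  l = solve-∀
  l₂ : ∀ x → x + - + 1 * x ≡ + 0
  l₂ = solve-∀

op-kill : ∀ c a b xs f → bin c a b f ≋ 0F → bin c a b (op xs f) ≋ 0F
op-kill c a b xs f z = ≋.trans (bin-op c a b xs f) (≋.trans (op-cong xs z) (op-0F xs))

Ξ-kill : op (X₁ 0) Ξ ≋ 0F
Ξ-kill m n = trans (op-⊞ (X₁ 0) (Ξ₁ ⊞ Ξ₂) Ξ₃ m n) (cong₂ _+_ (trans (op-⊞ (X₁ 0) Ξ₁ Ξ₂ m n) (cong₂ _+_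
  (op-kill (- + 1) (+ 3) (+ 2) ((- + 1 , + 3 , + 1) ∷ (- + 1 , + 1 , + 0) ∷ []) Ξ₁ Ξ₁-kill m n)
  (≋.trans (bin-cong (- + 1) (+ 3) (+ 2) (op-kill (- + 1) (+ 3) (+ 1) ((- + 1 , + 1 , + 0) ∷ []) Ξ₂ Ξ₂-kill))
    (op-0F ((- + 1 , + 3 , + 2) ∷ [])) m n)))
  (≋.trans (bin-cong (- + 1) (+ 3) (+ 2) (bin-cong (- + 1) (+ 3) (+ 1) Ξ₃-kill))
    (op-0F ((- + 1 , + 3 , + 2) ∷ (- + 1 , + 3 , + 1) ∷ [])) m n))

shift₁ : ∀ N m n → op (Y₁ (suc N)) (σ (P S₁ (suc N) g)) m n ≡ op (X₁ (suc N)) (P S₁ (suc N) g) (m + + 1) n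
shift₁ = Θ₁.shift-P {g} {Ξ} (- + 1) (+ 6) (+ 3) g-shift Ξ-kill refl refl refl

-- The constant 2 of the product formula, dictated by the residue 2 tot of `g`.
δ₂ : F
δ₂ m n = + 2 * δ m n

σ-δ₂ : σ δ₂ ≋ mono (+ 1) (+ 0) (+ 0) δ₂ ⊞ 0F
σ-δ₂ m n = trans (cong (+ 2 *_) (σ-δ m n)) (trans (cong₂ δ₂ (sym (ℤₚ.+-identityʳ m)) (sym (ℤₚ.+-identityʳ n)))
  (trans (sym (ℤₚ.*-identityˡ (δ₂ (m - + 0) (n - + 0)))) (sym (ℤₚ.+-identityʳ (+ 1 * δ₂ (m - + 0) (n - + 0))))))

shift₂ : ∀ N m n → op (Y₂ (suc N)) (σ (P S₂ (suc N) δ₂)) m n ≡ op (X₂ (suc N)) (P S₂ (suc N) δ₂) (m + + 1) n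
shift₂ = Θ₂.shift-P {δ₂} {0F} (+ 1) (+ 0) (+ 0) σ-δ₂ (op-0F (X₂ 0)) refl refl refl

drop-factor : ∀ {S S° c a b} xs ys → S 0 ≡ xs ++ (c , a , b) ∷ ys → S° 0 ≡ xs ++ ys → (∀ i → S° (suc i) ≡ S (suc i)) →
  ∀ N f → bin c a b (P S° (suc N) f) ≋ P S (suc N) f
drop-factor {S} {S°} {c} {a} {b} xs ys e e° es zero f = begin
  bin c a b (op (S° 0) f) ≡⟨ cong (λ zs → bin c a b (op zs f)) e° ⟩
  bin c a b (op (xs ++ ys) f) ≈⟨ bin-cong c a b (op-++ xs ys f) ⟩
  bin c a b (op xs (op ys f)) ≈⟨ bin-op c a b xs (op ys f) ⟩
  op xs (op ((c , a , b) ∷ ys) f) ≈⟨ op-++ xs ((c , a , b) ∷ ys) f ⟨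
  op (xs ++ (c , a , b) ∷ ys) f ≡⟨ cong (λ zs → op zs f) e ⟨
  op (S 0) f ∎
  where open ≋-Reasoning
drop-factor {S} {S°} {c} {a} {b} xs ys e e° es (suc N) f = begin
  bin c a b (op (S° (suc N)) (P S° (suc N) f)) ≡⟨ cong (λ zs → bin c a b (op zs (P S° (suc N) f))) (es N) ⟩
  bin c a b (op (S (suc N)) (P S° (suc N) f)) ≈⟨ bin-op c a b (S (suc N)) (P S° (suc N) f) ⟩
  op (S (suc N)) (bin c a b (P S° (suc N) f)) ≈⟨ op-cong (S (suc N)) (drop-factor {S} {S°} xs ys e e° es N f) ⟩
  op (S (suc N)) (P S (suc N) f) ∎
  where open ≋-Reasoning

T₁ : List Factor
T₁ = (- + 1 , - + 3 , + 3 * + 1 + - + 1) ∷ (- + 1 , - + 1 , + 1 * + 1 + + 0) ∷ []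

-- S₁ without the factor 1 - q/z³, which cancels the pole z³ = q of g
S₁° : ℕ → List Factor
S₁° zero    = X₁ 0 ++ T₁
S₁° (suc i) = S₁ (suc i)

S₁°-level : Level (+ 0) (+ 1) S₁°
S₁°-level zero    with S₁-level 0
... | p₁ ∷ p₂ ∷ p₃ ∷ p₄ ∷ ps = p₁ ∷ p₂ ∷ p₃ ∷ ps
S₁°-level (suc i) = S₁-level (suc i)

S₁°-drop : ∀ N f → bin (- + 1) (- + 3) (+ 1) (P S₁° (suc N) f) ≋ P S₁ (suc N) f
S₁°-drop = drop-factor {S₁} {S₁°} (X₁ 0) T₁ refl refl (λ _ → refl)

θ : ℤ → ℤ
θ (+ n)    = + 1
θ -[1+ n ] = + 0

-- the expansion of 2 / (1 - q/z³)
δ₂° : F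
δ₂° m n = + 2 * (ε (m + + 3 * n) * θ n)

θ-step : ∀ n → θ n - θ (n - + 1) ≡ ε n
θ-step (+ zero)  = refl
θ-step (+ suc n) = refl
θ-step -[1+ n ]  = refl

δ₂°-pole : bin (- + 1) (- + 3) (+ 1) δ₂° ≋ δ₂
δ₂°-pole m n = trans (cong (λ x → δ₂° m n + - + 1 * (+ 2 * (ε x * θ (n - + 1)))) (l₁ m n))
  (trans (l₂ (ε (m + + 3 * n)) (θ n) (θ (n - + 1))) (cong (+ 2 *_) (trans (cong (ε (m + + 3 * n) *_) (θ-step n)) (at-0 n))))
  where
  l₁ : ∀ m n → m - - + 3 + + 3 * (n - + 1) ≡ m + + 3 * n
  l₁ = solve-∀
  l₂ : ∀ e x y → + 2 * (e * x) + - + 1 * (+ 2 * (e * y)) ≡ + 2 * (e * (x - y))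
  l₂ = solve-∀
  at-0 : ∀ n → ε (m + + 3 * n) * ε n ≡ δ m n
  at-0 (+ zero)  = cong (λ x → ε x * + 1) (ℤₚ.+-identityʳ m)
  at-0 (+ suc n) = trans (ℤₚ.*-zeroʳ (ε (m + + 3 * + suc n))) (sym (ℤₚ.*-zeroʳ (ε m)))
  at-0 -[1+ n ]  = trans (ℤₚ.*-zeroʳ (ε (m + + 3 * -[1+ n ]))) (sym (ℤₚ.*-zeroʳ (ε m)))

Tends-δ₂° : Tends δ₂° (+ 2 · one)
Tends-δ₂° k = 0 , λ { (+ n) _ → trans (cong (λ x → + 2 * (ε x * + 1)) (l k (+ n))) (value k) }
  where
  l : ∀ k n → k - + 3 * n + + 3 * n ≡ k
  l = solve-∀
  value : ∀ k → + 2 * (ε k * + 1) ≡ ↑ (+ 2 · one) k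
  value (+ zero)  = refl
  value (+ suc n) = refl
  value -[1+ n ]  = refl

δ₂°-supp : Supp (+ 0) (+ 1) δ₂°
δ₂°-supp m n q with n | subst (_< + 0) (form01 m n) q
... | -[1+ n′ ] | _ = cong (+ 2 *_) (ℤₚ.*-zeroʳ (ε (m + + 3 * -[1+ n′ ])))
... | + n′      | +<+ ()

δ₂-supp : ∀ α β → Supp α β δ₂
δ₂-supp α β m n q = cong (+ 2 *_) (δ-supp α β m n q)

-- Exponents of q^(1/3) in the factors of `S₁°` at z = q^(1/3). The factor with q^(3i+1)/z³ gives 9i
-- = 9 + 9j; at i = 0 it would be zero and is the one removed.
line₁ : ℕ → List (ℤ × ℕ)
line₁ zero    = (- + 1 , 9) ∷ (- + 1 , 6) ∷ (- + 1 , 1) ∷ (- + 1 , 3) ∷ (- + 1 , 2) ∷ []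
line₁ (suc j) = let i = suc j in (- + 1 , 9 ℕ.+ 9 ℕ.* i) ∷ (- + 1 , 6 ℕ.+ 9 ℕ.* i) ∷ (- + 1 , 1 ℕ.+ 3 ℕ.* i) ∷
  (- + 1 , 9 ℕ.+ 9 ℕ.* j) ∷ (- + 1 , 3 ℕ.+ 9 ℕ.* i) ∷ (- + 1 , 2 ℕ.+ 3 ℕ.* i) ∷ []

line₂ : ℕ → List (ℤ × ℕ)
line₂ i = (+ 1 , 1 ℕ.+ 3 ℕ.* i) ∷ (+ 1 , 2 ℕ.+ 3 ℕ.* i) ∷ (+ 1 , 3 ℕ.+ 3 ℕ.* i) ∷ (- + 1 , 9 ℕ.+ 9 ℕ.* i) ∷ []

at-line : ∀ a r s A M i → (∀ x → a + + 3 * (r * x + s) ≡ + A + + M * x) → a + + 3 * (r * + i + s) ≡ + (A ℕ.+ M ℕ.* i)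
at-line a r s A M i h = trans (h (+ i)) (cong (_+_ (+ A)) (sym (ℤₚ.pos-* M i)))

at-line-suc : ∀ a r s A M i → (∀ x → a + + 3 * (r * (+ 1 + x) + s) ≡ + A + + M * x) → a + + 3 * (r * + suc i + s) ≡ + (A ℕ.+ M ℕ.* i)
at-line-suc a r s A M i h = trans (h (+ i)) (cong (_+_ (+ A)) (sym (ℤₚ.pos-* M i)))

S₁°-line : ∀ i → AtLine (S₁° i) (line₁ i)
S₁°-line zero    = refl ∷ refl ∷ refl ∷ refl ∷ refl ∷ []
S₁°-line (suc j) = at-line (+ 3) (+ 3) (+ 2) 9 9 (suc j) solve-∀ ∷ at-line (+ 3) (+ 3) (+ 1) 6 9 (suc j) solve-∀
  ∷ at-line (+ 1) (+ 1) (+ 0) 1 3 (suc j) solve-∀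
  ∷ trans (cong (λ x → - + 3 + + 3 * (+ 3 * x + - + 2)) (ℤₚ.pos-+ 1 (suc j))) (trans (l (+ j)) (cong (_+_ (+ 9)) (sym (ℤₚ.pos-* 9 j))))
  ∷ at-line-suc (- + 3) (+ 3) (- + 1) 3 9 (suc j) solve-∀ ∷ at-line-suc (- + 1) (+ 1) (+ 0) 2 3 (suc j) solve-∀ ∷ []
  where
  l : ∀ x → - + 3 + + 3 * (+ 3 * (+ 1 + (+ 1 + x)) + - + 2) ≡ + 9 + + 9 * x
  l = solve-∀

S₂-line : ∀ i → AtLine (S₂ i) (line₂ i)
S₂-line i = at-line (+ 1) (+ 1) (+ 0) 1 3 i solve-∀ ∷ at-line-suc (- + 1) (+ 1) (+ 0) 2 3 i solve-∀
  ∷ at-line (+ 0) (+ 1) (+ 1) 3 3 i solve-∀ ∷ at-line (+ 0) (+ 3) (+ 3) 9 9 i solve-∀ ∷ []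

data Above (i : ℕ) : List (ℤ × ℕ) → Set where
  []  : Above i []
  _∷_ : ∀ {c e xs} → i ℕ.< e → Above i xs → Above i ((c , e) ∷ xs)

Unit-line : ∀ {W : ℕ → List (ℤ × ℕ)} → (∀ i → Above i (W i)) → Unit (λ i → lineSeries (W i))
Unit-line ab i n le = go (ab i)
  where
  go : ∀ {xs} → Above i xs → lineSeries xs n ≡ one n
  go []       = refl
  go (_∷_ {c} {e} {xs} p ps) = trans (∙-one≤ (lineSeries xs) n (λ k k≤n →
    onePlus-low c e k (ℕₚ.≤-<-trans (ℕₚ.≤-trans k≤n le) p))) (go ps)

line₁-above : ∀ i → Above i (line₁ i)
line₁-above zero    = ℕ.s≤s ℕ.z≤n ∷ ℕ.s≤s ℕ.z≤n ∷ ℕ.s≤s ℕ.z≤n ∷ ℕ.s≤s ℕ.z≤n ∷ ℕ.s≤s ℕ.z≤n ∷ []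
line₁-above (suc j) = prog< 8 8 (suc j) ∷ prog< 5 8 (suc j) ∷ prog< 0 2 (suc j)
  ∷ ℕ.s≤s (ℕₚ.≤-trans (ℕ.s≤s (ℕₚ.m≤n*m j 9)) (ℕₚ.m≤n+m (1 ℕ.+ 9 ℕ.* j) 7)) ∷ prog< 2 8 (suc j) ∷ prog< 1 2 (suc j) ∷ []

line₂-above : ∀ i → Above i (line₂ i)
line₂-above i = prog< 0 2 i ∷ prog< 1 2 i ∷ prog< 2 2 i ∷ prog< 8 8 i ∷ []

term : ℤ → ℕ → ℕ → ℕ → PS
term c a m i = onePlus c (a ℕ.+ m ℕ.* i)

line₁-series : ∀ i → lineSeries (line₁ i) ≈
  ((term (- + 1) 2 3 i ∙ (term (- + 1) 3 9 i ∙ (term (- + 1) 1 3 i ∙ (term (- + 1) 6 9 i ∙ term (- + 1) 9 9 i)))) ∙ delay (term (- + 1) 9 9) i)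
line₁-series zero    = rearrange (term (- + 1) 2 3 0) (term (- + 1) 3 9 0) (term (- + 1) 1 3 0) (term (- + 1) 6 9 0) (term (- + 1) 9 9 0)
  where
  rearrange : ∀ a b c e f → one ∙ a ∙ b ∙ c ∙ e ∙ f ≈ (a ∙ (b ∙ (c ∙ (e ∙ f)))) ∙ one
  rearrange = CM.solve 5 (λ a b c e f → ((((CM.id CM.⊕ a) CM.⊕ b) CM.⊕ c) CM.⊕ e) CM.⊕ f
    CM.⊜ (a CM.⊕ (b CM.⊕ (c CM.⊕ (e CM.⊕ f)))) CM.⊕ CM.id) (λ _ → refl)
line₁-series (suc j) = rearrange (term (- + 1) 2 3 i) (term (- + 1) 3 9 i) (term (- + 1) 9 9 j) (term (- + 1) 1 3 i)
    (term (- + 1) 6 9 i) (term (- + 1) 9 9 i)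
  where
  i = suc j
  rearrange : ∀ a b d c e f → one ∙ a ∙ b ∙ d ∙ c ∙ e ∙ f ≈ (a ∙ (b ∙ (c ∙ (e ∙ f)))) ∙ d
  rearrange = CM.solve 6 (λ a b d c e f → (((((CM.id CM.⊕ a) CM.⊕ b) CM.⊕ d) CM.⊕ c) CM.⊕ e) CM.⊕ f
    CM.⊜ (a CM.⊕ (b CM.⊕ (c CM.⊕ (e CM.⊕ f)))) CM.⊕ d) (λ _ → refl)

∏line₁ : ∏ (λ i → lineSeries (line₁ i)) ≈
  (E⁻ 2 3 ∙ (E⁻ 3 9 ∙ (E⁻ 1 3 ∙ (E⁻ 6 9 ∙ E⁻ 9 9)))) ∙ E⁻ 9 9
∏line₁ = begin
  ∏ (λ i → lineSeries (line₁ i)) ≈⟨ ∏-cong line₁-series ⟩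
  ∏ (λ i → (t 2 3 i ∙ (t 3 9 i ∙ (t 1 3 i ∙ (t 6 9 i ∙ t 9 9 i)))) ∙ delay (t 9 9) i)
    ≈⟨ ∏-∙ u₀ unit-delay ⟩
  ∏ (λ i → t 2 3 i ∙ (t 3 9 i ∙ (t 1 3 i ∙ (t 6 9 i ∙ t 9 9 i)))) ∙ ∏ (delay (t 9 9))
    ≈⟨ PS.*-cong (PS.trans (∏-∙ (Unit-E (- + 1) 1 2) u₁) (PS.*-congˡ (PS.trans (∏-∙ (Unit-E (- + 1) 2 8) u₂)
         (PS.*-congˡ (PS.trans (∏-∙ (Unit-E (- + 1) 0 2) u₃) (PS.*-congˡ (∏-∙ (Unit-E (- + 1) 5 8) (Unit-E (- + 1) 8 8)))))))) 
       (∏-delay (Unit-E (- + 1) 8 8)) ⟩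
  (E⁻ 2 3 ∙ (E⁻ 3 9 ∙ (E⁻ 1 3 ∙ (E⁻ 6 9 ∙ E⁻ 9 9)))) ∙ E⁻ 9 9 ∎
  where
  open PS-Reasoning
  t = term (- + 1)
  u₃ = Unit-∙ (Unit-E (- + 1) 5 8) (Unit-E (- + 1) 8 8)
  u₂ = Unit-∙ (Unit-E (- + 1) 0 2) u₃
  u₁ = Unit-∙ (Unit-E (- + 1) 2 8) u₂
  u₀ = Unit-∙ (Unit-E (- + 1) 1 2) u₁
  unit-delay : Unit (delay (t 9 9))
  unit-delay zero    n _  = refl
  unit-delay (suc j) n le = onePlus-low (- + 1) (9 ℕ.+ 9 ℕ.* j) n
    (ℕₚ.≤-<-trans le (ℕ.s≤s (ℕₚ.≤-trans (ℕ.s≤s (ℕₚ.m≤n*m j 9)) (ℕₚ.m≤n+m (1 ℕ.+ 9 ℕ.* j) 7))))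

∏line₂ : ∏ (λ i → lineSeries (line₂ i)) ≈ E⁺ 1 1 ∙ E⁻ 9 9
∏line₂ = begin
  ∏ (λ i → lineSeries (line₂ i))
    ≈⟨ ∏-cong (λ i → rearrange (term (- + 1) 9 9 i) (t 3 3 i) (t 2 3 i) (t 1 3 i)) ⟩
  ∏ (λ i → (t 1 3 i ∙ (t 2 3 i ∙ t 3 3 i)) ∙ term (- + 1) 9 9 i)
    ≈⟨ ∏-∙ (Unit-∙ (Unit-E (+ 1) 0 2) (Unit-∙ (Unit-E (+ 1) 1 2) (Unit-E (+ 1) 2 2))) (Unit-E (- + 1) 8 8) ⟩
  ∏ (λ i → t 1 3 i ∙ (t 2 3 i ∙ t 3 3 i)) ∙ E⁻ 9 9
    ≈⟨ PS.*-congʳ (PS.trans (∏-∙ (Unit-E (+ 1) 0 2) (Unit-∙ (Unit-E (+ 1) 1 2) (Unit-E (+ 1) 2 2)))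
         (PS.*-congˡ (∏-∙ (Unit-E (+ 1) 1 2) (Unit-E (+ 1) 2 2)))) ⟩
  (E⁺ 1 3 ∙ (E⁺ 2 3 ∙ E⁺ 3 3)) ∙ E⁻ 9 9
    ≈⟨ PS.*-congʳ (E-split3 (+ 1) 0 0) ⟨
  E⁺ 1 1 ∙ E⁻ 9 9 ∎
  where
  open PS-Reasoning
  t = term (+ 1)
  rearrange : ∀ d c b a → one ∙ d ∙ c ∙ b ∙ a ≈ (a ∙ (b ∙ c)) ∙ d
  rearrange = CM.solve 4 (λ d c b a → (((CM.id CM.⊕ d) CM.⊕ c) CM.⊕ b) CM.⊕ a CM.⊜ (a CM.⊕ (b CM.⊕ c)) CM.⊕ d) (λ _ → refl)

-- Both sides of the product formula have the same residue at z³ = q.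
residues : (+ 2 · tot) ∙ ∏ (λ i → lineSeries (line₁ i)) ≈ (+ 2 · one) ∙ ∏ (λ i → lineSeries (line₂ i))
residues = begin
  (+ 2 · tot) ∙ ∏ (λ i → lineSeries (line₁ i)) ≈⟨ ·-∙ (+ 2) tot (∏ (λ i → lineSeries (line₁ i))) ⟩
  + 2 · (tot ∙ ∏ (λ i → lineSeries (line₁ i))) ≈⟨ (λ n → cong (+ 2 *_) (core n)) ⟩
  + 2 · (one ∙ ∏ (λ i → lineSeries (line₂ i))) ≈⟨ ·-∙ (+ 2) one (∏ (λ i → lineSeries (line₂ i))) ⟨
  (+ 2 · one) ∙ ∏ (λ i → lineSeries (line₂ i)) ∎
  where
  open PS-Reasoning
  a = E⁻ 1 3
  b = E⁻ 2 3
  d = E⁻ 3 9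
  e = E⁻ 6 9
  f = E⁻ 9 9
  rearrange : ∀ t a b d e f → t ∙ ((b ∙ (d ∙ (a ∙ (e ∙ f)))) ∙ f) ≈ (t ∙ (a ∙ (b ∙ (d ∙ (e ∙ f))))) ∙ f
  rearrange = CM.solve 6 (λ t a b d e f → t CM.⊕ ((b CM.⊕ (d CM.⊕ (a CM.⊕ (e CM.⊕ f)))) CM.⊕ f)
    CM.⊜ (t CM.⊕ (a CM.⊕ (b CM.⊕ (d CM.⊕ (e CM.⊕ f))))) CM.⊕ f) (λ _ → refl)
  core : tot ∙ ∏ (λ i → lineSeries (line₁ i)) ≈ one ∙ ∏ (λ i → lineSeries (line₂ i))
  core = begin
    tot ∙ ∏ (λ i → lineSeries (line₁ i)) ≈⟨ PS.*-congˡ ∏line₁ ⟩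
    tot ∙ ((b ∙ (d ∙ (a ∙ (e ∙ f)))) ∙ f) ≈⟨ rearrange tot a b d e f ⟩
    (tot ∙ (a ∙ (b ∙ (d ∙ (e ∙ f))))) ∙ f ≈⟨ PS.*-congʳ (PS.*-congˡ (PS.*-congˡ (PS.*-congˡ (E-split3 (- + 1) 2 2)))) ⟨
    (tot ∙ (a ∙ (b ∙ E⁻ 3 3))) ∙ f ≈⟨ PS.*-congʳ (PS.*-congˡ (E-split3 (- + 1) 0 0)) ⟨
    (tot ∙ E⁻ 1 1) ∙ f ≈⟨ PS.*-congʳ tot-product ⟩
    E⁺ 1 1 ∙ f ≈⟨ ∏line₂ ⟨
    ∏ (λ i → lineSeries (line₂ i)) ≈⟨ PS.*-identityˡ (∏ (λ i → lineSeries (line₂ i))) ⟨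
    one ∙ ∏ (λ i → lineSeries (line₂ i)) ∎

line-sum₁ : LineSum (lim S₁ g) (λ k → ((+ 2 · tot) ∙ prod (λ i → lineSeries (line₁ i)) (suc k)) k)
line-sum₁ k = line-sum {S₁} {g} {P S₁° (suc k) g} k S₁-level S₁-level-line g-supp-n g-supp-line
  (P-supp {+ 0} {+ 1} {S₁°} {g} (suc k) S₁°-level g-supp-n) (S₁°-drop k g) (Tends-P {S₁°} {g} (suc k) S₁°-line Tends-g)

-- This side has no pole to cancel, so one is created: δ₂ is written as (1 - q/z³) times `δ₂°`, and
-- the residue is that of the product applied to `δ₂°`.
line-sum₂ : LineSum (lim S₂ δ₂) (λ k → ((+ 2 · one) ∙ prod (λ i → lineSeries (line₂ i)) (suc k)) k)
line-sum₂ k = line-sum {S₂} {δ₂} {P S₂ (suc k) δ₂°} k S₂-level S₂-level-line (δ₂-supp (+ 0) (+ 1)) (δ₂-supp (+ 1) (+ 3))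
  (P-supp {+ 0} {+ 1} {S₂} {δ₂°} (suc k) S₂-level δ₂°-supp)
  (≋.trans (≋.sym (P-op S₂ (suc k) ((- + 1 , - + 3 , + 1) ∷ []) δ₂°)) (P-cong S₂ (suc k) δ₂°-pole))
  (Tends-P {S₂} {δ₂°} (suc k) S₂-line Tends-δ₂°)

truncate : ∀ {W : ℕ → List (ℤ × ℕ)} f k → (∀ i → Above i (W i)) →
  (f ∙ prod (λ i → lineSeries (W i)) (suc k)) k ≡ (f ∙ ∏ (λ i → lineSeries (W i))) k
truncate f k ab = ∙-cong≤ k (λ _ _ → refl) (λ i le → prod-∏ (suc k) i (Unit-line ab) (ℕₚ.m≤n⇒m≤1+n le))

lim-supp : ∀ {α β S f} → Level α β S → Supp α β f → Supp α β (lim S f)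
lim-supp {α} {β} {S} {f} lev s m n q = P-supp {α} {β} {S} {f} (suc ∣ n ∣) lev s m n q

-- Both sides solve B(zq) = B(z)/z, and their line sums are residues, which agree by `residues`.
-- Truncating the residue products after k + 1 factors does not affect the coefficient k.
product-formula : lim S₁ g ≋ lim S₂ δ₂
product-formula = shift-unique {lim S₁ g} {lim S₂ δ₂}
  (lim-shift {S₁} {g} X₁ Y₁ S₁-level g-supp-n X₁-level Y₁-level shift₁)
  (lim-shift {S₂} {δ₂} X₂ Y₂ S₂-level (δ₂-supp (+ 0) (+ 1)) X₂-level Y₂-level shift₂)
  (lim-supp {+ 0} {+ 1} {S₁} {g} S₁-level g-supp-n) (lim-supp {+ 0} {+ 1} {S₂} {δ₂} S₂-level (δ₂-supp (+ 0) (+ 1)))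
  line-sum₁ line-sum₂
  (λ k → trans (truncate {line₁} (+ 2 · tot) k line₁-above) (trans (residues k)
    (sym (truncate {line₂} (+ 2 · one) k line₂-above))))

-- From g to the rank generating function.

op-↭ : ∀ {xs ys} → xs ↭ ys → ∀ f → op xs f ≋ op ys f
op-↭ Perm.refl f = ≋.refl
op-↭ (Perm.prep (c , a , b) r) f = bin-cong c a b (op-↭ r f)
op-↭ (Perm.swap {xs} (c , a , b) (c′ , a′ , b′) r) f =
  ≋.trans (bin-comm c a b c′ a′ b′ (op xs f)) (bin-cong c′ a′ b′ (bin-cong c a b (op-↭ r f)))
op-↭ (Perm.trans r r′) f = ≋.trans (op-↭ r f) (op-↭ r′ f)

-- One family of factors is moved up by one index; by telescoping, the products differ only by its
-- members at 0 and at N.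
reindex : ∀ {S D} c a (e : ℕ → ℤ) (R : ℕ → List Factor) →
  (∀ i → S i ↭ (c , a , e i) ∷ R i) → (∀ i → D i ≡ (c , a , e (suc i)) ∷ R i) →
  ∀ N f → bin c a (e N) (P S N f) ≋ bin c a (e 0) (P D N f)
reindex c a e R hS hD zero f = ≋.refl
reindex {S} {D} c a e R hS hD (suc N) f = begin
  bin c a e′ (op (S N) (P S N f)) ≈⟨ bin-cong c a e′ (op-↭ (hS N) (P S N f)) ⟩
  bin c a e′ (bin c a (e N) (op (R N) (P S N f))) ≈⟨ bin-cong c a e′ (bin-op c a (e N) (R N) (P S N f)) ⟩
  bin c a e′ (op (R N) (bin c a (e N) (P S N f))) ≈⟨ bin-cong c a e′ (op-cong (R N) (reindex {S} {D} c a e R hS hD N f)) ⟩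
  bin c a e′ (op (R N) (bin c a (e 0) (P D N f))) ≈⟨ bin-op c a (e 0) ((c , a , e′) ∷ R N) (P D N f) ⟨
  bin c a (e 0) (bin c a e′ (op (R N) (P D N f))) ≡⟨ cong (λ zs → bin c a (e 0) (op zs (P D N f))) (hD N) ⟨
  bin c a (e 0) (op (D N) (P D N f)) ∎
  where
  open ≋-Reasoning
  e′ = e (suc N)

-- Ordered so that factors with z^a and z^-a and the same power of q are adjacent, as `Λ-pair`
-- requires.
R₁ R₂ D₁ D₂ : ℕ → List Factor
R₁ i = (- + 1 , - + 1 , + 1 * + suc i + + 0) ∷ (- + 1 , + 3 , + 3 * + i + + 2) ∷ (- + 1 , - + 3 , + 3 * + i + + 2) ∷
  (- + 1 , + 3 , + 3 * + i + + 1) ∷ (- + 1 , - + 3 , + 3 * + i + + 1) ∷ []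
R₂ i = (+ 1 , - + 1 , + 1 * + suc i + + 0) ∷ Z₂ i
D₁ i = (- + 1 , + 1 , + 1 * + suc i + + 0) ∷ R₁ i
D₂ i = (+ 1 , + 1 , + 1 * + suc i + + 0) ∷ R₂ i

S₁-↭ : ∀ i → S₁ i ↭ (- + 1 , + 1 , + 1 * + i + + 0) ∷ R₁ i
S₁-↭ i = subst₂ (λ x y → S₁ i ↭ z ∷ z⁻ ∷ a₂ ∷ (- + 1 , - + 3 , x) ∷ a₁ ∷ (- + 1 , - + 3 , y) ∷ []) (l₂ (+ i)) (l₁ (+ i))
  (↭-trans (shift z (a₂ ∷ a₁ ∷ []) (b₁ ∷ b₂ ∷ z⁻ ∷ []))
  (Perm.prep z (↭-trans (shift z⁻ (a₂ ∷ a₁ ∷ b₁ ∷ b₂ ∷ []) [])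
  (Perm.prep z⁻ (Perm.prep a₂ (shift b₂ (a₁ ∷ b₁ ∷ []) []))))))
  where
  z z⁻ a₂ a₁ b₁ b₂ : Factor
  z = - + 1 , + 1 , + 1 * + i + + 0
  z⁻ = - + 1 , - + 1 , + 1 * + suc i + + 0
  a₂ = - + 1 , + 3 , + 3 * + i + + 2
  a₁ = - + 1 , + 3 , + 3 * + i + + 1
  b₁ = - + 1 , - + 3 , + 3 * + suc i + - + 2
  b₂ = - + 1 , - + 3 , + 3 * + suc i + - + 1
  l₁ : ∀ i → + 3 * (+ 1 + i) + - + 2 ≡ + 3 * i + + 1
  l₁ = solve-∀
  l₂ : ∀ i → + 3 * (+ 1 + i) + - + 1 ≡ + 3 * i + + 2
  l₂ = solve-∀

-- The exponents ≡ 1 of the rank generating function (1 - z) U.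
R : F
R = bin (- + 1) (+ 1) (+ 0) (third u)

R-supp-n : Supp (+ 0) (+ 1) R
R-supp-n = bin-supp {+ 0} {+ 1} {third u} (- + 1) (+ 1) (+ 0) u₁-supp-n (0≤+ _)

R-supp-line : Supp (+ 1) (+ 3) R
R-supp-line = bin-supp {+ 1} {+ 3} {third u} (- + 1) (+ 1) (+ 0) u₁-supp-line (0≤+ _)

-- The factor 1 - z of the theta product on the left turns `g` into (1 + z) R; the 1 + z is then
-- cancelled against the one in (-z; q) on the right.
g-R : bin (- + 1) (+ 1) (+ 0) g ≋ bin (+ 1) (+ 1) (+ 0) R
g-R = ≋.trans (bin-cong (- + 1) (+ 1) (+ 0) (≋.sym g≋)) (bin-comm (- + 1) (+ 1) (+ 0) (+ 1) (+ 1) (+ 0) (third u))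

D₁-level-line : Level (+ 1) (+ 3) D₁
D₁-level-line i = at-suc (+ 1) (+ 3) (+ 1) (+ 1) (+ 0) 2 4 i solve-∀ ∷ at-suc (+ 1) (+ 3) (- + 1) (+ 1) (+ 0) 2 2 i solve-∀
  ∷ at (+ 1) (+ 3) (+ 3) (+ 3) (+ 2) 8 9 i solve-∀ ∷ at (+ 1) (+ 3) (- + 3) (+ 3) (+ 2) 8 3 i solve-∀
  ∷ at (+ 1) (+ 3) (+ 3) (+ 3) (+ 1) 8 6 i solve-∀ ∷ at (+ 1) (+ 3) (- + 3) (+ 3) (+ 1) 8 0 i solve-∀ ∷ []

D₁-level-line⁻ : Level (- + 1) (+ 3) D₁
D₁-level-line⁻ i = at-suc (- + 1) (+ 3) (+ 1) (+ 1) (+ 0) 2 2 i solve-∀ ∷ at-suc (- + 1) (+ 3) (- + 1) (+ 1) (+ 0) 2 4 i solve-∀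
  ∷ at (- + 1) (+ 3) (+ 3) (+ 3) (+ 2) 8 3 i solve-∀ ∷ at (- + 1) (+ 3) (- + 3) (+ 3) (+ 2) 8 9 i solve-∀
  ∷ at (- + 1) (+ 3) (+ 3) (+ 3) (+ 1) 8 0 i solve-∀ ∷ at (- + 1) (+ 3) (- + 3) (+ 3) (+ 1) 8 6 i solve-∀ ∷ []

D₂-level-line : Level (+ 1) (+ 3) D₂
D₂-level-line i = at-suc (+ 1) (+ 3) (+ 1) (+ 1) (+ 0) 2 4 i solve-∀ ∷ at-suc (+ 1) (+ 3) (- + 1) (+ 1) (+ 0) 2 2 i solve-∀
  ∷ at (+ 1) (+ 3) (+ 0) (+ 1) (+ 1) 2 3 i solve-∀ ∷ at (+ 1) (+ 3) (+ 0) (+ 3) (+ 3) 8 9 i solve-∀ ∷ []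

D₂-level-line⁻ : Level (- + 1) (+ 3) D₂
D₂-level-line⁻ i = at-suc (- + 1) (+ 3) (+ 1) (+ 1) (+ 0) 2 2 i solve-∀ ∷ at-suc (- + 1) (+ 3) (- + 1) (+ 1) (+ 0) 2 4 i solve-∀
  ∷ at (- + 1) (+ 3) (+ 0) (+ 1) (+ 1) 2 3 i solve-∀ ∷ at (- + 1) (+ 3) (+ 0) (+ 3) (+ 3) 8 9 i solve-∀ ∷ []

lim-reindex : ∀ {S D f f′ c c′} (e : ℕ → ℤ) → Level (+ 0) (+ 1) S → Supp (+ 0) (+ 1) f → (∀ i → + i ≤ e i) → e 0 ≡ + 0 →
  (∀ N → bin c (+ 1) (e N) (P S N f) ≋ bin c (+ 1) (e 0) (P D N f)) →
  bin c (+ 1) (+ 0) f ≋ bin c′ (+ 1) (+ 0) f′ → lim S f ≋ bin c′ (+ 1) (+ 0) (lim D f′)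
lim-reindex {S} {D} {f} {f′} {c} {c′} e lev s he e₀ re eq m n = begin
  P S N f m n ≡⟨ bin-stab {+ 0} {+ 1} {+ N} {P S N f} c (+ 1) (e N) (P-supp {+ 0} {+ 1} N lev s)
                                                   (subst (+ N ≤_) (sym (form01 (+ 1) (e N))) (he N))
                                                   (subst (_< + N) (sym (form01 m n)) (i<1+∣i∣ n)) ⟨
  bin c (+ 1) (e N) (P S N f) m n ≡⟨ re N m n ⟩
  bin c (+ 1) (e 0) (P D N f) m n ≡⟨ cong (λ x → bin c (+ 1) x (P D N f) m n) e₀ ⟩
  bin c (+ 1) (+ 0) (P D N f) m n ≡⟨ P-op D N ((c , + 1 , + 0) ∷ []) f m n ⟨
  P D N (bin c (+ 1) (+ 0) f) m n ≡⟨ P-cong D N eq m n ⟩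
  P D N (bin c′ (+ 1) (+ 0) f′) m n ≡⟨ P-op D N ((c′ , + 1 , + 0) ∷ []) f′ m n ⟩
  P D N f′ m n + c′ * P D N f′ (m - + 1) (n - + 0)
    ≡⟨ cong (λ x → P D N f′ m n + c′ * P D (suc ∣ x ∣) f′ (m - + 1) (n - + 0)) (sym (ℤₚ.+-identityʳ n)) ⟩
  bin c′ (+ 1) (+ 0) (lim D f′) m n ∎
  where
  open ≡-Reasoning
  N = suc ∣ n ∣

e₁ : ℕ → ℤ
e₁ i = + 1 * + i + + 0

i≤e₁ : ∀ i → + i ≤ e₁ i
i≤e₁ i = subst (+ i ≤_) (form01 (+ 1) (e₁ i)) (at (+ 0) (+ 1) (+ 1) (+ 1) (+ 0) 0 0 i solve-∀)

-- (zq, q/z; q)(z³q, z³q², q/z³, q²/z³; q³) R = 2 (-q; q)(q³; q³)(-zq, -q/z; q)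
rank-product : lim D₁ R ≋ lim D₂ δ₂
rank-product = bin-injective {+ 1} {+ 3} (+ 1) (+ 1) (+ 0)
  (lim-supp {+ 1} {+ 3} {D₁} {R} D₁-level-line R-supp-line) (lim-supp {+ 1} {+ 3} {D₂} {δ₂} D₂-level-line (δ₂-supp (+ 1) (+ 3)))
  (+≤+ ℕₚ.≤-refl)
  (≋.trans (≋.sym (lim-reindex {S₁} {D₁} {g} {R} {c = - + 1} {+ 1} e₁ S₁-level g-supp-n i≤e₁ refl
      (λ N → reindex {S₁} {D₁} (- + 1) (+ 1) e₁ R₁ S₁-↭ (λ _ → refl) N g) g-R))
  (≋.trans product-formula
    (lim-reindex {S₂} {D₂} {δ₂} {δ₂} {c = + 1} {+ 1} e₁ S₂-level (δ₂-supp (+ 0) (+ 1)) i≤e₁ refl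
      (λ N → reindex {S₂} {D₂} (+ 1) (+ 1) e₁ R₂ (λ _ → ↭-refl) (λ _ → refl) N δ₂) ≋.refl)))

-- Rank counts and the cone |m| ≤ 3n.

rankCount : ℕ → ℤ → ℕ → ℤ
rankCount K m n = weigh (λ π → ε (rank π - m)) (ovpBounded K n)

rankCount-suc : ∀ K m n → rankCount (suc K) m n ≡ rankCount K m n + ∑ (added K (+ suc K - m) (+ n)) n
rankCount-suc K m n = weigh-ovpBounded-suc K n (+ suc K - m) (λ π → ε (rank π - m)) λ i b π →
  trans (cong (λ x → ε (+ suc K - x - m)) (length-block-++ (suc i) (suc K) b π))
    (trans (cong ε (l (+ suc K) (+ suc i) (+ length π) m)) (ε-neg (+ length π - (+ suc K - m - + suc i))))
  where
  l : ∀ K i x m → K - (i + x) - m ≡ + 0 - (x - (K - m - i))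
  l = solve-∀

-- Truncated form of (1 - z) U = 1 + Σ_(k≥1) z^k (P k - P (k-1)), whose summand at k collects the
-- overpartitions with largest part exactly k.
rankCount-uₖ : ∀ K m n → rankCount K m n ≡ uₖ (suc K) m (+ n) - uₖ K (m - + 1) (+ n)
rankCount-uₖ zero m n = trans (base n) (trans (sym (p₀-flip m (+ n))) (l (p 0 (+ 0 - m) (+ n))))
  where
  base : ∀ n → rankCount 0 m n ≡ δ m (+ n)
  base zero    = trans (ℤₚ.+-identityʳ (ε (+ 0 - m))) (trans (ε-neg m) (sym (ℤₚ.*-identityʳ (ε m))))
  base (suc n) = sym (ℤₚ.*-zeroʳ (ε m))
  l : ∀ x → x ≡ + 0 + x - + 0
  l = solve-∀
rankCount-uₖ (suc K) m n = begin
  rankCount (suc K) m n ≡⟨ rankCount-suc K m n ⟩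
  rankCount K m n + Q K j (+ n) ≡⟨ cong (_+ Q K j (+ n)) (rankCount-uₖ K m n) ⟩
  U - U′ + Q K j (+ n) ≡⟨ l U U′ (p K j (+ n)) (Q K j (+ n)) ⟩
  U + (p K j (+ n) + Q K j (+ n)) - (U′ + p K j (+ n)) ≡⟨ cong₂ (λ x y → U + x - (U′ + p K y (+ n))) (sym (p-suc K j (+ n))) (i₁ (+ K) m) ⟩
  uₖ (suc (suc K)) m (+ n) - uₖ (suc K) (m - + 1) (+ n) ∎
  where
  open ≡-Reasoning
  j = + suc K - m
  U = uₖ (suc K) m (+ n)
  U′ = uₖ K (m - + 1) (+ n)
  i₁ : ∀ K m → + 1 + K - m ≡ K - (m - + 1)
  i₁ = solve-∀
  l : ∀ U U′ x y → U - U′ + y ≡ U + (x + y) - (U′ + x)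
  l = solve-∀

rankCount-stable : ∀ d m n → rankCount (d ℕ.+ n) m n ≡ rankCount n m n
rankCount-stable zero    m n = refl
rankCount-stable (suc d) m n = trans (rankCount-suc (d ℕ.+ n) m n) (trans (cong₂ _+_ (rankCount-stable d m n)
  (∑-zero n (λ i _ → added-vanish (d ℕ.+ n) (+ suc (d ℕ.+ n) - m) (+ n) i (+<+ (ℕₚ.≤-trans (ℕ.s≤s (ℕₚ.m≤n+m n d)) (ℕₚ.m≤n*m (suc (d ℕ.+ n)) (suc i)))))))
  (ℤₚ.+-identityʳ (rankCount n m n)))

u-rankCount : ∀ m n → u m (+ n) - u (m - + 1) (+ n) ≡ rankCount n m n
u-rankCount m n = begin
  u m (+ n) - u (m - + 1) (+ n)
    ≡⟨ cong₂ _-_ (uₖ-u (suc K) m (+ n) (ℕₚ.m≤n⇒m≤1+n (ℕₚ.≤-trans (ℕₚ.m≤m+n b b′) (ℕₚ.m≤m+n (b ℕ.+ b′) n))))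
                 (uₖ-u K (m - + 1) (+ n) (ℕₚ.≤-trans (ℕₚ.m≤n+m b′ b) (ℕₚ.m≤m+n (b ℕ.+ b′) n))) ⟨
  uₖ (suc K) m (+ n) - uₖ K (m - + 1) (+ n) ≡⟨ rankCount-uₖ K m n ⟨
  rankCount K m n ≡⟨ rankCount-stable (b ℕ.+ b′) m n ⟩
  rankCount n m n ∎
  where
  open ≡-Reasoning
  b = suc (∣ m ∣ ℕ.+ n)
  b′ = suc (∣ m - + 1 ∣ ℕ.+ n)
  K = b ℕ.+ b′ ℕ.+ n

3n+1 : ∀ n → + 3 * + n + + 1 ≡ + (3 ℕ.* n ℕ.+ 1)
3n+1 n = cong (_+ + 1) (sym (ℤₚ.pos-* 3 n))

R-rankCount : ∀ m n → R m (+ n) ≡ rankCount (3 ℕ.* n ℕ.+ 1) m (3 ℕ.* n ℕ.+ 1)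
R-rankCount m n = trans (cong₂ (λ x y → u m x + - + 1 * u (m - + 1) y) (3n+1 n)
    (trans (cong (λ x → + 3 * x + + 1) (ℤₚ.+-identityʳ (+ n))) (3n+1 n)))
  (trans (l (u m (+ N)) (u (m - + 1) (+ N))) (u-rankCount m N))
  where
  N = 3 ℕ.* n ℕ.+ 1
  l : ∀ x y → x + - + 1 * y ≡ x - y
  l = solve-∀

-- A nonempty overpartition of n + 1 has largest part at most n + 1 and at least one part, so its
-- rank is at most n.
rankCount-large : ∀ K m n → + suc n ≤ m → rankCount K m (suc n) ≡ + 0
rankCount-large zero    m n q = refl
rankCount-large (suc K) m n q = trans (rankCount-suc K m (suc n)) (cong₂ _+_ (rankCount-large K m n q)
  (∑-zero (suc n) λ i _ → vanish i))
  where
  l : ∀ K m i n → + 0 - (+ 1 * (K - m - (+ 1 + i)) + + 0 * n) ≡ + 1 + (m - K + i)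
  l = solve-∀
  vanish : ∀ i → added K (+ suc K - m) (+ suc n) i ≡ + 0
  vanish i with suc K ℕ.≤? suc n
  ... | yes K≤n = cong (+ 2 *_) (p-supp-parts K (+ suc K - m - + suc i) (+ suc n - + (suc i ℕ.* suc K))
          (<-by (0<+0≤ {+ 1} 0<+ (0≤+0≤ (≤⇒0≤ (ℤₚ.≤-trans (+≤+ K≤n) q)) (0≤+ i)))
            (l (+ suc K) m (+ i) (+ suc n - + (suc i ℕ.* suc K)))))
  ... | no K≰n = added-vanish K (+ suc K - m) (+ suc n) i (+<+ (ℕₚ.≤-trans (ℕₚ.≰⇒> K≰n) (ℕₚ.m≤n*m (suc K) (suc i))))

R-supp-line⁻ : Supp (- + 1) (+ 3) R
R-supp-line⁻ m -[1+ n ] q = R-supp-n m -[1+ n ] (subst (_< + 0) (sym (form01 m -[1+ n ])) -<+)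
R-supp-line⁻ m (+ n)    q = trans (R-rankCount m n) (trans (cong₂ (λ x y → rankCount x m y) (ℕₚ.+-comm (3 ℕ.* n) 1) (ℕₚ.+-comm (3 ℕ.* n) 1))
  (rankCount-large (suc (3 ℕ.* n)) m (3 ℕ.* n) (≤-by (≤⇒0≤ (ℤₚ.i<j⇒suc[i]≤j q))
    (trans (cong (λ x → m - (+ 1 + x)) (ℤₚ.pos-* 3 n)) (l m (+ n))))))
  where
  l : ∀ m n → m - (+ 1 + + 3 * n) ≡ + 0 - (+ 1 + (- + 1 * m + + 3 * n))
  l = solve-∀

-- Evaluation by linear functionals.

window : (ℤ → ℤ) → ℕ → ℤ
window h w = ∑ (λ i → h (+ i - + w)) (suc (w ℕ.+ w))

-- `s` and `t` are the margins left and right of the translated support inside the window of radius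
-- w′.
window-translate : ∀ {h} w w′ a s t → (∀ x → x < - + w → h x ≡ + 0) → (∀ x → + w < x → h x ≡ + 0) →
  + w′ + a ≡ + w + + s → + w′ ≡ + w + a + + t → window (λ m → h (m - a)) w′ ≡ window h w
window-translate {h} w w′ a s t hl hr es et = begin
  ∑ f (suc (w′ ℕ.+ w′)) ≡⟨ cong (∑ f) size ⟩
  ∑ f (s ℕ.+ (suc (w ℕ.+ w) ℕ.+ t)) ≡⟨ ∑-split f s (suc (w ℕ.+ w) ℕ.+ t) ⟩
  ∑ f s + ∑ (λ i → f (s ℕ.+ i)) (suc (w ℕ.+ w) ℕ.+ t)
    ≡⟨ cong₂ _+_ (∑-zero s left) (trans (∑-extend (ℕₚ.m≤m+n (suc (w ℕ.+ w)) t) right) (∑-cong (suc (w ℕ.+ w)) (λ i _ → cong h (mid i)))) ⟩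
  + 0 + window h w ≡⟨ ℤₚ.+-identityˡ (window h w) ⟩
  window h w ∎
  where
  open ≡-Reasoning
  f : ℕ → ℤ
  f i = h (+ i - + w′ - a)
  l₁ : ∀ w′ a w s t → w′ + a ≡ w + s → w′ ≡ w + a + t → + 1 + (w′ + w′) ≡ s + (+ 1 + (w + w) + t)
  l₁ w′ a w s t e e′ = trans (l w′ a) (trans (cong₂ (λ x y → + 1 + (x + (y - a))) e e′) (l₃ a w s t))
    where
    l : ∀ w′ a → + 1 + (w′ + w′) ≡ + 1 + ((w′ + a) + (w′ - a))
    l = solve-∀
    l₃ : ∀ a w s t → + 1 + ((w + s) + (w + a + t - a)) ≡ s + (+ 1 + (w + w) + t)
    l₃ = solve-∀
  size : suc (w′ ℕ.+ w′) ≡ s ℕ.+ (suc (w ℕ.+ w) ℕ.+ t)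
  size = ℤₚ.+-injective (l₁ (+ w′) a (+ w) (+ s) (+ t) es et)
  index : ∀ x → x - + w′ - a ≡ x - (+ w + + s)
  index x = trans (l x (+ w′) a) (cong (_-_ x) es)
    where
    l : ∀ x w′ a → x - w′ - a ≡ x - (w′ + a)
    l = solve-∀
  mid : ∀ i → + (s ℕ.+ i) - + w′ - a ≡ + i - + w
  mid i = trans (index (+ (s ℕ.+ i))) (l (+ s) (+ i) (+ w))
    where
    l : ∀ s i w → s + i - (w + s) ≡ i - w
    l = solve-∀
  left : ∀ i → i ℕ.< s → f i ≡ + 0
  left i i<s = trans (cong h (index (+ i))) (hl _ (<-by (<⇒0< (+<+ i<s)) (l (+ i) (+ w) (+ s))))
    where
    l : ∀ i w s → - w - (i - (w + s)) ≡ s - i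
    l = solve-∀
  right : ∀ i → suc (w ℕ.+ w) ℕ.≤ i → f (s ℕ.+ i) ≡ + 0
  right i q = trans (cong h (mid i)) (hr _ (<-by (<⇒0< (+<+ q)) (l (+ i) (+ w))))
    where
    l : ∀ i w → i - w - w ≡ i - (w + w)
    l = solve-∀

window-widen : ∀ {h} w d → (∀ x → x < - + w → h x ≡ + 0) → (∀ x → + w < x → h x ≡ + 0) → window h (d ℕ.+ w) ≡ window h w
window-widen {h} w d hl hr = trans (∑-cong (suc (d ℕ.+ w ℕ.+ (d ℕ.+ w))) (λ i _ → cong h (sym (ℤₚ.+-identityʳ (+ i - + (d ℕ.+ w))))))
  (window-translate {h} w (d ℕ.+ w) (+ 0) d d hl hr (l₁ (+ w) (+ d)) (l₂ (+ w) (+ d)))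
  where
  l₁ : ∀ w d → d + w + + 0 ≡ w + d
  l₁ = solve-∀
  l₂ : ∀ w d → d + w ≡ w + + 0 + d
  l₂ = solve-∀

-- Only |m| ≤ 3n occurs, so every row is finite and z can be specialised.
Cone : F → Set
Cone f = Supp (+ 1) (+ 3) f × Supp (- + 1) (+ 3) f

cone-n : ∀ {f} → Cone f → ∀ m n → n < + 0 → f m n ≡ + 0
cone-n {f} (sl , sr) m n q with m ℤₚ.<? + 0
... | yes m<0 = sl m n (<-by (0<+0≤ (<⇒0< m<0) (0≤* 3 (≤⇒0≤ (ℤₚ.<⇒≤ q)))) (l m n))
  where
  l : ∀ m n → + 0 - (+ 1 * m + + 3 * n) ≡ + 0 - m + + 3 * (+ 0 - n)
  l = solve-∀
... | no m≮0 = sr m n (<-by (0<+0≤ (<⇒0< q) (0≤+0≤ (0≤* 2 (≤⇒0≤ (ℤₚ.<⇒≤ q))) (ℤₚ.≮⇒≥ m≮0))) (l m n))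
  where
  l : ∀ m n → + 0 - (- + 1 * m + + 3 * n) ≡ + 0 - n + (+ 2 * (+ 0 - n) + m)
  l = solve-∀

opaque
  -- Σ_m κ m · f m n
  Λ : (ℤ → ℤ) → F → PS
  Λ κ f n = window (λ m → κ m * f m (+ n)) (3 ℕ.* n)

  Λ-def : ∀ κ f n → Λ κ f n ≡ window (λ m → κ m * f m (+ n)) (3 ℕ.* n)
  Λ-def κ f n = refl

  Λ-cong : ∀ {κ κ′} → (∀ x → κ x ≡ κ′ x) → ∀ f → Λ κ f ≈ Λ κ′ f
  Λ-cong e f n = ∑-cong (suc (3 ℕ.* n ℕ.+ 3 ℕ.* n)) (λ i _ → cong (_* f (+ i - + (3 ℕ.* n)) (+ n)) (e (+ i - + (3 ℕ.* n))))

cone-left : ∀ {f} → Cone f → ∀ (κ : ℤ → ℤ) d x → x < - + (3 ℕ.* d) → κ x * f x (+ d) ≡ + 0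
cone-left {f} (sl , _) κ d x q = trans (cong (κ x *_) (sl x (+ d) (<-by (<⇒0< q)
  (trans (l x (+ d)) (cong (λ y → - y - x) (sym (ℤₚ.pos-* 3 d))))))) (ℤₚ.*-zeroʳ (κ x))
  where
  l : ∀ x d → + 0 - (+ 1 * x + + 3 * d) ≡ - (+ 3 * d) - x
  l = solve-∀

cone-right : ∀ {f} → Cone f → ∀ (κ : ℤ → ℤ) d x → + (3 ℕ.* d) < x → κ x * f x (+ d) ≡ + 0
cone-right {f} (_ , sr) κ d x q = trans (cong (κ x *_) (sr x (+ d) (<-by (<⇒0< q)
  (trans (l x (+ d)) (cong (λ y → x - y) (sym (ℤₚ.pos-* 3 d))))))) (ℤₚ.*-zeroʳ (κ x))
  where
  l : ∀ x d → + 0 - (- + 1 * x + + 3 * d) ≡ x - + 3 * d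
  l = solve-∀

-- The two inequalities say |a| ≤ 3b, so z^a q^b maps the cone into itself. Translating the
-- summation moves the shift by a from `f` onto κ.
Λ-shift : ∀ {f} → Cone f → ∀ (κ : ℤ → ℤ) a b → + 0 ≤ + 3 * + b + a → + 0 ≤ + 3 * + b - a → ∀ n →
  window (λ m → κ m * f (m - a) (+ n - + b)) (3 ℕ.* n) ≡ ↑ (Λ (λ x → κ (x + a)) f) (+ n - + b)
Λ-shift {f} cf κ a b ha ha′ n = go (+ n - + b) (l (+ n) (+ b))
  where
  l : ∀ n b → n ≡ n - b + b
  l = solve-∀
  go : ∀ k → + n ≡ k + + b → window (λ m → κ m * f (m - a) k) (3 ℕ.* n) ≡ ↑ (Λ (λ x → κ (x + a)) f) k
  go -[1+ k ] _  = ∑-zero (suc (3 ℕ.* n ℕ.+ 3 ℕ.* n)) λ i _ →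
    trans (cong (κ (+ i - + (3 ℕ.* n)) *_) (cone-n {f} cf (+ i - + (3 ℕ.* n) - a) -[1+ k ] -<+)) (ℤₚ.*-zeroʳ (κ (+ i - + (3 ℕ.* n))))
  go (+ d)    eq = trans
    (∑-cong (suc (3 ℕ.* n ℕ.+ 3 ℕ.* n)) (λ i _ → cong (λ x → κ x * f (+ i - + (3 ℕ.* n) - a) (+ d)) (l₂ (+ i - + (3 ℕ.* n)) a)))
    (trans (window-translate {λ x → κ (x + a) * f x (+ d)} (3 ℕ.* d) (3 ℕ.* n) a ∣ + 3 * + b + a ∣ ∣ + 3 * + b - a ∣
      (cone-left {f} cf (λ x → κ (x + a)) d) (cone-right {f} cf (λ x → κ (x + a)) d)
      (trans (cong (_+ a) scale) (trans (l₃ (+ 3 * + d) (+ 3 * + b) a) (cong₂ _+_ (sym (ℤₚ.pos-* 3 d)) (sym (ℤₚ.0≤i⇒+∣i∣≡i ha)))))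
      (trans scale (trans (l₄ (+ 3 * + d) (+ 3 * + b) a) (cong₂ (λ x y → x + a + y) (sym (ℤₚ.pos-* 3 d)) (sym (ℤₚ.0≤i⇒+∣i∣≡i ha′))))))
      (sym (Λ-def (λ x → κ (x + a)) f d)))
    where
    l₂ : ∀ m a → m ≡ m - a + a
    l₂ = solve-∀
    l₃ : ∀ d b a → d + b + a ≡ d + (b + a)
    l₃ = solve-∀
    l₄ : ∀ d b a → d + b ≡ d + a + (b - a)
    l₄ = solve-∀
    scale : + (3 ℕ.* n) ≡ + 3 * + d + + 3 * + b
    scale = trans (ℤₚ.pos-* 3 n) (trans (cong (+ 3 *_) eq) (ℤₚ.*-distribˡ-+ (+ 3) (+ d) (+ b))) 

Λ-bin : ∀ {f} → Cone f → ∀ (κ : ℤ → ℤ) c a b → + 0 ≤ + 3 * + b + a → + 0 ≤ + 3 * + b - a → ∀ n →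
  Λ κ (bin c a (+ b) f) n ≡ Λ κ f n + c * ↑ (Λ (λ x → κ (x + a)) f) (+ n - + b)
Λ-bin {f} cf κ c a b ha ha′ n = begin
  Λ κ (bin c a (+ b) f) n ≡⟨ Λ-def κ (bin c a (+ b) f) n ⟩
  ∑ (λ i → κ (m i) * (f (m i) (+ n) + c * f (m i - a) (+ n - + b))) M
    ≡⟨ ∑-cong M (λ i _ → l c (κ (m i)) (f (m i) (+ n)) (f (m i - a) (+ n - + b))) ⟩
  ∑ (λ i → κ (m i) * f (m i) (+ n) + c * (κ (m i) * f (m i - a) (+ n - + b))) M
    ≡⟨ ∑-+ (λ i → κ (m i) * f (m i) (+ n)) (λ i → c * (κ (m i) * f (m i - a) (+ n - + b))) M ⟩
  ∑ (λ i → κ (m i) * f (m i) (+ n)) M + ∑ (λ i → c * (κ (m i) * f (m i - a) (+ n - + b))) M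
    ≡⟨ cong₂ _+_ (sym (Λ-def κ f n)) (trans (∑-* c (λ i → κ (m i) * f (m i - a) (+ n - + b)) M) (cong (c *_) (Λ-shift {f} cf κ a b ha ha′ n))) ⟩
  Λ κ f n + c * ↑ (Λ (λ x → κ (x + a)) f) (+ n - + b) ∎
  where
  open ≡-Reasoning
  M = suc (3 ℕ.* n ℕ.+ 3 ℕ.* n)
  m : ℕ → ℤ
  m i = + i - + (3 ℕ.* n)
  l : ∀ c k x y → k * (x + c * y) ≡ k * x + c * (k * y)
  l = solve-∀

-- The value of (1 + c z q^b)(1 + c q^b/z) for c² = 1, with s = c (z + 1/z).
quad : ℤ → ℕ → PS
quad s b = onePlus s b ⊕ X^ (b ℕ.+ b)

∙-X^ : ∀ f e n → (f ∙ X^ e) n ≡ ↑ f (+ n - + e)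
∙-X^ f e n = trans (∙-comm f (X^ e) n) (trans (cong (λ h → h n) (∙≡⊛ (X^ e) f)) (shiftPS e f n))

quad-∙ : ∀ s b f n → (f ∙ quad s b) n ≡ f n + s * ↑ f (+ n - + b) + ↑ f (+ n - + b - + b)
quad-∙ s b f n = trans (PS.distribˡ f (onePlus s b) (X^ (b ℕ.+ b)) n)
  (cong₂ _+_ (onePlus-∙ s b f (+ n)) (trans (∙-X^ f (b ℕ.+ b) n) (cong (↑ f) (l (+ n) (+ b)))))
  where
  l : ∀ n b → n - (b + b) ≡ n - b - b
  l = solve-∀

Unit-quad : ∀ s (e : ℕ → ℕ) → (∀ i → i ℕ.< e i) → Unit (λ i → quad s (e i))
Unit-quad s e lt i n le = trans (cong₂ _+_ (Unit-onePlus s e lt i n le)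
  (cong (λ b → if b then + 1 else + 0) (dec-false (n ℕₚ.≟ (e i ℕ.+ e i))
    (ℕₚ.<⇒≢ (ℕₚ.<-≤-trans (ℕₚ.≤-<-trans le (lt i)) (ℕₚ.m≤m+n (e i) (e i)))))))
  (ℤₚ.+-identityʳ (one n))

Λ-bin-↑ : ∀ {f} → Cone f → ∀ (κ : ℤ → ℤ) c a b → + 0 ≤ + 3 * + b + a → + 0 ≤ + 3 * + b - a → ∀ k →
  ↑ (Λ κ (bin c a (+ b) f)) k ≡ ↑ (Λ κ f) k + c * ↑ (Λ (λ x → κ (x + a)) f) (k - + b)
Λ-bin-↑ {f} cf κ c a b ha ha′ (+ n)    = Λ-bin {f} cf κ c a b ha ha′ n
Λ-bin-↑ {f} cf κ c a b ha ha′ -[1+ n ] with -[1+ n ] - + b | neg-sub n b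
... | _ | k , refl = sym (trans (ℤₚ.+-identityˡ (c * + 0)) (ℤₚ.*-zeroʳ c))

Λ-linear : ∀ {κ₁ κ₂ κ t} f → (∀ x → κ₁ x + κ₂ x ≡ t * κ x) → ∀ k → ↑ (Λ κ₁ f) k + ↑ (Λ κ₂ f) k ≡ t * ↑ (Λ κ f) k
Λ-linear {κ₁} {κ₂} {κ} {t} f h (+ n) = begin
  Λ κ₁ f n + Λ κ₂ f n ≡⟨ cong₂ _+_ (Λ-def κ₁ f n) (Λ-def κ₂ f n) ⟩
  ∑ (term₁ κ₁) M + ∑ (term₁ κ₂) M ≡⟨ ∑-+ (term₁ κ₁) (term₁ κ₂) M ⟨
  ∑ (λ i → term₁ κ₁ i + term₁ κ₂ i) M ≡⟨ ∑-cong M (λ i _ → step (m i) (f (m i) (+ n))) ⟩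
  ∑ (λ i → t * term₁ κ i) M ≡⟨ ∑-* t (term₁ κ) M ⟩
  t * ∑ (term₁ κ) M ≡⟨ cong (t *_) (Λ-def κ f n) ⟨
  t * Λ κ f n ∎
  where
  open ≡-Reasoning
  M = suc (3 ℕ.* n ℕ.+ 3 ℕ.* n)
  m : ℕ → ℤ
  m i = + i - + (3 ℕ.* n)
  term₁ : (ℤ → ℤ) → ℕ → ℤ
  term₁ κ i = κ (m i) * f (m i) (+ n)
  step : ∀ x y → κ₁ x * y + κ₂ x * y ≡ t * (κ x * y)
  step x y = trans (sym (ℤₚ.*-distribʳ-+ y (κ₁ x) (κ₂ x))) (trans (cong (_* y) (h x)) (ℤₚ.*-assoc t (κ x) y))
Λ-linear {t = t} f h -[1+ n ] = sym (ℤₚ.*-zeroʳ t)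

cone-op : ∀ {f} xs → All (AtLeast (+ 1) (+ 3) (+ 0)) xs → All (AtLeast (- + 1) (+ 3) (+ 0)) xs → Cone f → Cone (op xs f)
cone-op {f} xs p p′ (sl , sr) = op-supp {+ 1} {+ 3} {f} {xs} sl p , op-supp { - + 1} {+ 3} {f} {xs} sr p′

-- The cross terms shift κ by a and by -a, and the recurrence merges them into t κ: under Λ the
-- symmetric pair acts as if z^a + z^-a were the integer t.
Λ-pair : ∀ {f} → Cone f → ∀ (κ : ℤ → ℤ) c t a b → + 0 ≤ + 3 * + b + a → + 0 ≤ + 3 * + b - a → c * c ≡ + 1 →
  (∀ x → κ (x + a) + κ (x - a) ≡ t * κ x) →
  Λ κ (bin c a (+ b) (bin c (- a) (+ b) f)) ≈ Λ κ f ∙ quad (c * t) b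
Λ-pair {f} cf κ c t a b ha ha′ c² h n = begin
  Λ κ (bin c a (+ b) h′) n ≡⟨ Λ-bin {h′} ch κ c a b ha ha′ n ⟩
  Λ κ h′ n + c * ↑ (Λ κ₊ h′) k ≡⟨ cong₂ (λ x y → x + c * y) (Λ-bin {f} cf κ c (- a) b hn hn′ n) (Λ-bin-↑ {f} cf κ₊ c (- a) b hn hn′ k) ⟩
  Λ κ f n + c * ↑ (Λ κ₋ f) k + c * (↑ (Λ κ₊ f) k + c * ↑ (Λ (λ x → κ₊ (x - a)) f) (k - + b))
    ≡⟨ cong (λ y → Λ κ f n + c * ↑ (Λ κ₋ f) k + c * (↑ (Λ κ₊ f) k + c * y)) (back (k - + b)) ⟩
  Λ κ f n + c * ↑ (Λ κ₋ f) k + c * (↑ (Λ κ₊ f) k + c * ↑ (Λ κ f) (k - + b))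
    ≡⟨ l c (Λ κ f n) (↑ (Λ κ₋ f) k) (↑ (Λ κ₊ f) k) (↑ (Λ κ f) (k - + b)) ⟩
  Λ κ f n + c * (↑ (Λ κ₊ f) k + ↑ (Λ κ₋ f) k) + (c * c) * ↑ (Λ κ f) (k - + b)
    ≡⟨ cong₂ (λ x y → Λ κ f n + c * x + y * ↑ (Λ κ f) (k - + b)) (Λ-linear {κ₊} {κ₋} {κ} {t} f h k) c² ⟩
  Λ κ f n + c * (t * ↑ (Λ κ f) k) + + 1 * ↑ (Λ κ f) (k - + b)
    ≡⟨ cong₂ (λ x y → Λ κ f n + x + y) (sym (ℤₚ.*-assoc c t (↑ (Λ κ f) k))) (ℤₚ.*-identityˡ (↑ (Λ κ f) (k - + b))) ⟩
  Λ κ f n + c * t * ↑ (Λ κ f) k + ↑ (Λ κ f) (k - + b) ≡⟨ quad-∙ (c * t) b (Λ κ f) n ⟨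
  (Λ κ f ∙ quad (c * t) b) n ∎
  where
  open ≡-Reasoning
  h′ = bin c (- a) (+ b) f
  k = + n - + b
  κ₊ κ₋ : ℤ → ℤ
  κ₊ x = κ (x + a)
  κ₋ x = κ (x - a)
  l₁ : ∀ a b → + 3 * b - a ≡ + 1 * - a + + 3 * b
  l₁ = solve-∀
  l₂ : ∀ a b → + 3 * b + a ≡ - + 1 * - a + + 3 * b
  l₂ = solve-∀
  l₃ : ∀ a b → + 3 * b + a ≡ + 3 * b - - a
  l₃ = solve-∀
  hn : + 0 ≤ + 3 * + b + - a
  hn = ha′
  hn′ : + 0 ≤ + 3 * + b - - a
  hn′ = subst (+ 0 ≤_) (l₃ a (+ b)) ha
  ch : Cone h′
  ch = cone-op {f} ((c , - a , + b) ∷ []) (subst (+ 0 ≤_) (l₁ a (+ b)) ha′ ∷ []) (subst (+ 0 ≤_) (l₂ a (+ b)) ha ∷ []) cf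
  l₄ : ∀ x a → x - a + a ≡ x
  l₄ = solve-∀
  back : ∀ k → ↑ (Λ (λ x → κ₊ (x - a)) f) k ≡ ↑ (Λ κ f) k
  back = ↑-cong (Λ-cong (λ x → cong κ (l₄ x a)) f)
  l : ∀ c x y z w → x + c * y + c * (z + c * w) ≡ x + c * (z + y) + (c * c) * w
  l = solve-∀

Λ-scalar : ∀ {f} → Cone f → ∀ (κ : ℤ → ℤ) c b → Λ κ (bin c (+ 0) (+ b) f) ≈ Λ κ f ∙ onePlus c b
Λ-scalar {f} cf κ c b n = trans (Λ-bin {f} cf κ c (+ 0) b h h′ n)
  (trans (cong (λ x → Λ κ f n + c * x) (↑-cong (Λ-cong (λ x → cong κ (ℤₚ.+-identityʳ x)) f) (+ n - + b))) (sym (onePlus-∙ c b (Λ κ f) (+ n))))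
  where
  h : + 0 ≤ + 3 * + b + + 0
  h = 0≤lin 3 0 b
  h′ : + 0 ≤ + 3 * + b - + 0
  h′ = 0≤lin 3 0 b

Λ-δ₂ : ∀ κ → Λ κ δ₂ ≈ (κ (+ 0) * + 2) · one
Λ-δ₂ κ zero    = trans (Λ-def κ δ₂ 0) (l (κ (+ 0)))
  where
  l : ∀ x → + 0 + x * + 2 ≡ x * + 2 * + 1
  l = solve-∀
Λ-δ₂ κ (suc n) = trans (Λ-def κ δ₂ (suc n)) (trans
  (∑-zero (suc (3 ℕ.* suc n ℕ.+ 3 ℕ.* suc n)) (λ i _ → trans (cong (κ (m i) *_) (cong (+ 2 *_) (ℤₚ.*-zeroʳ (ε (m i))))) (ℤₚ.*-zeroʳ (κ (m i)))))
  (sym (ℤₚ.*-zeroʳ (κ (+ 0) * + 2))))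
  where
  m : ℕ → ℤ
  m i = + i - + (3 ℕ.* suc n)

exponent : ∀ r s i → + r * + i + + s ≡ + (s ℕ.+ r ℕ.* i)
exponent r s i = trans (cong (_+ + s) (sym (ℤₚ.pos-* r i))) (cong +_ (ℕₚ.+-comm (r ℕ.* i) s))

exponent-suc : ∀ i → + 1 * + suc i + + 0 ≡ + (1 ℕ.+ 1 ℕ.* i)
exponent-suc i = trans (l (+ i)) (exponent 1 1 i)
  where
  l : ∀ i → + 1 * (+ 1 + i) + + 0 ≡ + 1 * i + + 1
  l = solve-∀

Λ-pair′ : ∀ {f e} → Cone f → ∀ (κ : ℤ → ℤ) c t a b → e ≡ + b → + 0 ≤ + 3 * + b + a → + 0 ≤ + 3 * + b - a → c * c ≡ + 1 →
  (∀ x → κ (x + a) + κ (x - a) ≡ t * κ x) →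
  Λ κ (bin c a e (bin c (- a) e f)) ≈ Λ κ f ∙ quad (c * t) b
Λ-pair′ {f} cf κ c t a b refl = Λ-pair {f} cf κ c t a b

Λ-scalar′ : ∀ {f e} → Cone f → ∀ (κ : ℤ → ℤ) c b → e ≡ + b → Λ κ (bin c (+ 0) e f) ≈ Λ κ f ∙ onePlus c b
Λ-scalar′ {f} cf κ c b refl = Λ-scalar {f} cf κ c b

-- Evaluation at a root of unity z, through a functional κ with κ (m+1) + κ (m-1) = t κ m, t = z + 1/z.
module Evaluate (κ : ℤ → ℤ) (t t₃ : ℤ)
  (h₁ : ∀ x → κ (x + + 1) + κ (x - + 1) ≡ t * κ x) (h₃ : ∀ x → κ (x + + 3) + κ (x - + 3) ≡ t₃ * κ x) where

  num den : ℕ → PS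
  den i = (quad (- + 1 * t₃) (1 ℕ.+ 3 ℕ.* i) ∙ quad (- + 1 * t₃) (2 ℕ.+ 3 ℕ.* i)) ∙ quad (- + 1 * t) (1 ℕ.+ 1 ℕ.* i)
  num i = (onePlus (- + 1) (3 ℕ.+ 3 ℕ.* i) ∙ onePlus (+ 1) (1 ℕ.+ 1 ℕ.* i)) ∙ quad (+ 1 * t) (1 ℕ.+ 1 ℕ.* i)

  Unit-den : Unit den
  Unit-den = Unit-∙ (Unit-∙ (Unit-quad (- + 1 * t₃) (λ i → 1 ℕ.+ 3 ℕ.* i) (prog< 0 2)) (Unit-quad (- + 1 * t₃) (λ i → 2 ℕ.+ 3 ℕ.* i) (prog< 1 2)))
                    (Unit-quad (- + 1 * t) (λ i → 1 ℕ.+ 1 ℕ.* i) (prog< 0 0))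

  Unit-num : Unit num
  Unit-num = Unit-∙ (Unit-∙ (Unit-E (- + 1) 2 2) (Unit-E (+ 1) 0 0)) (Unit-quad (+ 1 * t) (λ i → 1 ℕ.+ 1 ℕ.* i) (prog< 0 0))

  low : ∀ a r s i → + 0 ≤ + 3 * + s + a → + 0 ≤ + 3 * + (s ℕ.+ r ℕ.* i) + a
  low a r s i h = ≤-by (0≤+0≤ h (0≤* 3 (0≤+ (r ℕ.* i)))) (l a (+ s) (+ (r ℕ.* i)))
    where
    l : ∀ a s x → + 3 * (s + x) + a - + 0 ≡ + 3 * s + a + + 3 * x
    l = solve-∀

  Λ-D₁ : ∀ i {f} → Cone f → Λ κ (op (D₁ i) f) ≈ Λ κ f ∙ den i
  Λ-D₁ i {f} cf with AtLeast-≤ {+ 1} {+ 3} (0≤+ _) (D₁-level-line i) | AtLeast-≤ { - + 1} {+ 3} (0≤+ _) (D₁-level-line⁻ i)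
  ... | _ ∷ _ ∷ p₂ | _ ∷ _ ∷ q₂ with p₂ | q₂
  ... | _ ∷ _ ∷ p₄ | _ ∷ _ ∷ q₄ = begin
    Λ κ (op (D₁ i) f) ≈⟨ Λ-pair′ {op R₂₁ f} (cone-op {f} R₂₁ p₂ q₂ cf) κ (- + 1) t (+ 1) (1 ℕ.+ 1 ℕ.* i) (exponent-suc i)
                                   (low (+ 1) 1 1 i (0≤+ _)) (low (- + 1) 1 1 i (0≤+ _)) refl h₁ ⟩
    Λ κ (op R₂₁ f) ∙ a₁ ≈⟨ PS.*-congʳ (Λ-pair′ {op R₁₁ f} (cone-op {f} R₁₁ p₄ q₄ cf) κ (- + 1) t₃ (+ 3) (2 ℕ.+ 3 ℕ.* i) (exponent 3 2 i)
                                   (low (+ 3) 3 2 i (0≤+ _)) (low (- + 3) 3 2 i (0≤+ _)) refl h₃) ⟩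
    (Λ κ (op R₁₁ f) ∙ a₂) ∙ a₁ ≈⟨ PS.*-congʳ (PS.*-congʳ (Λ-pair′ {f} cf κ (- + 1) t₃ (+ 3) (1 ℕ.+ 3 ℕ.* i) (exponent 3 1 i)
                                   (low (+ 3) 3 1 i (0≤+ _)) (low (- + 3) 3 1 i (0≤+ _)) refl h₃)) ⟩
    ((Λ κ f ∙ a₃) ∙ a₂) ∙ a₁ ≈⟨ PS.*-congʳ (PS.*-assoc (Λ κ f) a₃ a₂) ⟩
    (Λ κ f ∙ (a₃ ∙ a₂)) ∙ a₁ ≈⟨ PS.*-assoc (Λ κ f) (a₃ ∙ a₂) a₁ ⟩
    Λ κ f ∙ den i ∎
    where
    open PS-Reasoning
    R₁₁ R₂₁ : List Factor
    R₁₁ = (- + 1 , + 3 , + 3 * + i + + 1) ∷ (- + 1 , - + 3 , + 3 * + i + + 1) ∷ []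
    R₂₁ = (- + 1 , + 3 , + 3 * + i + + 2) ∷ (- + 1 , - + 3 , + 3 * + i + + 2) ∷ R₁₁
    a₁ = quad (- + 1 * t) (1 ℕ.+ 1 ℕ.* i)
    a₂ = quad (- + 1 * t₃) (2 ℕ.+ 3 ℕ.* i)
    a₃ = quad (- + 1 * t₃) (1 ℕ.+ 3 ℕ.* i)

  Λ-D₂ : ∀ i {f} → Cone f → Λ κ (op (D₂ i) f) ≈ Λ κ f ∙ num i
  Λ-D₂ i {f} cf with AtLeast-≤ {+ 1} {+ 3} (0≤+ _) (D₂-level-line i) | AtLeast-≤ { - + 1} {+ 3} (0≤+ _) (D₂-level-line⁻ i)
  ... | _ ∷ _ ∷ p₂ | _ ∷ _ ∷ q₂ with p₂ | q₂
  ... | _ ∷ p₃ | _ ∷ q₃ = begin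
    Λ κ (op (D₂ i) f) ≈⟨ Λ-pair′ {op (Z₂ i) f} (cone-op {f} (Z₂ i) p₂ q₂ cf) κ (+ 1) t (+ 1) (1 ℕ.+ 1 ℕ.* i) (exponent-suc i)
                                   (low (+ 1) 1 1 i (0≤+ _)) (low (- + 1) 1 1 i (0≤+ _)) refl h₁ ⟩
    Λ κ (op (Z₂ i) f) ∙ a₁ ≈⟨ PS.*-congʳ (Λ-scalar′ {op W f} (cone-op {f} W p₃ q₃ cf) κ (+ 1) (1 ℕ.+ 1 ℕ.* i) (exponent 1 1 i)) ⟩
    (Λ κ (op W f) ∙ a₂) ∙ a₁ ≈⟨ PS.*-congʳ (PS.*-congʳ (Λ-scalar′ {f} cf κ (- + 1) (3 ℕ.+ 3 ℕ.* i) (exponent 3 3 i))) ⟩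
    ((Λ κ f ∙ a₃) ∙ a₂) ∙ a₁ ≈⟨ PS.*-congʳ (PS.*-assoc (Λ κ f) a₃ a₂) ⟩
    (Λ κ f ∙ (a₃ ∙ a₂)) ∙ a₁ ≈⟨ PS.*-assoc (Λ κ f) (a₃ ∙ a₂) a₁ ⟩
    Λ κ f ∙ num i ∎
    where
    open PS-Reasoning
    W : List Factor
    W = (- + 1 , + 0 , + 3 * + i + + 3) ∷ []
    a₁ = quad (+ 1 * t) (1 ℕ.+ 1 ℕ.* i)
    a₂ = onePlus (+ 1) (1 ℕ.+ 1 ℕ.* i)
    a₃ = onePlus (- + 1) (3 ℕ.+ 3 ℕ.* i)

  cone-P : ∀ {S f} N → Level (+ 1) (+ 3) S → Level (- + 1) (+ 3) S → Cone f → Cone (P S N f)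
  cone-P {S} {f} N l l′ (sl , sr) = P-supp {+ 1} {+ 3} {S} {f} N l sl , P-supp { - + 1} {+ 3} {S} {f} N l′ sr

  Λ-P : ∀ {S w f} → Level (+ 1) (+ 3) S → Level (- + 1) (+ 3) S → (∀ i {f} → Cone f → Λ κ (op (S i) f) ≈ Λ κ f ∙ w i) →
    Cone f → ∀ N → Λ κ (P S N f) ≈ Λ κ f ∙ prod w N
  Λ-P {f = f} l l′ hw cf zero    = PS.sym (PS.*-identityʳ (Λ κ f))
  Λ-P {S} {w} {f} l l′ hw cf (suc N) = begin
    Λ κ (op (S N) (P S N f)) ≈⟨ hw N {P S N f} (cone-P {S} {f} N l l′ cf) ⟩
    Λ κ (P S N f) ∙ w N ≈⟨ PS.*-congʳ (Λ-P {S} {w} {f} l l′ hw cf N) ⟩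
    (Λ κ f ∙ prod w N) ∙ w N ≈⟨ PS.*-assoc (Λ κ f) (prod w N) (w N) ⟩
    Λ κ f ∙ prod w (suc N) ∎
    where open PS-Reasoning

  lim-Λ : ∀ {S w f} → Level (+ 1) (+ 3) S → Level (- + 1) (+ 3) S → (∀ i {f} → Cone f → Λ κ (op (S i) f) ≈ Λ κ f ∙ w i) →
    Unit w → Cone f → Λ κ (lim S f) ≈ Λ κ f ∙ ∏ w
  lim-Λ {S} {w} {f} l l′ hw un cf n = trans (Λ-def κ (lim S f) n) (trans (sym (Λ-def κ (P S (suc n) f) n))
    (trans (Λ-P {S} {w} {f} l l′ hw cf (suc n) n)
      (∙-cong≤ {Λ κ f} n (λ _ _ → refl) (λ i le → prod-∏ (suc n) i un (ℕₚ.m≤n⇒m≤1+n le)))))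

  evaluate : Λ κ R ∙ ∏ den ≈ ((κ (+ 0) * + 2) · one) ∙ ∏ num
  evaluate = begin
    Λ κ R ∙ ∏ den ≈⟨ lim-Λ {D₁} {den} {R} D₁-level-line D₁-level-line⁻ (λ i {f} → Λ-D₁ i {f}) Unit-den (R-supp-line , R-supp-line⁻) ⟨
    Λ κ (lim D₁ R) ≈⟨ (λ n → trans (Λ-def κ (lim D₁ R) n) (trans (∑-cong (suc (3 ℕ.* n ℕ.+ 3 ℕ.* n)) (λ i _ →
                                       cong (κ (+ i - + (3 ℕ.* n)) *_) (rank-product (+ i - + (3 ℕ.* n)) (+ n)))) (sym (Λ-def κ (lim D₂ δ₂) n)))) ⟩
    Λ κ (lim D₂ δ₂) ≈⟨ lim-Λ {D₂} {num} {δ₂} D₂-level-line D₂-level-line⁻ (λ i {f} → Λ-D₂ i {f}) Unit-num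
                                       (δ₂-supp (+ 1) (+ 3) , δ₂-supp (- + 1) (+ 3)) ⟩
    Λ κ δ₂ ∙ ∏ num ≈⟨ PS.*-congʳ (Λ-δ₂ κ) ⟩
    ((κ (+ 0) * + 2) · one) ∙ ∏ num ∎
    where open PS-Reasoning

-- Evaluations in terms of the counts modulo 6.

weigh-cong : ∀ {A : Set} {v w : A → ℤ} → (∀ x → v x ≡ w x) → ∀ xs → weigh v xs ≡ weigh w xs
weigh-cong e []       = refl
weigh-cong e (x ∷ xs) = cong₂ _+_ (e x) (weigh-cong e xs)

window-single : ∀ (κ : ℤ → ℤ) r w → ∣ r ∣ ℕ.≤ w → window (λ m → κ m * ε (r - m)) w ≡ κ r
window-single κ r w le = trans (∑-single (suc (w ℕ.+ w)) j (ℕ.s≤s (ℤₚ.drop‿+≤+ (subst (_≤ + (w ℕ.+ w)) (sym j≡) upper))) off)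
  (trans (cong₂ (λ x y → κ x * ε y) at-r (trans (cong (_-_ r) at-r) (ℤₚ.+-inverseʳ r))) (ℤₚ.*-identityʳ (κ r)))
  where
  j = ∣ r + + w ∣
  lower : ∀ r → ∣ r ∣ ℕ.≤ w → + 0 ≤ r + + w
  lower (+ n)    _ = 0≤+ _
  lower -[1+ n ] q = ≤-by (≤⇒0≤ (+≤+ q)) (l (+ w) (+ suc n))
    where
    l : ∀ w n → - n + w - + 0 ≡ w - n
    l = solve-∀
  j≡ : + j ≡ r + + w
  j≡ = ℤₚ.0≤i⇒+∣i∣≡i (lower r le)
  upper : r + + w ≤ + (w ℕ.+ w)
  upper = ℤₚ.+-monoˡ-≤ (+ w) (ℤₚ.≤-trans (i≤∣i∣ r) (+≤+ le))
  l₁ : ∀ r w → r + w - w ≡ r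
  l₁ = solve-∀
  at-r : + j - + w ≡ r
  at-r = trans (cong (_- + w) j≡) (l₁ r (+ w))
  l₂ : ∀ r i w → r - (i - w) ≡ r + w - i
  l₂ = solve-∀
  off : ∀ i → i ≢ j → κ (+ i - + w) * ε (r - (+ i - + w)) ≡ + 0
  off i i≢j = trans (cong (κ (+ i - + w) *_) (ε-≢ λ eq → i≢j (sym (ℤₚ.+-injective
      (trans j≡ (ℤₚ.i-j≡0⇒i≡j (r + + w) (+ i) (trans (sym (l₂ r (+ i) (+ w))) eq))))))) (ℤₚ.*-zeroʳ (κ (+ i - + w)))

-- Interchange of the sums over m and over the list. The bound `w₀` makes the window contain every ρ
-- x.
window-weigh : ∀ {A : Set} (κ : ℤ → ℤ) (ρ : A → ℤ) xs → ∃[ w₀ ] ∀ w → w₀ ℕ.≤ w →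
  window (λ m → κ m * weigh (λ x → ε (ρ x - m)) xs) w ≡ weigh (κ ∘ ρ) xs
window-weigh κ ρ [] = 0 , λ w _ → ∑-zero (suc (w ℕ.+ w)) (λ i _ → ℤₚ.*-zeroʳ (κ (+ i - + w)))
window-weigh κ ρ (x ∷ xs) with window-weigh κ ρ xs
... | w₀ , h = ∣ ρ x ∣ ℕ.+ w₀ , λ w le → trans
  (∑-cong (suc (w ℕ.+ w)) (λ i _ → ℤₚ.*-distribˡ-+ (κ (+ i - + w)) (ε (ρ x - (+ i - + w))) (weigh (λ x → ε (ρ x - (+ i - + w))) xs)))
  (trans (∑-+ (λ i → κ (+ i - + w) * ε (ρ x - (+ i - + w))) (λ i → κ (+ i - + w) * weigh (λ x → ε (ρ x - (+ i - + w))) xs) (suc (w ℕ.+ w)))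
    (cong₂ _+_ (window-single κ (ρ x) w (ℕₚ.≤-trans (ℕₚ.m≤m+n ∣ ρ x ∣ w₀) le)) (h w (ℕₚ.≤-trans (ℕₚ.m≤n+m w₀ ∣ ρ x ∣) le))))

Λ-R : ∀ κ n → Λ κ R n ≡ weigh (κ ∘ rank) (overpartitions (3 ℕ.* n ℕ.+ 1))
Λ-R κ n with window-weigh κ rank (overpartitions (3 ℕ.* n ℕ.+ 1))
... | w₀ , h = trans (Λ-def κ R n) (trans
  -- The window of Λ is enlarged past `w₀`, which changes nothing because R lies in the cone.
  (sym (window-widen {λ m → κ m * R m (+ n)} (3 ℕ.* n) w₀ (cone-left {R} cone κ n) (cone-right {R} cone κ n)))
  (trans (∑-cong (suc (w₀ ℕ.+ 3 ℕ.* n ℕ.+ (w₀ ℕ.+ 3 ℕ.* n))) (λ i _ → cong (κ (+ i - + (w₀ ℕ.+ 3 ℕ.* n)) *_) (R-rankCount (+ i - + (w₀ ℕ.+ 3 ℕ.* n)) n)))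
    (h (w₀ ℕ.+ 3 ℕ.* n) (ℕₚ.m≤m+n w₀ (3 ℕ.* n)))))
  where
  cone : Cone R
  cone = R-supp-line , R-supp-line⁻

remainder-unique : ∀ {r r′} A B → r ℕ.< 6 → r′ ℕ.< 6 → + r + A * + 6 ≡ + r′ + B * + 6 → r ≡ r′
remainder-unique {r} {r′} A B r<6 r′<6 eq = go ∣ B - A ∣ size
  where
  l : ∀ r r′ A B → r - r′ ≡ r + A * + 6 - r′ - A * + 6
  l = solve-∀
  l₂ : ∀ r′ A B → r′ + B * + 6 - r′ - A * + 6 ≡ (B - A) * + 6
  l₂ = solve-∀
  diff : r ℤ.⊖ r′ ≡ (B - A) * + 6
  diff = trans (sym (ℤₚ.m-n≡m⊖n r r′)) (trans (l (+ r) (+ r′) A B) (trans (cong (λ x → x - + r′ - A * + 6) eq) (l₂ (+ r′) A B)))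
  size : ∣ r ℤ.⊖ r′ ∣ ≡ ∣ B - A ∣ ℕ.* 6
  size = trans (cong ∣_∣ diff) (ℤₚ.abs-* (B - A) (+ 6))
  go : ∀ k → ∣ r ℤ.⊖ r′ ∣ ≡ k ℕ.* 6 → r ≡ r′
  go zero    e = ℤₚ.+-injective (ℤₚ.i-j≡0⇒i≡j (+ r) (+ r′) (trans (ℤₚ.m-n≡m⊖n r r′) (ℤₚ.∣i∣≡0⇒i≡0 e)))
  go (suc k) e = contradiction (subst (ℕ._< 6) e (ℕₚ.≤-<-trans (ℤₚ.∣m⊝n∣≤m⊔n r r′) (ℕₚ.⊔-lub r<6 r′<6)))
    (ℕₚ.≤⇒≯ (ℕₚ.m≤m+n 6 (k ℕ.* 6)))

%-periodic : ∀ x q → (x + q * + 6) %ℕ 6 ≡ x %ℕ 6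
%-periodic x q = remainder-unique ((x + q * + 6) /ℕ 6) (x /ℕ 6 + q) (n%ℕd<d (x + q * + 6) 6) (n%ℕd<d x 6)
  (trans (sym (a≡a%ℕn+[a/ℕn]*n (x + q * + 6) 6)) (trans (cong (_+ q * + 6) (a≡a%ℕn+[a/ℕn]*n x 6)) (l (+ (x %ℕ 6)) (x /ℕ 6) q)))
  where
  l : ∀ r y q → r + y * + 6 + q * + 6 ≡ r + (y + q) * + 6
  l = solve-∀

%-shift : ∀ m a → (m + a) %ℕ 6 ≡ (+ (m %ℕ 6) + a) %ℕ 6
%-shift m a = trans (cong (λ x → (x + a) %ℕ 6) (a≡a%ℕn+[a/ℕn]*n m 6)) (trans (cong (_%ℕ 6) (l (+ (m %ℕ 6)) (m /ℕ 6) a))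
  (%-periodic (+ (m %ℕ 6) + a) (m /ℕ 6)))
  where
  l : ∀ r q a → r + q * + 6 + a ≡ r + a + q * + 6
  l = solve-∀

mod6 : (ℕ → ℤ) → ℤ → ℤ
mod6 c m = c (m %ℕ 6)

mod6-rec : ∀ c t a → (∀ r → r ℕ.< 6 → c ((+ r + a) %ℕ 6) + c ((+ r - a) %ℕ 6) ≡ t * c r) →
  ∀ x → mod6 c (x + a) + mod6 c (x - a) ≡ t * mod6 c x
mod6-rec c t a h x = trans (cong₂ (λ r s → c r + c s) (%-shift x a) (%-shift x (- a))) (h (x %ℕ 6) (n%ℕd<d x 6))

below6 : {Q : ℕ → Set} → Q 0 → Q 1 → Q 2 → Q 3 → Q 4 → Q 5 → ∀ r → r ℕ.< 6 → Q r
below6 a b c d e f 0 _ = a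
below6 a b c d e f 1 _ = b
below6 a b c d e f 2 _ = c
below6 a b c d e f 3 _ = d
below6 a b c d e f 4 _ = e
below6 a b c d e f 5 _ = f
below6 a b c d e f (suc (suc (suc (suc (suc (suc r)))))) (ℕ.s≤s (ℕ.s≤s (ℕ.s≤s (ℕ.s≤s (ℕ.s≤s (ℕ.s≤s ()))))))

indicator : ℕ → ℕ → ℤ
indicator s r = if does (r ℕₚ.≟ s) then + 1 else + 0

length-filter : ∀ {A : Set} {Q : A → Set} (Q? : ∀ x → Dec (Q x)) xs →
  + length (filter Q? xs) ≡ weigh (λ x → if does (Q? x) then + 1 else + 0) xs
length-filter Q? []       = refl
length-filter Q? (x ∷ xs) with does (Q? x)
... | true  = cong (_+_ (+ 1)) (length-filter Q? xs)
... | false = trans (length-filter Q? xs) (sym (ℤₚ.+-identityˡ _))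

combine6 : (ℕ → ℤ) → (ℕ → ℤ) → ℤ
combine6 c N = c 0 * N 0 + c 1 * N 1 + c 2 * N 2 + c 3 * N 3 + c 4 * N 4 + c 5 * N 5

weigh-mod6 : ∀ {A : Set} (ρ : A → ℤ) c xs → weigh (mod6 c ∘ ρ) xs ≡ combine6 c (λ s → weigh (λ x → indicator s (ρ x %ℕ 6)) xs)
weigh-mod6 ρ c []       = l (c 0) (c 1) (c 2) (c 3) (c 4) (c 5)
  where
  l : ∀ a b d e f g → + 0 ≡ a * + 0 + b * + 0 + d * + 0 + e * + 0 + f * + 0 + g * + 0
  l = solve-∀
weigh-mod6 ρ c (x ∷ xs) = trans (cong₂ _+_ (single (ρ x %ℕ 6) (n%ℕd<d (ρ x) 6)) (weigh-mod6 ρ c xs))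
  (l (c 0) (c 1) (c 2) (c 3) (c 4) (c 5) (i 0) (i 1) (i 2) (i 3) (i 4) (i 5) (N 0) (N 1) (N 2) (N 3) (N 4) (N 5))
  where
  i N : ℕ → ℤ
  i s = indicator s (ρ x %ℕ 6)
  N s = weigh (λ x → indicator s (ρ x %ℕ 6)) xs
  l : ∀ a b d e f g i₀ i₁ i₂ i₃ i₄ i₅ x₀ x₁ x₂ x₃ x₄ x₅ →
    (a * i₀ + b * i₁ + d * i₂ + e * i₃ + f * i₄ + g * i₅) + (a * x₀ + b * x₁ + d * x₂ + e * x₃ + f * x₄ + g * x₅) ≡
    a * (i₀ + x₀) + b * (i₁ + x₁) + d * (i₂ + x₂) + e * (i₃ + x₃) + f * (i₄ + x₄) + g * (i₅ + x₅)
  l = solve-∀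
  single : ∀ r → r ℕ.< 6 → c r ≡ combine6 c (λ s → indicator s r)
  single = below6 (l₀ (c 0) (c 1) (c 2) (c 3) (c 4) (c 5)) (l₁ (c 0) (c 1) (c 2) (c 3) (c 4) (c 5)) (l₂ (c 0) (c 1) (c 2) (c 3) (c 4) (c 5))
    (l₃ (c 0) (c 1) (c 2) (c 3) (c 4) (c 5)) (l₄ (c 0) (c 1) (c 2) (c 3) (c 4) (c 5)) (l₅ (c 0) (c 1) (c 2) (c 3) (c 4) (c 5))
    where
    l₀ : ∀ a b d e f g → a ≡ a * + 1 + b * + 0 + d * + 0 + e * + 0 + f * + 0 + g * + 0
    l₀ = solve-∀
    l₁ : ∀ a b d e f g → b ≡ a * + 0 + b * + 1 + d * + 0 + e * + 0 + f * + 0 + g * + 0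
    l₁ = solve-∀
    l₂ : ∀ a b d e f g → d ≡ a * + 0 + b * + 0 + d * + 1 + e * + 0 + f * + 0 + g * + 0
    l₂ = solve-∀
    l₃ : ∀ a b d e f g → e ≡ a * + 0 + b * + 0 + d * + 0 + e * + 1 + f * + 0 + g * + 0
    l₃ = solve-∀
    l₄ : ∀ a b d e f g → f ≡ a * + 0 + b * + 0 + d * + 0 + e * + 0 + f * + 1 + g * + 0
    l₄ = solve-∀
    l₅ : ∀ a b d e f g → g ≡ a * + 0 + b * + 0 + d * + 0 + e * + 0 + f * + 0 + g * + 1
    l₅ = solve-∀

combine6-cong : ∀ c {N N′ : ℕ → ℤ} → (∀ s → s ℕ.< 6 → N s ≡ N′ s) → combine6 c N ≡ combine6 c N′
combine6-cong c {N} {N′} e = cong₂ _+_ (cong₂ _+_ (cong₂ _+_ (cong₂ _+_ (cong₂ _+_ (t 0 (lt 0)) (t 1 (lt 1))) (t 2 (lt 2))) (t 3 (lt 3))) (t 4 (lt 4))) (t 5 ℕₚ.≤-refl)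
  where
  t : ∀ s → s ℕ.< 6 → c s * N s ≡ c s * N′ s
  t s q = cong (c s *_) (e s q)
  lt : ∀ s {d} → s ℕ.< suc (s ℕ.+ d)
  lt s {d} = ℕ.s≤s (ℕₚ.m≤m+n s d)

Nbar-weigh : ∀ s N → s ℕ.< 6 → + Nbar s 6 N ≡ weigh (λ π → indicator s (rank π %ℕ 6)) (overpartitions N)
Nbar-weigh s N q = trans (length-filter (λ π → (rank π %ℕ 6) ℕ.≟ (s ℕ.% 6)) (overpartitions N))
  (weigh-cong (λ π → cong (λ x → indicator x (rank π %ℕ 6)) (m<n⇒m%n≡m q)) (overpartitions N))

Λ-rbar : ∀ c n → Λ (mod6 c) R n ≡ combine6 c (λ s → rbar s 1 n)
Λ-rbar c n = trans (Λ-R (mod6 c) n) (trans (weigh-mod6 rank c (overpartitions (3 ℕ.* n ℕ.+ 1)))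
  (sym (combine6-cong c (λ s q → Nbar-weigh s (3 ℕ.* n ℕ.+ 1) q))))

-- Products of quadratic factors.

shift-X^ : ∀ a b n → ↑ (X^ a) (+ n - + b) ≡ X^ (a ℕ.+ b) n
shift-X^ a zero    n       = trans (cong (↑ (X^ a)) (ℤₚ.+-identityʳ (+ n))) (cong (λ e → X^ e n) (sym (ℕₚ.+-identityʳ a)))
shift-X^ a (suc b) zero    = cong (λ e → X^ e 0) (sym (ℕₚ.+-suc a b))
shift-X^ a (suc b) (suc n) = trans (cong (↑ (X^ a)) (l (+ n) (+ b))) (trans (shift-X^ a b n)
  (trans (sym (tail-X^ (a ℕ.+ b) n)) (cong (λ e → X^ e (suc n)) (sym (ℕₚ.+-suc a b)))))
  where
  l : ∀ n b → + 1 + n - (+ 1 + b) ≡ n - b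
  l = solve-∀

X^-zero : X^ 0 ≈ one
X^-zero zero    = refl
X^-zero (suc n) = refl

shift-one : ∀ b n → ↑ one (+ n - + b) ≡ X^ b n
shift-one b n = trans (↑-cong (λ n → sym (X^-zero n)) (+ n - + b)) (shift-X^ 0 b n)

↑-⊕ : ∀ f g k → ↑ (f ⊕ g) k ≡ ↑ f k + ↑ g k
↑-⊕ f g (+ n)    = refl
↑-⊕ f g -[1+ n ] = refl

↑-· : ∀ c f k → ↑ (c · f) k ≡ c * ↑ f k
↑-· c f (+ n)    = refl
↑-· c f -[1+ n ] = sym (ℤₚ.*-zeroʳ c)

onePlus-onePlus : ∀ c d b n → (onePlus c b ∙ onePlus d b) n ≡ one n + c * X^ b n + d * (X^ b n + c * X^ (b ℕ.+ b) n)
onePlus-onePlus c d b n = trans (onePlus-∙ d b (onePlus c b) (+ n)) (cong (λ x → onePlus c b n + d * x)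
  (trans (↑-⊕ one (c · X^ b) (+ n - + b)) (cong₂ _+_ (shift-one b n) (trans (↑-· c (X^ b) (+ n - + b)) (cong (c *_) (shift-X^ b b n))))))

quad-onePlus : ∀ s d b n → (quad s b ∙ onePlus d b) n ≡
  one n + s * X^ b n + X^ (b ℕ.+ b) n + d * (X^ b n + s * X^ (b ℕ.+ b) n + X^ (b ℕ.+ b ℕ.+ b) n)
quad-onePlus s d b n = trans (onePlus-∙ d b (quad s b) (+ n)) (cong (λ x → quad s b n + d * x)
  (trans (↑-⊕ (onePlus s b) (X^ (b ℕ.+ b)) k) (cong₂ _+_ (trans (↑-⊕ one (s · X^ b) k) (cong₂ _+_ (shift-one b n)
    (trans (↑-· s (X^ b) k) (cong (s *_) (shift-X^ b b n))))) (shift-X^ (b ℕ.+ b) b n))))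
  where
  k = + n - + b

double : ∀ b → onePlus (+ 1) b ∙ onePlus (- + 1) b ≈ onePlus (- + 1) (b ℕ.+ b)
double b n = trans (onePlus-onePlus (+ 1) (- + 1) b n) (l (one n) (X^ b n) (X^ (b ℕ.+ b) n))
  where
  l : ∀ o x y → o + + 1 * x + - + 1 * (x + + 1 * y) ≡ o + - + 1 * y
  l = solve-∀

square : ∀ c b → c * c ≡ + 1 → quad (c + c) b ≈ onePlus c b ∙ onePlus c b
square c b c² n = sym (trans (onePlus-onePlus c c b n) (trans (l c (one n) (X^ b n) (X^ (b ℕ.+ b) n))
  (trans (cong (λ x → one n + (c + c) * X^ b n + x * X^ (b ℕ.+ b) n) c²) (cong (_+_ (onePlus (c + c) b n)) (ℤₚ.*-identityˡ (X^ (b ℕ.+ b) n))))))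
  where
  l : ∀ c o x y → o + c * x + c * (x + c * y) ≡ o + (c + c) * x + (c * c) * y
  l = solve-∀

-- The factorisation of 1 + c³x³ at x = q^b, where c³ = c. It expresses the products at cubic and
-- sixth roots of unity by ordinary ones.
cube : ∀ c b → c * c ≡ + 1 → quad (- c) b ∙ onePlus c b ≈ onePlus c (b ℕ.+ b ℕ.+ b)
cube c b c² n = trans (quad-onePlus (- c) c b n) (trans (l c (one n) (X^ b n) (X^ (b ℕ.+ b) n) (X^ (b ℕ.+ b ℕ.+ b) n))
  (trans (cong (λ x → onePlus c (b ℕ.+ b ℕ.+ b) n + (+ 1 - x) * X^ (b ℕ.+ b) n) c²) (l₂ (onePlus c (b ℕ.+ b ℕ.+ b) n) (X^ (b ℕ.+ b) n))))
  where
  l : ∀ c o x y z → o + - c * x + y + c * (x + - c * y + z) ≡ o + c * z + (+ 1 - c * c) * y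
  l = solve-∀
  l₂ : ∀ x y → x + (+ 1 - + 1) * y ≡ x
  l₂ = solve-∀

Q′ : ℤ → ℕ → ℕ → PS
Q′ s a m = ∏ (λ i → quad s (a ℕ.+ m ℕ.* i))

Unit-Q′ : ∀ s a m → Unit (λ i → quad s (suc a ℕ.+ suc m ℕ.* i))
Unit-Q′ s a m = Unit-quad s (λ i → suc a ℕ.+ suc m ℕ.* i) (prog< a m)

Q′-square : ∀ c a m → c * c ≡ + 1 → Q′ (c + c) (suc a) (suc m) ≈ E c (suc a) (suc m) ∙ E c (suc a) (suc m)
Q′-square c a m c² = PS.trans (∏-cong (λ i → square c (suc a ℕ.+ suc m ℕ.* i) c²)) (∏-∙ (Unit-E c a m) (Unit-E c a m))

Q′-cube : ∀ c a m → c * c ≡ + 1 → Q′ (- c) (suc a) (suc m) ∙ E c (suc a) (suc m) ≈ E c (3 ℕ.* suc a) (3 ℕ.* suc m)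
Q′-cube c a m c² = PS.trans (PS.sym (∏-∙ (Unit-Q′ (- c) a m) (Unit-E c a m))) (∏-cong (λ i →
  PS.trans (cube c (suc a ℕ.+ suc m ℕ.* i) c²) (PS.reflexive (cong (onePlus c) (thrice i)))))
  where
  triple : ∀ x → x ℕ.+ x ℕ.+ x ≡ 3 ℕ.* x
  triple x = trans (ℕₚ.+-assoc x x x) (cong (λ y → x ℕ.+ (x ℕ.+ y)) (sym (ℕₚ.+-identityʳ x)))
  thrice : ∀ i → let b = suc a ℕ.+ suc m ℕ.* i in b ℕ.+ b ℕ.+ b ≡ 3 ℕ.* suc a ℕ.+ 3 ℕ.* suc m ℕ.* i
  thrice i = trans (triple (suc a ℕ.+ suc m ℕ.* i)) (trans (ℕₚ.*-distribˡ-+ 3 (suc a) (suc m ℕ.* i))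
    (cong (3 ℕ.* suc a ℕ.+_) (sym (ℕₚ.*-assoc 3 (suc m) i))))

E-double : ∀ a m → E⁺ (suc a) (suc m) ∙ E⁻ (suc a) (suc m) ≈ E⁻ (2 ℕ.* suc a) (2 ℕ.* suc m)
E-double a m = PS.trans (PS.sym (∏-∙ (Unit-E (+ 1) a m) (Unit-E (- + 1) a m))) (∏-cong (λ i →
  PS.trans (double (suc a ℕ.+ suc m ℕ.* i)) (PS.reflexive (cong (onePlus (- + 1)) (twice i)))))
  where
  twice : ∀ i → let b = suc a ℕ.+ suc m ℕ.* i in b ℕ.+ b ≡ 2 ℕ.* suc a ℕ.+ 2 ℕ.* suc m ℕ.* i
  twice i = trans (cong (λ y → suc a ℕ.+ suc m ℕ.* i ℕ.+ y) (sym (ℕₚ.+-identityʳ (suc a ℕ.+ suc m ℕ.* i))))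
    (trans (ℕₚ.*-distribˡ-+ 2 (suc a) (suc m ℕ.* i)) (cong (2 ℕ.* suc a ℕ.+_) (sym (ℕₚ.*-assoc 2 (suc m) i))))

-- Cancellation, and the product algebra of the evaluations.

Monic : PS → Set
Monic f = f 0 ≡ + 1

Monic-∙ : ∀ {f g} → Monic f → Monic g → Monic (f ∙ g)
Monic-∙ {f} {g} p q = trans (cong (λ h → h 0) (∙≡⊛ f g)) (trans (⊛-zero f g) (cong₂ _*_ p q))

Monic-∏ : ∀ {f} → Unit f → Monic (∏ f)
Monic-∏ un = sym (prod-∏ 0 0 un ℕ.z≤n)

inv-∙ : ∀ {f} → Monic f → f ∙ inv f ≈ one
inv-∙ {f} p n = trans (cong (λ h → h n) (∙≡⊛ f (inv f))) (⊛-inverseʳ f p n)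

cancelˡ : ∀ {f g h} → Monic f → f ∙ g ≈ f ∙ h → g ≈ h
cancelˡ {f} {g} {h} p e = begin
  g ≈⟨ undo g ⟨
  inv f ∙ (f ∙ g) ≈⟨ PS.*-congˡ e ⟩
  inv f ∙ (f ∙ h) ≈⟨ undo h ⟩
  h ∎
  where
  open PS-Reasoning
  undo : ∀ g → inv f ∙ (f ∙ g) ≈ g
  undo g = PS.trans (PS.sym (PS.*-assoc (inv f) f g)) (PS.trans (PS.*-congʳ (PS.trans (PS.*-comm (inv f) f) (inv-∙ {f} p))) (PS.*-identityˡ g))

pow : PS → ℕ → PS
pow f zero    = one
pow f (suc n) = f ∙ pow f n

pow-cong : ∀ {f g} n → f ≈ g → pow f n ≈ pow g n
pow-cong zero    e = PS.refl
pow-cong (suc n) e = PS.*-cong e (pow-cong n e)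

pow-one : ∀ {f} n → f ≈ one → pow f n ≈ one
pow-one zero    e = PS.refl
pow-one (suc n) e = PS.trans (PS.*-cong e (pow-one n e)) (PS.*-identityˡ one)

^-pow : ∀ f n → f ^ n ≈ pow f n
^-pow f zero    = PS.refl
^-pow f (suc n) = PS.trans (⊛-∙ f (f ^ n)) (PS.*-congˡ (^-pow f n))
  where
  ⊛-∙ : ∀ f g → f ⊛ g ≈ f ∙ g
  ⊛-∙ f g n = cong (λ h → h n) (sym (∙≡⊛ f g))

Monic-pow : ∀ {f} n → Monic f → Monic (pow f n)
Monic-pow zero    p = refl
Monic-pow {f} (suc n) p = Monic-∙ {f} {pow f n} p (Monic-pow {f} n p)

oneMinusQ-onePlus : ∀ e → oneMinusQ e ≈ onePlus (- + 1) e
oneMinusQ-onePlus e n = l (one n) (X^ e n)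
  where
  l : ∀ x y → x - y ≡ x + - + 1 * y
  l = solve-∀

pochFin-prod : ∀ a m N → pochFin a m N ≈ prod (λ i → onePlus (- + 1) (a ℕ.+ m ℕ.* i)) N
pochFin-prod a m zero    = PS.refl
pochFin-prod a m (suc N) = PS.trans (PS.reflexive (sym (∙≡⊛ (pochFin a m N) (oneMinusQ (a ℕ.+ m ℕ.* N)))))
  (PS.*-cong (pochFin-prod a m N) (oneMinusQ-onePlus (a ℕ.+ m ℕ.* N)))

poch-E : ∀ a m → poch a m ≈ E⁻ a m
poch-E a m n = trans (pochFin-prod a m (suc n) n) (sym (∏-def (λ i → onePlus (- + 1) (a ℕ.+ m ℕ.* i)) n))

-- a, b, c = (qⁱ; q³) for i = 1, 2, 3 and eᵢ = (qⁱ; q⁶); with a sign: P = (-q; q) and a⁺, b⁺, c⁺ = (-qⁱ; q³);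
-- q₁, q₂ = Π (1 ± q^n + q^(2n)).
module Quotients (L K P a⁺ b⁺ c⁺ q₁ q₂ e₁ e₂ e₃ e₄ e₅ e₆ : PS) where

  a b c U j₀ w j₁ j₂ j₃ : PS
  a = e₁ ∙ e₄
  b = e₂ ∙ e₅
  c = e₃ ∙ e₆
  U = e₁ ∙ (e₃ ∙ e₅)
  j₀ = U ∙ (e₂ ∙ (e₄ ∙ e₆))
  w = a⁺ ∙ (b⁺ ∙ c⁺)
  j₁ = (e₁ ∙ e₅) ∙ e₆
  j₂ = e₂ ∙ (e₄ ∙ e₆)
  j₃ = (e₃ ∙ e₃) ∙ e₆

  private
    open CM using (Expr; var; solve; _⊜_) renaming (_⊕_ to _⊗_; id to ι)

    infixr 8 _^^_
    _^^_ : ∀ {n} → Expr n → ℕ → Expr n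
    x ^^ zero  = ι
    x ^^ suc n = x ⊗ x ^^ n

  -- These five relations remove all signed and quadratic products. Each identity below inserts or
  -- extracts powers of P U = 1, substitutes a relation, and regroups. A common factor, e₃ or V, is
  -- left on both sides and cancelled afterwards.
  module _ (PU : P ∙ U ≈ one) (cc : c⁺ ∙ c ≈ e₆) (Pw : P ≈ w) (qj : q₁ ∙ j₀ ≈ c) (qP : q₂ ∙ P ≈ c⁺) where
    open PS-Reasoning

    at-1 : L ∙ (((a ∙ a) ∙ (b ∙ b)) ∙ (j₀ ∙ j₀)) ≈ K ∙ ((c ∙ P) ∙ (P ∙ P)) →
      e₃ ∙ (L ∙ ((pow j₁ 7 ∙ pow j₂ 4) ∙ pow j₃ 2)) ≈ e₃ ∙ (K ∙ pow e₆ 12)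
    at-1 eq = begin
      e₃ ∙ (L ∙ ((pow j₁ 7 ∙ pow j₂ 4) ∙ pow j₃ 2))
        ≈⟨ solve 7 (λ L e₁ e₂ e₃ e₄ e₅ e₆ → let a = e₁ ⊗ e₄; b = e₂ ⊗ e₅; U = e₁ ⊗ (e₃ ⊗ e₅); j₀ = U ⊗ (e₂ ⊗ (e₄ ⊗ e₆)) in
             e₃ ⊗ (L ⊗ ((((e₁ ⊗ e₅) ⊗ e₆) ^^ 7 ⊗ (e₂ ⊗ (e₄ ⊗ e₆)) ^^ 4) ⊗ ((e₃ ⊗ e₃) ⊗ e₆) ^^ 2)) ⊜
             (L ⊗ (((a ⊗ a) ⊗ (b ⊗ b)) ⊗ (j₀ ⊗ j₀))) ⊗ (U ^^ 3 ⊗ e₆ ^^ 11)) (λ _ → refl) L e₁ e₂ e₃ e₄ e₅ e₆ ⟩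
      -- U³ e₆¹¹ is what the left side of the hypothesis lacks of the required denominator times e₃;
      -- its U³ then meets the P³ on the right.
      (L ∙ (((a ∙ a) ∙ (b ∙ b)) ∙ (j₀ ∙ j₀))) ∙ (pow U 3 ∙ pow e₆ 11) ≈⟨ PS.*-congʳ eq ⟩
      (K ∙ ((c ∙ P) ∙ (P ∙ P))) ∙ (pow U 3 ∙ pow e₆ 11)
        ≈⟨ solve 5 (λ K P U e₃ e₆ → (K ⊗ (((e₃ ⊗ e₆) ⊗ P) ⊗ (P ⊗ P))) ⊗ (U ^^ 3 ⊗ e₆ ^^ 11) ⊜
             (P ⊗ U) ^^ 3 ⊗ (e₃ ⊗ (K ⊗ e₆ ^^ 12))) (λ _ → refl) K P U e₃ e₆ ⟩
      pow (P ∙ U) 3 ∙ (e₃ ∙ (K ∙ pow e₆ 12)) ≈⟨ PS.*-congʳ (pow-one 3 PU) ⟩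
      one ∙ (e₃ ∙ (K ∙ pow e₆ 12)) ≈⟨ PS.*-identityˡ (e₃ ∙ (K ∙ pow e₆ 12)) ⟩
      e₃ ∙ (K ∙ pow e₆ 12) ∎

    at-−1 : L ∙ (((a⁺ ∙ a⁺) ∙ (b⁺ ∙ b⁺)) ∙ (P ∙ P)) ≈ K ∙ ((c ∙ P) ∙ (j₀ ∙ j₀)) →
      e₃ ∙ (L ∙ pow e₆ 6) ≈ e₃ ∙ (K ∙ ((pow j₁ 5 ∙ pow j₂ 2) ∙ pow j₃ 2))
    at-−1 eq = begin
      e₃ ∙ (L ∙ pow e₆ 6) ≈⟨ PS.*-identityˡ (e₃ ∙ (L ∙ pow e₆ 6)) ⟨
      one ∙ (e₃ ∙ (L ∙ pow e₆ 6)) ≈⟨ PS.*-congʳ (pow-one 4 PU) ⟨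
      -- Of the four copies of P, two become w² and supply the squares of a⁺ and b⁺; the other two
      -- are the P ∙ P of the hypothesis.
      pow (P ∙ U) 4 ∙ (e₃ ∙ (L ∙ pow e₆ 6))
        ≈⟨ solve 5 (λ L P U e₃ e₆ → (P ⊗ U) ^^ 4 ⊗ (e₃ ⊗ (L ⊗ e₆ ^^ 6)) ⊜
             (P ⊗ P) ⊗ ((L ⊗ (P ⊗ P)) ⊗ (U ^^ 4 ⊗ (e₃ ⊗ e₆ ^^ 6)))) (λ _ → refl) L P U e₃ e₆ ⟩
      (P ∙ P) ∙ ((L ∙ (P ∙ P)) ∙ (pow U 4 ∙ (e₃ ∙ pow e₆ 6))) ≈⟨ PS.*-congʳ (PS.*-cong Pw Pw) ⟩
      (w ∙ w) ∙ ((L ∙ (P ∙ P)) ∙ (pow U 4 ∙ (e₃ ∙ pow e₆ 6)))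
        ≈⟨ solve 6 (λ L P a⁺ b⁺ c⁺ r → ((a⁺ ⊗ (b⁺ ⊗ c⁺)) ⊗ (a⁺ ⊗ (b⁺ ⊗ c⁺))) ⊗ ((L ⊗ (P ⊗ P)) ⊗ r) ⊜
             (L ⊗ (((a⁺ ⊗ a⁺) ⊗ (b⁺ ⊗ b⁺)) ⊗ (P ⊗ P))) ⊗ ((c⁺ ⊗ c⁺) ⊗ r)) (λ _ → refl) L P a⁺ b⁺ c⁺ (pow U 4 ∙ (e₃ ∙ pow e₆ 6)) ⟩
      (L ∙ (((a⁺ ∙ a⁺) ∙ (b⁺ ∙ b⁺)) ∙ (P ∙ P))) ∙ ((c⁺ ∙ c⁺) ∙ (pow U 4 ∙ (e₃ ∙ pow e₆ 6))) ≈⟨ PS.*-congʳ eq ⟩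
      (K ∙ ((c ∙ P) ∙ (j₀ ∙ j₀))) ∙ ((c⁺ ∙ c⁺) ∙ (pow U 4 ∙ (e₃ ∙ pow e₆ 6)))
        ≈⟨ solve 7 (λ K P j₀ c⁺ U e₃ e₆ → (K ⊗ (((e₃ ⊗ e₆) ⊗ P) ⊗ (j₀ ⊗ j₀))) ⊗ ((c⁺ ⊗ c⁺) ⊗ (U ^^ 4 ⊗ (e₃ ⊗ e₆ ^^ 6))) ⊜
             ((c⁺ ⊗ (e₃ ⊗ e₆)) ^^ 2 ⊗ (P ⊗ U)) ⊗ (K ⊗ (U ^^ 3 ⊗ ((j₀ ⊗ j₀) ⊗ e₆ ^^ 5)))) (λ _ → refl) K P j₀ c⁺ U e₃ e₆ ⟩
      (pow (c⁺ ∙ c) 2 ∙ (P ∙ U)) ∙ (K ∙ (pow U 3 ∙ ((j₀ ∙ j₀) ∙ pow e₆ 5))) ≈⟨ PS.*-congʳ (PS.*-cong (pow-cong 2 cc) PU) ⟩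
      (pow e₆ 2 ∙ one) ∙ (K ∙ (pow U 3 ∙ ((j₀ ∙ j₀) ∙ pow e₆ 5)))
        ≈⟨ solve 7 (λ K e₁ e₂ e₃ e₄ e₅ e₆ → let U = e₁ ⊗ (e₃ ⊗ e₅); j₀ = U ⊗ (e₂ ⊗ (e₄ ⊗ e₆)) in
             (e₆ ^^ 2 ⊗ ι) ⊗ (K ⊗ (U ^^ 3 ⊗ ((j₀ ⊗ j₀) ⊗ e₆ ^^ 5))) ⊜
             e₃ ⊗ (K ⊗ ((((e₁ ⊗ e₅) ⊗ e₆) ^^ 5 ⊗ (e₂ ⊗ (e₄ ⊗ e₆)) ^^ 2) ⊗ ((e₃ ⊗ e₃) ⊗ e₆) ^^ 2))) (λ _ → refl) K e₁ e₂ e₃ e₄ e₅ e₆ ⟩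
      e₃ ∙ (K ∙ ((pow j₁ 5 ∙ pow j₂ 2) ∙ pow j₃ 2)) ∎

    V : PS
    V = (e₁ ∙ (e₂ ∙ (e₄ ∙ e₅))) ∙ (e₃ ∙ e₃)

    at-ω : L ∙ (((a ∙ a) ∙ (b ∙ b)) ∙ q₁) ≈ K ∙ ((c ∙ P) ∙ q₂) → V ∙ (L ∙ (j₁ ∙ j₂)) ≈ V ∙ (K ∙ pow e₆ 3)
    at-ω eq = begin
      V ∙ (L ∙ (j₁ ∙ j₂))
        ≈⟨ solve 7 (λ L e₁ e₂ e₃ e₄ e₅ e₆ → let a = e₁ ⊗ e₄; b = e₂ ⊗ e₅; c = e₃ ⊗ e₆ in
             ((e₁ ⊗ (e₂ ⊗ (e₄ ⊗ e₅))) ⊗ (e₃ ⊗ e₃)) ⊗ (L ⊗ (((e₁ ⊗ e₅) ⊗ e₆) ⊗ (e₂ ⊗ (e₄ ⊗ e₆)))) ⊜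
             ((L ⊗ ((a ⊗ a) ⊗ (b ⊗ b))) ⊗ c) ⊗ c) (λ _ → refl) L e₁ e₂ e₃ e₄ e₅ e₆ ⟩
      ((L ∙ ((a ∙ a) ∙ (b ∙ b))) ∙ c) ∙ c ≈⟨ PS.*-congʳ (PS.*-congˡ qj) ⟨
      ((L ∙ ((a ∙ a) ∙ (b ∙ b))) ∙ (q₁ ∙ j₀)) ∙ c
        ≈⟨ solve 5 (λ L d q j₀ c → ((L ⊗ d) ⊗ (q ⊗ j₀)) ⊗ c ⊜ (L ⊗ (d ⊗ q)) ⊗ (j₀ ⊗ c)) (λ _ → refl) L ((a ∙ a) ∙ (b ∙ b)) q₁ j₀ c ⟩
      (L ∙ (((a ∙ a) ∙ (b ∙ b)) ∙ q₁)) ∙ (j₀ ∙ c) ≈⟨ PS.*-congʳ eq ⟩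
      (K ∙ ((c ∙ P) ∙ q₂)) ∙ (j₀ ∙ c)
        ≈⟨ solve 5 (λ K c P q j₀ → (K ⊗ ((c ⊗ P) ⊗ q)) ⊗ (j₀ ⊗ c) ⊜ (K ⊗ (j₀ ⊗ c)) ⊗ ((q ⊗ P) ⊗ c)) (λ _ → refl) K c P q₂ j₀ ⟩
      (K ∙ (j₀ ∙ c)) ∙ ((q₂ ∙ P) ∙ c) ≈⟨ PS.*-congˡ (PS.trans (PS.*-congʳ qP) cc) ⟩
      (K ∙ (j₀ ∙ c)) ∙ e₆
        ≈⟨ solve 7 (λ K e₁ e₂ e₃ e₄ e₅ e₆ → (K ⊗ (((e₁ ⊗ (e₃ ⊗ e₅)) ⊗ (e₂ ⊗ (e₄ ⊗ e₆))) ⊗ (e₃ ⊗ e₆))) ⊗ e₆ ⊜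
             ((e₁ ⊗ (e₂ ⊗ (e₄ ⊗ e₅))) ⊗ (e₃ ⊗ e₃)) ⊗ (K ⊗ e₆ ^^ 3)) (λ _ → refl) K e₁ e₂ e₃ e₄ e₅ e₆ ⟩
      V ∙ (K ∙ pow e₆ 3) ∎

    at-−ω : L ∙ (((a⁺ ∙ a⁺) ∙ (b⁺ ∙ b⁺)) ∙ q₂) ≈ K ∙ ((c ∙ P) ∙ q₁) → e₃ ∙ (L ∙ (j₁ ∙ j₂)) ≈ e₃ ∙ (K ∙ pow e₆ 3)
    at-−ω eq = begin
      e₃ ∙ (L ∙ (j₁ ∙ j₂))
        ≈⟨ solve 7 (λ L e₁ e₂ e₃ e₄ e₅ e₆ → e₃ ⊗ (L ⊗ (((e₁ ⊗ e₅) ⊗ e₆) ⊗ (e₂ ⊗ (e₄ ⊗ e₆)))) ⊜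
             ι ⊗ (e₆ ⊗ (L ⊗ ((e₁ ⊗ (e₃ ⊗ e₅)) ⊗ (e₂ ⊗ (e₄ ⊗ e₆)))))) (λ _ → refl) L e₁ e₂ e₃ e₄ e₅ e₆ ⟩
      one ∙ (e₆ ∙ (L ∙ j₀)) ≈⟨ PS.*-cong (pow-one 2 PU) (PS.*-congʳ (PS.trans (PS.*-congʳ qP) cc)) ⟨
      pow (P ∙ U) 2 ∙ (((q₂ ∙ P) ∙ c) ∙ (L ∙ j₀))
        ≈⟨ solve 6 (λ L P U q c j₀ → (P ⊗ U) ^^ 2 ⊗ (((q ⊗ P) ⊗ c) ⊗ (L ⊗ j₀)) ⊜
             (P ⊗ P) ⊗ ((L ⊗ q) ⊗ (((P ⊗ c) ⊗ j₀) ⊗ (U ⊗ U)))) (λ _ → refl) L P U q₂ c j₀ ⟩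
      (P ∙ P) ∙ ((L ∙ q₂) ∙ (((P ∙ c) ∙ j₀) ∙ (U ∙ U))) ≈⟨ PS.*-congʳ (PS.*-cong Pw Pw) ⟩
      (w ∙ w) ∙ ((L ∙ q₂) ∙ (((P ∙ c) ∙ j₀) ∙ (U ∙ U)))
        ≈⟨ solve 6 (λ L q a⁺ b⁺ c⁺ r → ((a⁺ ⊗ (b⁺ ⊗ c⁺)) ⊗ (a⁺ ⊗ (b⁺ ⊗ c⁺))) ⊗ ((L ⊗ q) ⊗ r) ⊜
             (L ⊗ (((a⁺ ⊗ a⁺) ⊗ (b⁺ ⊗ b⁺)) ⊗ q)) ⊗ ((c⁺ ⊗ c⁺) ⊗ r)) (λ _ → refl) L q₂ a⁺ b⁺ c⁺ (((P ∙ c) ∙ j₀) ∙ (U ∙ U)) ⟩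
      (L ∙ (((a⁺ ∙ a⁺) ∙ (b⁺ ∙ b⁺)) ∙ q₂)) ∙ ((c⁺ ∙ c⁺) ∙ (((P ∙ c) ∙ j₀) ∙ (U ∙ U))) ≈⟨ PS.*-congʳ eq ⟩
      (K ∙ ((c ∙ P) ∙ q₁)) ∙ ((c⁺ ∙ c⁺) ∙ (((P ∙ c) ∙ j₀) ∙ (U ∙ U)))
        ≈⟨ solve 7 (λ K c P q c⁺ j₀ U → (K ⊗ ((c ⊗ P) ⊗ q)) ⊗ ((c⁺ ⊗ c⁺) ⊗ (((P ⊗ c) ⊗ j₀) ⊗ (U ⊗ U))) ⊜
             ((c⁺ ⊗ c) ^^ 2 ⊗ (P ⊗ U) ^^ 2) ⊗ (K ⊗ (q ⊗ j₀))) (λ _ → refl) K c P q₁ c⁺ j₀ U ⟩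
      (pow (c⁺ ∙ c) 2 ∙ pow (P ∙ U) 2) ∙ (K ∙ (q₁ ∙ j₀)) ≈⟨ PS.*-cong (PS.*-cong (pow-cong 2 cc) (pow-one 2 PU)) (PS.*-congˡ qj) ⟩
      (pow e₆ 2 ∙ one) ∙ (K ∙ c)
        ≈⟨ solve 3 (λ K e₃ e₆ → (e₆ ^^ 2 ⊗ ι) ⊗ (K ⊗ (e₃ ⊗ e₆)) ⊜ e₃ ⊗ (K ⊗ e₆ ^^ 3)) (λ _ → refl) K e₃ e₆ ⟩
      e₃ ∙ (K ∙ pow e₆ 3) ∎

module _ (κ : ℤ → ℤ) (t t₃ : ℤ)
  (h₁ : ∀ x → κ (x + + 1) + κ (x - + 1) ≡ t * κ x) (h₃ : ∀ x → κ (x + + 3) + κ (x - + 3) ≡ t₃ * κ x) where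
  open Evaluate κ t t₃ h₁ h₃
  open PS-Reasoning

  evaluation : Λ κ R ∙ ((Q′ (- + 1 * t₃) 1 3 ∙ Q′ (- + 1 * t₃) 2 3) ∙ Q′ (- + 1 * t) 1 1) ≈
    ((κ (+ 0) * + 2) · one) ∙ ((E⁻ 3 3 ∙ E⁺ 1 1) ∙ Q′ (+ 1 * t) 1 1)
  evaluation = begin
    Λ κ R ∙ ((Q′ (- + 1 * t₃) 1 3 ∙ Q′ (- + 1 * t₃) 2 3) ∙ Q′ (- + 1 * t) 1 1)
      ≈⟨ PS.*-congˡ (PS.trans (∏-∙ (Unit-∙ (Unit-Q′ (- + 1 * t₃) 0 2) (Unit-Q′ (- + 1 * t₃) 1 2)) (Unit-Q′ (- + 1 * t) 0 0))
           (PS.*-congʳ (∏-∙ (Unit-Q′ (- + 1 * t₃) 0 2) (Unit-Q′ (- + 1 * t₃) 1 2)))) ⟨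
    Λ κ R ∙ ∏ den ≈⟨ evaluate ⟩
    ((κ (+ 0) * + 2) · one) ∙ ∏ num
      ≈⟨ PS.*-congˡ (PS.trans (∏-∙ (Unit-∙ (Unit-E (- + 1) 2 2) (Unit-E (+ 1) 0 0)) (Unit-Q′ (+ 1 * t) 0 0))
           (PS.*-congʳ (∏-∙ (Unit-E (- + 1) 2 2) (Unit-E (+ 1) 0 0)))) ⟩
    ((κ (+ 0) * + 2) · one) ∙ ((E⁻ 3 3 ∙ E⁺ 1 1) ∙ Q′ (+ 1 * t) 1 1) ∎

  -- Meant for the odd solutions of the recurrence: they see only the constant term of δ₂, at m = 0,
  -- and so obtain zero. This is where the symmetry of the rank counts comes from.
  evaluation-zero : κ (+ 0) ≡ + 0 → Λ κ R ≈ zeroPS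
  evaluation-zero κ₀ = cancelˡ {∏ den} (Monic-∏ Unit-den) (begin
    ∏ den ∙ Λ κ R ≈⟨ PS.*-comm (∏ den) (Λ κ R) ⟩
    Λ κ R ∙ ∏ den ≈⟨ evaluate ⟩
    ((κ (+ 0) * + 2) · one) ∙ ∏ num ≈⟨ PS.*-congʳ (λ n → trans (cong (λ x → x * + 2 * one n) κ₀) (ℤₚ.*-zeroˡ (one n))) ⟩
    zeroPS ∙ ∏ num ≈⟨ PS.zeroˡ (∏ num) ⟩
    zeroPS ≈⟨ PS.zeroʳ (∏ den) ⟨
    ∏ den ∙ zeroPS ∎)

e : ℕ → PS
e i = E⁻ i 6

Monic-e : ∀ i → Monic (e (suc i))
Monic-e i = Monic-∏ (Unit-E (- + 1) i 5)

E13 : E⁻ 1 3 ≈ e 1 ∙ e 4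
E13 = E-split2 (- + 1) 0 2

E23 : E⁻ 2 3 ≈ e 2 ∙ e 5
E23 = E-split2 (- + 1) 1 2

E33 : E⁻ 3 3 ≈ e 3 ∙ e 6
E33 = E-split2 (- + 1) 2 2

E22 : E⁻ 2 2 ≈ e 2 ∙ (e 4 ∙ e 6)
E22 = E-split3 (- + 1) 1 1

E11 : E⁻ 1 1 ≈ (e 1 ∙ (e 3 ∙ e 5)) ∙ (e 2 ∙ (e 4 ∙ e 6))
E11 = PS.trans (E-split2 (- + 1) 0 0) (PS.*-cong (E-split3 (- + 1) 0 1) E22)

-- From (-q; q)(q; q) = (q²; q²) and (q; q) = (q; q²)(q²; q²).
euler : E⁺ 1 1 ∙ (e 1 ∙ (e 3 ∙ e 5)) ≈ one
euler = cancelˡ {E⁻ 2 2} (Monic-∏ (Unit-E (- + 1) 1 1)) (begin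
  E⁻ 2 2 ∙ (E⁺ 1 1 ∙ (e 1 ∙ (e 3 ∙ e 5)))
    ≈⟨ CM.solve 3 (λ x y z → x CM.⊕ (y CM.⊕ z) CM.⊜ y CM.⊕ (z CM.⊕ x)) (λ _ → refl) (E⁻ 2 2) (E⁺ 1 1) (e 1 ∙ (e 3 ∙ e 5)) ⟩
  E⁺ 1 1 ∙ ((e 1 ∙ (e 3 ∙ e 5)) ∙ E⁻ 2 2)
    ≈⟨ PS.*-congˡ (PS.trans (E-split2 (- + 1) 0 0) (PS.*-congʳ (E-split3 (- + 1) 0 1))) ⟨
  E⁺ 1 1 ∙ E⁻ 1 1 ≈⟨ E-double 0 0 ⟩
  E⁻ 2 2 ≈⟨ PS.*-identityʳ (E⁻ 2 2) ⟨
  E⁻ 2 2 ∙ one ∎)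
  where open PS-Reasoning

module At (L K : PS) = Quotients L K (E⁺ 1 1) (E⁺ 1 3) (E⁺ 2 3) (E⁺ 3 3)
  (Q′ (+ 1) 1 1) (Q′ (- + 1) 1 1) (e 1) (e 2) (e 3) (e 4) (e 5) (e 6)

module Facts where
  cc : E⁺ 3 3 ∙ (e 3 ∙ e 6) ≈ e 6
  cc = PS.trans (PS.*-congˡ (PS.sym E33)) (E-double 2 2)

  Pw : E⁺ 1 1 ≈ E⁺ 1 3 ∙ (E⁺ 2 3 ∙ E⁺ 3 3)
  Pw = E-split3 (+ 1) 0 0

  qj : Q′ (+ 1) 1 1 ∙ ((e 1 ∙ (e 3 ∙ e 5)) ∙ (e 2 ∙ (e 4 ∙ e 6))) ≈ e 3 ∙ e 6
  qj = PS.trans (PS.*-congˡ (PS.sym E11)) (PS.trans (Q′-cube (- + 1) 0 0 refl) E33)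

  qP : Q′ (- + 1) 1 1 ∙ E⁺ 1 1 ≈ E⁺ 3 3
  qP = Q′-cube (+ 1) 0 0 refl

open Facts

-- The six functionals modulo 6 and the final linear system.

pick : (a b c d e f : ℤ) → ℕ → ℤ
pick a b c d e f 0 = a
pick a b c d e f 1 = b
pick a b c d e f 2 = c
pick a b c d e f 3 = d
pick a b c d e f 4 = e
pick a b c d e f 5 = f
pick a b c d e f _ = + 0

-- With ω a primitive cube root of unity: z^m at z = 1 and z = -1, then z^m + z^-m at z = ω and z =
-- -ω, then (z^m - z^-m)/(z - 1/z) at the same two.
χ₁ χ₂ χ₃ χ₄ χ₅ χ₆ : ℕ → ℤ
χ₁ = pick (+ 1) (+ 1) (+ 1) (+ 1) (+ 1) (+ 1)
χ₂ = pick (+ 1) (- + 1) (+ 1) (- + 1) (+ 1) (- + 1)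
χ₃ = pick (+ 2) (- + 1) (- + 1) (+ 2) (- + 1) (- + 1)
χ₄ = pick (+ 2) (+ 1) (- + 1) (- + 2) (- + 1) (+ 1)
χ₅ = pick (+ 0) (+ 1) (- + 1) (+ 0) (+ 1) (- + 1)
χ₆ = pick (+ 0) (+ 1) (+ 1) (+ 0) (- + 1) (- + 1)

quotient : ∀ {N N′ D D′} → N ≈ N′ → D ≈ D′ → Monic D′ → (N ⊛ inv D) ∙ D′ ≈ N′
quotient {N} {N′} {D} {D′} en ed md = begin
  (N ⊛ inv D) ∙ D′ ≡⟨ cong (_∙ D′) (∙≡⊛ N (inv D)) ⟨
  (N ∙ inv D) ∙ D′ ≈⟨ PS.*-assoc N (inv D) D′ ⟩
  N ∙ (inv D ∙ D′) ≈⟨ PS.*-cong en (PS.trans (PS.*-congˡ (PS.sym ed)) (PS.trans (PS.*-comm (inv D) D) (inv-∙ {D} (trans (ed 0) md)))) ⟩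
  N′ ∙ one ≈⟨ PS.*-identityʳ N′ ⟩
  N′ ∎
  where open PS-Reasoning

compare : ∀ {L T D N} k → Monic D → L ∙ D ≈ (k · one) ∙ N → T ∙ D ≈ N → L ≈ k · T
compare {L} {T} {D} {N} k md hL hT = PS.trans (cancelˡ {D} {L} {(k · one) ∙ T} md (begin
  D ∙ L ≈⟨ PS.*-comm D L ⟩
  L ∙ D ≈⟨ hL ⟩
  (k · one) ∙ N ≈⟨ PS.*-congˡ hT ⟨
  (k · one) ∙ (T ∙ D) ≈⟨ CM.solve 3 (λ x y z → x CM.⊕ (y CM.⊕ z) CM.⊜ z CM.⊕ (x CM.⊕ y)) (λ _ → refl) (k · one) T D ⟩
  D ∙ ((k · one) ∙ T) ∎)) (PS.trans (·-∙ k one T) (λ n → cong (k *_) (PS.*-identityˡ T n)))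
  where open PS-Reasoning

⊛-to-∙ : ∀ {f f′ g g′} → f ≈ f′ → g ≈ g′ → f ⊛ g ≈ f′ ∙ g′
⊛-to-∙ {f} {f′} {g} {g′} p q = PS.trans (PS.reflexive (sym (∙≡⊛ f g))) (PS.*-cong p q)

^-to-pow : ∀ {f g} n → f ≈ g → f ^ n ≈ pow g n
^-to-pow {f} n p = PS.trans (^-pow f n) (pow-cong n p)

powers : ∀ {x y z x′ y′ z′} i j k → x ≈ x′ → y ≈ y′ → z ≈ z′ →
  (x ^ i) ⊛ (y ^ j) ⊛ (z ^ k) ≈ (pow x′ i ∙ pow y′ j) ∙ pow z′ k
powers {x} {y} {z} {x′} {y′} {z′} i j k p q r = ⊛-to-∙ {(x ^ i) ⊛ (y ^ j)} {pow x′ i ∙ pow y′ j} {z ^ k} {pow z′ k}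
  (⊛-to-∙ {x ^ i} {pow x′ i} {y ^ j} {pow y′ j} (^-to-pow {x} {x′} i p) (^-to-pow {y} {y′} j q)) (^-to-pow {z} {z′} k r)

Monic-powers : ∀ {x y z} i j k → Monic x → Monic y → Monic z → Monic ((pow x i ∙ pow y j) ∙ pow z k)
Monic-powers {x} {y} {z} i j k p q r = Monic-∙ {pow x i ∙ pow y j} {pow z k}
  (Monic-∙ {pow x i} {pow y j} (Monic-pow {x} i p) (Monic-pow {y} j q)) (Monic-pow {z} k r)

J′-E : ∀ a m → J′ a m ≈ (E⁻ a m ∙ E⁻ (m ∸ a) m) ∙ E⁻ m m
J′-E a m = ⊛-to-∙ {poch a m ⊛ poch (m ∸ a) m} {E⁻ a m ∙ E⁻ (m ∸ a) m} {poch m m} {E⁻ m m}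
  (⊛-to-∙ {poch a m} {E⁻ a m} {poch (m ∸ a) m} {E⁻ (m ∸ a) m} (poch-E a m) (poch-E (m ∸ a) m)) (poch-E m m)

j₁ j₂ j₃ : PS
j₁ = (e 1 ∙ e 5) ∙ e 6
j₂ = e 2 ∙ (e 4 ∙ e 6)
j₃ = (e 3 ∙ e 3) ∙ e 6

J′16 : J′ 1 6 ≈ j₁
J′16 = J′-E 1 6

J′36 : J′ 3 6 ≈ j₃
J′36 = J′-E 3 6

J2 : J 2 ≈ j₂
J2 = PS.trans (poch-E 2 2) E22

J6 : J 6 ≈ e 6
J6 = poch-E 6 6

Monic-j₁ : Monic j₁
Monic-j₁ = Monic-∙ {e 1 ∙ e 5} {e 6} (Monic-∙ {e 1} {e 5} (Monic-e 0) (Monic-e 4)) (Monic-e 5)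

Monic-j₂ : Monic j₂
Monic-j₂ = Monic-∙ {e 2} {e 4 ∙ e 6} (Monic-e 1) (Monic-∙ {e 4} {e 6} (Monic-e 3) (Monic-e 5))

Monic-j₃ : Monic j₃
Monic-j₃ = Monic-∙ {e 3 ∙ e 3} {e 6} (Monic-∙ {e 3} {e 3} (Monic-e 2) (Monic-e 2)) (Monic-e 5)

quotientA : ∀ {u x y z u′ x′ y′ z′} n i j k → u ≈ u′ → x ≈ x′ → y ≈ y′ → z ≈ z′ → Monic x′ → Monic y′ → Monic z′ →
  ((u ^ n) ⊛ inv ((x ^ i) ⊛ (y ^ j) ⊛ (z ^ k))) ∙ ((pow x′ i ∙ pow y′ j) ∙ pow z′ k) ≈ pow u′ n
quotientA {u} {x} {y} {z} {u′} {x′} {y′} {z′} n i j k hu hx hy hz mx my mz =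
  quotient {u ^ n} {pow u′ n} {(x ^ i) ⊛ (y ^ j) ⊛ (z ^ k)} {(pow x′ i ∙ pow y′ j) ∙ pow z′ k}
    (^-to-pow {u} {u′} n hu) (powers {x} {y} {z} {x′} {y′} {z′} i j k hx hy hz) (Monic-powers {x′} {y′} {z′} i j k mx my mz)

quotientB : ∀ {u x y u′ x′ y′} n → u ≈ u′ → x ≈ x′ → y ≈ y′ → Monic x′ → Monic y′ →
  ((u ^ n) ⊛ inv (x ⊛ y)) ∙ (x′ ∙ y′) ≈ pow u′ n
quotientB {u} {x} {y} {u′} {x′} {y′} n hu hx hy mx my =
  quotient {u ^ n} {pow u′ n} {x ⊛ y} {x′ ∙ y′} (^-to-pow {u} {u′} n hu) (⊛-to-∙ {x} {x′} {y} {y′} hx hy) (Monic-∙ {x′} {y′} mx my)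

quotientC : ∀ {u x y z u′ x′ y′ z′} n i j k → u ≈ u′ → x ≈ x′ → y ≈ y′ → z ≈ z′ → Monic u′ →
  ((x ^ i) ⊛ (y ^ j) ⊛ (z ^ k) ⊛ inv (u ^ n)) ∙ pow u′ n ≈ (pow x′ i ∙ pow y′ j) ∙ pow z′ k
quotientC {u} {x} {y} {z} {u′} {x′} {y′} {z′} n i j k hu hx hy hz mu =
  quotient {(x ^ i) ⊛ (y ^ j) ⊛ (z ^ k)} {(pow x′ i ∙ pow y′ j) ∙ pow z′ k} {u ^ n} {pow u′ n}
    (powers {x} {y} {z} {x′} {y′} {z′} i j k hx hy hz) (^-to-pow {u} {u′} n hu) (Monic-pow {u′} n mu)

TA-quotient : TA ∙ ((pow j₁ 7 ∙ pow j₂ 4) ∙ pow j₃ 2) ≈ pow (e 6) 12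
TA-quotient = quotientA {J 6} {J′ 1 6} {J 2} {J′ 3 6} {e 6} {j₁} {j₂} {j₃} 12 7 4 2 J6 J′16 J2 J′36 Monic-j₁ Monic-j₂ Monic-j₃

TB-quotient : TB ∙ (j₁ ∙ j₂) ≈ pow (e 6) 3
TB-quotient = quotientB {J 6} {J′ 1 6} {J 2} {e 6} {j₁} {j₂} 3 J6 J′16 J2 Monic-j₁ Monic-j₂

TC-quotient : TC ∙ pow (e 6) 6 ≈ (pow j₁ 5 ∙ pow j₂ 2) ∙ pow j₃ 2
TC-quotient = quotientC {J 6} {J′ 1 6} {J 2} {J′ 3 6} {e 6} {j₁} {j₂} {j₃} 6 5 2 2 J6 J′16 J2 J′36 (Monic-e 5)

rank-at-1 : Λ (mod6 χ₁) R ≈ + 2 · TA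
rank-at-1 = compare {D = (pow j₁ 7 ∙ pow j₂ 4) ∙ pow j₃ 2} (+ 2) (Monic-powers {j₁} {j₂} {j₃} 7 4 2 Monic-j₁ Monic-j₂ Monic-j₃) (cancelˡ {e 3} (Monic-e 2)
  (At.at-1 L K euler cc Pw qj qP (begin
    L ∙ ((((e 1 ∙ e 4) ∙ (e 1 ∙ e 4)) ∙ ((e 2 ∙ e 5) ∙ (e 2 ∙ e 5))) ∙ (J₁ ∙ J₁))
      ≈⟨ PS.*-congˡ (PS.*-cong (PS.*-cong (sq 0 2 E13) (sq 1 2 E23)) (sq 0 0 E11)) ⟨
    L ∙ ((Q′ (- + 2) 1 3 ∙ Q′ (- + 2) 2 3) ∙ Q′ (- + 2) 1 1)
      ≈⟨ evaluation (mod6 χ₁) (+ 2) (+ 2) (mod6-rec χ₁ (+ 2) (+ 1) (below6 refl refl refl refl refl refl))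
           (mod6-rec χ₁ (+ 2) (+ 3) (below6 refl refl refl refl refl refl)) ⟩
    K ∙ ((E⁻ 3 3 ∙ E⁺ 1 1) ∙ Q′ (+ 2) 1 1)
      ≈⟨ PS.*-congˡ (PS.*-cong (PS.*-congʳ E33) (Q′-square (+ 1) 0 0 refl)) ⟩
    K ∙ (((e 3 ∙ e 6) ∙ E⁺ 1 1) ∙ (E⁺ 1 1 ∙ E⁺ 1 1)) ∎))) TA-quotient
  where
  open PS-Reasoning
  L = Λ (mod6 χ₁) R
  K = (+ 2) · one
  J₁ = (e 1 ∙ (e 3 ∙ e 5)) ∙ (e 2 ∙ (e 4 ∙ e 6))
  sq : ∀ a m {f} → E⁻ (suc a) (suc m) ≈ f → Q′ (- + 2) (suc a) (suc m) ≈ f ∙ f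
  sq a m p = PS.trans (Q′-square (- + 1) a m refl) (PS.*-cong p p)

rank-at-−1 : Λ (mod6 χ₂) R ≈ + 2 · TC
rank-at-−1 = compare {D = pow (e 6) 6} (+ 2) (Monic-pow {e 6} 6 (Monic-e 5)) (cancelˡ {e 3} (Monic-e 2)
  (At.at-−1 L K euler cc Pw qj qP (begin
    L ∙ (((E⁺ 1 3 ∙ E⁺ 1 3) ∙ (E⁺ 2 3 ∙ E⁺ 2 3)) ∙ (E⁺ 1 1 ∙ E⁺ 1 1))
      ≈⟨ PS.*-congˡ (PS.*-cong (PS.*-cong (Q′-square (+ 1) 0 2 refl) (Q′-square (+ 1) 1 2 refl)) (Q′-square (+ 1) 0 0 refl)) ⟨
    L ∙ ((Q′ (+ 2) 1 3 ∙ Q′ (+ 2) 2 3) ∙ Q′ (+ 2) 1 1)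
      ≈⟨ evaluation (mod6 χ₂) (- + 2) (- + 2) (mod6-rec χ₂ (- + 2) (+ 1) (below6 refl refl refl refl refl refl))
           (mod6-rec χ₂ (- + 2) (+ 3) (below6 refl refl refl refl refl refl)) ⟩
    K ∙ ((E⁻ 3 3 ∙ E⁺ 1 1) ∙ Q′ (- + 2) 1 1)
      ≈⟨ PS.*-congˡ (PS.*-cong (PS.*-congʳ E33) (PS.trans (Q′-square (- + 1) 0 0 refl) (PS.*-cong E11 E11))) ⟩
    K ∙ (((e 3 ∙ e 6) ∙ E⁺ 1 1) ∙ (J₁ ∙ J₁)) ∎))) TC-quotient
  where
  open PS-Reasoning
  L = Λ (mod6 χ₂) R
  K = (+ 2) · one
  J₁ = (e 1 ∙ (e 3 ∙ e 5)) ∙ (e 2 ∙ (e 4 ∙ e 6))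

-- Here z³ = 1, so the factors in z³ are the same as at z = 1, while z + 1/z = -1 gives the cubic
-- products. The constant is 4 because χ₃ takes the value 2 at 0.
rank-at-ω : Λ (mod6 χ₃) R ≈ + 4 · TB
rank-at-ω = compare {D = j₁ ∙ j₂} (+ 4) (Monic-∙ {j₁} {j₂} Monic-j₁ Monic-j₂) (cancelˡ {V} monic-V
  (At.at-ω L K euler cc Pw qj qP (begin
    L ∙ ((((e 1 ∙ e 4) ∙ (e 1 ∙ e 4)) ∙ ((e 2 ∙ e 5) ∙ (e 2 ∙ e 5))) ∙ Q′ (+ 1) 1 1)
      ≈⟨ PS.*-congˡ (PS.*-congʳ (PS.*-cong (sq 0 2 E13) (sq 1 2 E23))) ⟨
    L ∙ ((Q′ (- + 2) 1 3 ∙ Q′ (- + 2) 2 3) ∙ Q′ (+ 1) 1 1)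
      ≈⟨ evaluation (mod6 χ₃) (- + 1) (+ 2) (mod6-rec χ₃ (- + 1) (+ 1) (below6 refl refl refl refl refl refl))
           (mod6-rec χ₃ (+ 2) (+ 3) (below6 refl refl refl refl refl refl)) ⟩
    K ∙ ((E⁻ 3 3 ∙ E⁺ 1 1) ∙ Q′ (- + 1) 1 1) ≈⟨ PS.*-congˡ (PS.*-congʳ (PS.*-congʳ E33)) ⟩
    K ∙ (((e 3 ∙ e 6) ∙ E⁺ 1 1) ∙ Q′ (- + 1) 1 1) ∎))) TB-quotient
  where
  open PS-Reasoning
  L = Λ (mod6 χ₃) R
  K = (+ 4) · one
  V = (e 1 ∙ (e 2 ∙ (e 4 ∙ e 5))) ∙ (e 3 ∙ e 3)
  monic-V : Monic V
  monic-V = Monic-∙ {e 1 ∙ (e 2 ∙ (e 4 ∙ e 5))} {e 3 ∙ e 3} (Monic-∙ {e 1} {e 2 ∙ (e 4 ∙ e 5)} (Monic-e 0)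
    (Monic-∙ {e 2} {e 4 ∙ e 5} (Monic-e 1) (Monic-∙ {e 4} {e 5} (Monic-e 3) (Monic-e 4)))) (Monic-∙ {e 3} {e 3} (Monic-e 2) (Monic-e 2))
  sq : ∀ a m {f} → E⁻ (suc a) (suc m) ≈ f → Q′ (- + 2) (suc a) (suc m) ≈ f ∙ f
  sq a m p = PS.trans (Q′-square (- + 1) a m refl) (PS.*-cong p p)

rank-at-−ω : Λ (mod6 χ₄) R ≈ + 4 · TB
rank-at-−ω = compare {D = j₁ ∙ j₂} (+ 4) (Monic-∙ {j₁} {j₂} Monic-j₁ Monic-j₂) (cancelˡ {e 3} (Monic-e 2)
  (At.at-−ω L K euler cc Pw qj qP (begin
    L ∙ (((E⁺ 1 3 ∙ E⁺ 1 3) ∙ (E⁺ 2 3 ∙ E⁺ 2 3)) ∙ Q′ (- + 1) 1 1)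
      ≈⟨ PS.*-congˡ (PS.*-congʳ (PS.*-cong (Q′-square (+ 1) 0 2 refl) (Q′-square (+ 1) 1 2 refl))) ⟨
    L ∙ ((Q′ (+ 2) 1 3 ∙ Q′ (+ 2) 2 3) ∙ Q′ (- + 1) 1 1)
      ≈⟨ evaluation (mod6 χ₄) (+ 1) (- + 2) (mod6-rec χ₄ (+ 1) (+ 1) (below6 refl refl refl refl refl refl))
           (mod6-rec χ₄ (- + 2) (+ 3) (below6 refl refl refl refl refl refl)) ⟩
    K ∙ ((E⁻ 3 3 ∙ E⁺ 1 1) ∙ Q′ (+ 1) 1 1) ≈⟨ PS.*-congˡ (PS.*-congʳ (PS.*-congʳ E33)) ⟩
    K ∙ (((e 3 ∙ e 6) ∙ E⁺ 1 1) ∙ Q′ (+ 1) 1 1) ∎))) TB-quotient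
  where
  open PS-Reasoning
  L = Λ (mod6 χ₄) R
  K = (+ 4) · one

rank-odd₁ : Λ (mod6 χ₅) R ≈ zeroPS
rank-odd₁ = evaluation-zero (mod6 χ₅) (- + 1) (+ 2) (mod6-rec χ₅ (- + 1) (+ 1) (below6 refl refl refl refl refl refl))
  (mod6-rec χ₅ (+ 2) (+ 3) (below6 refl refl refl refl refl refl)) refl

rank-odd₂ : Λ (mod6 χ₆) R ≈ zeroPS
rank-odd₂ = evaluation-zero (mod6 χ₆) (+ 1) (- + 2) (mod6-rec χ₆ (+ 1) (+ 1) (below6 refl refl refl refl refl refl))
  (mod6-rec χ₆ (- + 2) (+ 3) (below6 refl refl refl refl refl refl)) refl

-- Inversion of the 6 × 6 system. Together c₅ and c₆ say that N 1 = N 5 and N 2 = N 4.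
module Solve (N : ℕ → ℤ) (x y z : ℤ)
  (c₁ : combine6 χ₁ N ≡ + 2 * x) (c₂ : combine6 χ₂ N ≡ + 2 * z) (c₃ : combine6 χ₃ N ≡ + 4 * y) (c₄ : combine6 χ₄ N ≡ + 4 * y)
  (c₅ : combine6 χ₅ N ≡ + 0) (c₆ : combine6 χ₆ N ≡ + 0) where

  private
    A = N 0
    B = N 1
    C = N 2
    D = N 3
    F′ = N 4
    G = N 5

  -- The average over all six sixth roots of unity, where χ₃ and χ₄ account for two roots each.
  solve-0 : + 3 * N 0 ≡ x + + 4 * y + z
  solve-0 = ℤₚ.*-cancelˡ-≡ (+ 2) _ _ (trans (l A B C D F′ G)
    (trans (cong₂ _+_ (cong₂ _+_ (cong₂ _+_ c₁ c₂) c₃) c₄) (r x y z)))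
    where
    l : ∀ a b c d e f → + 2 * (+ 3 * a) ≡
      (+ 1 * a + + 1 * b + + 1 * c + + 1 * d + + 1 * e + + 1 * f) + (+ 1 * a + - + 1 * b + + 1 * c + - + 1 * d + + 1 * e + - + 1 * f) +
      (+ 2 * a + - + 1 * b + - + 1 * c + + 2 * d + - + 1 * e + - + 1 * f) + (+ 2 * a + + 1 * b + - + 1 * c + - + 2 * d + - + 1 * e + + 1 * f)
    l = solve-∀
    r : ∀ x y z → + 2 * x + + 2 * z + + 4 * y + + 4 * y ≡ + 2 * (x + + 4 * y + z)
    r = solve-∀

  solve-3 : + 3 * N 3 ≡ x - z
  solve-3 = ℤₚ.*-cancelˡ-≡ (+ 2) _ _ (trans (l A B C D F′ G)
    (trans (cong₂ _-_ (cong₂ _+_ (cong₂ _-_ c₁ c₂) c₃) c₄) (r x y z)))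
    where
    l : ∀ a b c d e f → + 2 * (+ 3 * d) ≡
      (+ 1 * a + + 1 * b + + 1 * c + + 1 * d + + 1 * e + + 1 * f) - (+ 1 * a + - + 1 * b + + 1 * c + - + 1 * d + + 1 * e + - + 1 * f) +
      (+ 2 * a + - + 1 * b + - + 1 * c + + 2 * d + - + 1 * e + - + 1 * f) - (+ 2 * a + + 1 * b + - + 1 * c + - + 2 * d + - + 1 * e + + 1 * f)
    l = solve-∀
    r : ∀ x y z → + 2 * x - + 2 * z + + 4 * y - + 4 * y ≡ + 2 * (x - z)
    r = solve-∀

  -- The even functionals see N 1 and N 5 only through their sum; c₅ and c₆ separate them.
  solve-1 : + 3 * N 1 ≡ x - z
  solve-1 = ℤₚ.*-cancelˡ-≡ (+ 4) _ _ (trans (l A B C D F′ G)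
    (trans (cong₂ _+_ (cong₂ _+_ (cong₂ _-_ (cong₂ _-_ (cong (+ 2 *_) c₁) (cong (+ 2 *_) c₂)) c₃) c₄)
      (cong₂ (λ u v → + 3 * (u + v)) c₅ c₆)) (r x y z)))
    where
    l : ∀ a b c d e f → + 4 * (+ 3 * b) ≡
      + 2 * (+ 1 * a + + 1 * b + + 1 * c + + 1 * d + + 1 * e + + 1 * f) - + 2 * (+ 1 * a + - + 1 * b + + 1 * c + - + 1 * d + + 1 * e + - + 1 * f) -
      (+ 2 * a + - + 1 * b + - + 1 * c + + 2 * d + - + 1 * e + - + 1 * f) + (+ 2 * a + + 1 * b + - + 1 * c + - + 2 * d + - + 1 * e + + 1 * f) +
      + 3 * ((+ 0 * a + + 1 * b + - + 1 * c + + 0 * d + + 1 * e + - + 1 * f) + (+ 0 * a + + 1 * b + + 1 * c + + 0 * d + - + 1 * e + - + 1 * f))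
    l = solve-∀
    r : ∀ x y z → + 2 * (+ 2 * x) - + 2 * (+ 2 * z) - + 4 * y + + 4 * y + + 3 * (+ 0 + + 0) ≡ + 4 * (x - z)
    r = solve-∀

  solve-2 : + 3 * N 2 ≡ x - + 2 * y + z
  solve-2 = ℤₚ.*-cancelˡ-≡ (+ 4) _ _ (trans (l A B C D F′ G)
    (trans (cong₂ _+_ (cong₂ _-_ (cong₂ _-_ (cong₂ _+_ (cong (+ 2 *_) c₁) (cong (+ 2 *_) c₂)) c₃) c₄)
      (cong₂ (λ u v → + 3 * (v - u)) c₅ c₆)) (r x y z)))
    where
    l : ∀ a b c d e f → + 4 * (+ 3 * c) ≡
      + 2 * (+ 1 * a + + 1 * b + + 1 * c + + 1 * d + + 1 * e + + 1 * f) + + 2 * (+ 1 * a + - + 1 * b + + 1 * c + - + 1 * d + + 1 * e + - + 1 * f) -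
      (+ 2 * a + - + 1 * b + - + 1 * c + + 2 * d + - + 1 * e + - + 1 * f) - (+ 2 * a + + 1 * b + - + 1 * c + - + 2 * d + - + 1 * e + + 1 * f) +
      + 3 * ((+ 0 * a + + 1 * b + + 1 * c + + 0 * d + - + 1 * e + - + 1 * f) - (+ 0 * a + + 1 * b + - + 1 * c + + 0 * d + + 1 * e + - + 1 * f))
    l = solve-∀
    r : ∀ x y z → + 2 * (+ 2 * x) + + 2 * (+ 2 * z) - + 4 * y - + 4 * y + + 3 * (+ 0 - + 0) ≡ + 4 * (x - + 2 * y + z)
    r = solve-∀

module Residues (n : ℕ) = Solve (λ s → rbar s 1 n) (TA n) (TB n) (TC n)
  (trans (sym (Λ-rbar χ₁ n)) (rank-at-1 n)) (trans (sym (Λ-rbar χ₂ n)) (rank-at-−1 n))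
  (trans (sym (Λ-rbar χ₃ n)) (rank-at-ω n)) (trans (sym (Λ-rbar χ₄ n)) (rank-at-−ω n))
  (trans (sym (Λ-rbar χ₅ n)) (rank-odd₁ n)) (trans (sym (Λ-rbar χ₆ n)) (rank-odd₂ n))

theorem5p8 : (∀ (n : ℕ) → ((+ 3) · rbar 0 1) n ≡ (TA ⊕ (+ 4) · TB ⊕ TC) n)
    × (∀ (n : ℕ) → ((+ 3) · rbar 1 1) n ≡ (TA ⊖ TC) n)
    × (∀ (n : ℕ) → ((+ 3) · rbar 2 1) n ≡ (TA ⊖ (+ 2) · TB ⊕ TC) n)
    × (∀ (n : ℕ) → ((+ 3) · rbar 3 1) n ≡ (TA ⊖ TC) n)
theorem5p8 = Residues.solve-0 , Residues.solve-1 , Residues.solve-2 , Residues.solve-3
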